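{- Let $\Sigma$ be a finite alphabet. For any $\Sigma$-labeled graph $G$, the following statements are equivalent: 1. $G$ is isomorphic to the transition graph $G_M$ of a (normalized) labeled linearly bounded Turing machine $M$ with input alphabet $\Sigma$; 2. $G$ is isomorphic to the $\Sigma$-labeled Cayley-type graph of a finite length-decreasing word rewriting system; 3. $G$ is isomorphic to the transduction graph of a finite set $(T_a)_{a\in\Sigma}$ of incremental context-sensitive transductions.
   Context: Graphs. A $\Sigma$-labeled graph is a set $G\subseteq V\times\Sigma\times V$ with $\Sigma$ finite and $V$ countable; its set of vertices (support) $V_G$ is the set of all sources and targets of its edges. Two graphs $G,H$ are isomorphic if there is a bijection $\rho:V_H\to V_G$ with $(x,a,y)\in H$ iff $(\rho(x),a,\rho(y))\in G$. The empty word is denoted $\varepsilon$. Labeled linearly bounded Turing machines (LLBMs). An LLBM is a tuple $M=(\Gamma,\Sigma,[,],Q,q_0,F,\delta)$ where $\Gamma$ is a finite set of tape symbols, $\Sigma\subseteq\Gamma$ is the input alphabet, $[,]\notin\Gamma$ are the left and right end-markers, $Q$ is a finite set of control states disjoint from $\Gamma$, $q_0\in Q$ is the initial state, $F\subseteq Q$ is the set of final states, and $\delta$ is a finite set of labeled rules of the forms $pA\xrightarrow{\varepsilon}qB\pm$, $p[\,\xrightarrow{\varepsilon}q[+$, $p]\xrightarrow{\varepsilon}q]-$, $pB\xrightarrow{a}qAB$, $p]\xrightarrow{a}qA]$, $pA\xrightarrow{\varepsilon}q$, with $p,q\in Q$, $A,B\in\Gamma$, $\pm\in\{+,-\}$,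 $a\in\Sigma$. A configuration is a word $uqv$ with $q\in Q$, $v\neq\varepsilon$ and $uv\in[\Gamma^*]$ (left marker, then a word over $\Gamma$, then right marker). For $x\in\Sigma\cup\{\varepsilon\}$ the relation $\xrightarrow{x}$ on configurations consists of the following pairs, where $X,Y\in\Gamma\cup\{[,]\}$: $upXv\xrightarrow{x}uYqv$ if $pX\xrightarrow{x}qY+\in\delta$; $uCpXv\xrightarrow{x}uqCYv$ if $pX\xrightarrow{x}qY-\in\delta$; $upAv\xrightarrow{\varepsilon}uqv$ if $pA\xrightarrow{\varepsilon}q\in\delta$; $upXv\xrightarrow{a}uqAXv$ if $pX\xrightarrow{a}qAX\in\delta$. Normalized LLBMs. $M$ is normalized if $Q$ is the disjoint union of $Q_\Sigma$ (external states) and $Q_\varepsilon$ (internal states) such that $F\subseteq Q_\Sigma$, every rule labeled by a letter of $\Sigma$ has its left-hand state $p$ in $Q_\Sigma$, every rule labeled by $\varepsilon$ has its left-hand state $p$ in $Q_\varepsilon$, and for every $p\in Q_\varepsilon$ and $X\in\Gamma\cup\{[,]\}$ there is a rule of the form $pX\xrightarrow{\varepsilon}qY\pm$ in $\delta$. A configuration is external if its control state is in $Q_\Sigma$. Transition graph. For a normalized LLBM $M$, $G_M=\{(c,a,c')\mid a\in\Sigma,\ c,c' \text{ external configurations, } c\xrightarrow{a\varepsilon^*}c'\}$, where $c\xrightarrow{a\varepsilon^*}c'$ means one $a$-transition followed by finitely many (possibly zero) $\varepsilon$-transitions. Cayley-type graphs. A word rewriting system over a finite alphabet $\Gamma$ is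 a set $R\subseteq\Gamma^*\times\Gamma^*$ of rules $l\to r$; its rewriting relation is $\{(ulv,urv)\mid u,v\in\Gamma^*,\ l\to r\in R\}$ and $R^*$ is the reflexive-transitive closure of that relation. $\mathrm{NF}(R)$ is the set of words containing no left-hand side of $R$ as a factor. $R$ is finite length-decreasing if it has finitely many rules and $|l|\ge|r|$ for every rule. For $\Sigma\subseteq\Gamma$, the $\Sigma$-labeled Cayley-type graph of $R$ is $\{(u,a,v)\mid a\in\Sigma,\ u,v\in\mathrm{NF}(R),\ ua\,R^*\,v\}$. Transduction graphs. For $k\in\mathbb N$, a relation $T\subseteq\Gamma^*\times\Gamma^*$ ($\Gamma$ a finite alphabet) is a $k$-incremental context-sensitive transduction if $|v|\le|u|+k$ for all $(u,v)\in T$ and the language $\{u\#v\mid(u,v)\in T\}$ is context-sensitive, where $\#\notin\Gamma$. It is incremental if it is $k$-incremental for some $k$. The transduction graph of $(T_a)_{a\in\Sigma}$ (all over the same alphabet) is $\{(u,a,v)\mid a\in\Sigma,\ (u,v)\in T_a\}$. A context-sensitive language is one accepted by a nondeterministic linearly bounded Turing machine. -}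

module Defs where

open import Data.Fin using (Fin)
open import Data.List using (List; []; _∷_; [_]; _++_; _∷ʳ_; map; length)
open import Data.List.Membership.Propositional using (_∈_)
open import Data.List.Relation.Unary.All using (All)
open import Data.Maybe using (Maybe; just; nothing)
open import Data.Nat using (ℕ; _≤_; _+_)
open import Data.Product using (Σ; ∃; ∃₂; _×_; _,_; proj₁)
open import Data.Sum using (_⊎_)
open import Function using (_↔_; _↣_; _⇔_; Bijection; Injection)
open import Level using (0ℓ)
open import Relation.Binary using (Rel; Setoid)
import Relation.Binary.Construct.On as On
open import Relation.Binary.Construct.Closure.ReflexiveTransitive using (Star)
open import Relation.Binary.PropositionalEquality using (_≡_; _≢_; setoid)
open import Relation.Unary using (Pred)

Finite : Set → Set
Finite A = ∃ λ n → A ↔ Fin n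

Countable : Set → Set
Countable A = A ↣ ℕ

------------------------------------------------------------------------
-- Labeled graphs

Graph : Set → Set → Set₁
Graph V A = Pred (V × A × V) 0ℓ

module _ {V A : Set} where

  InSupport : Graph V A → Pred V 0ℓ
  InSupport G x = ∃₂ λ a y → G (x , a , y) ⊎ G (y , a , x)

  -- Vertices are compared by their underlying elements of V only: the
  -- edge witnessing membership in the support is irrelevant.
  Support : Graph V A → Setoid 0ℓ 0ℓ
  Support G = On.setoid {B = Σ V (InSupport G)} (setoid V) proj₁

infix 4 _≅_

_≅_ : {V W A : Set} → Graph V A → Graph W A → Set
_≅_ {A = A} G H =
  Σ (Bijection (Support H) (Support G)) λ ρ →
    let vertex = λ x → proj₁ (Bijection.to ρ x) in
    ∀ (x : Setoid.Carrier (Support H)) (a : A) (y : Setoid.Carrier (Support H)) →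
    H (proj₁ x , a , proj₁ y) ⇔ G (vertex x , a , vertex y)

------------------------------------------------------------------------
-- Tapes and configurations

data Cell (Γ : Set) : Set where
  ⟦ ⟧ : Cell Γ
  sym : Γ → Cell Γ

-- u ⟨ q ⟩ v stands for the word u q v.  As states and cells are
-- disjoint, a word containing exactly one state determines u, q and v.
record StateWord (Q Γ : Set) : Set where
  constructor _⟨_⟩_
  field
    before : List (Cell Γ)
    state  : Q
    after  : List (Cell Γ)

open StateWord public

module _ {Q Γ : Set} where

  IsConfiguration : Pred (StateWord Q Γ) 0ℓ
  IsConfiguration c =
    after c ≢ [] × ∃ λ w → before c ++ after c ≡ ⟦ ∷ map sym w ++ [ ⟧ ]

data Direction : Set where
  ⊕ ⊖ : Direction

-- Allowed X Y d: rules p X → q Y d may occur in a machine.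
data Allowed {Γ : Set} : Cell Γ → Cell Γ → Direction → Set where
  inner : ∀ A B d → Allowed (sym A) (sym B) d
  left  : Allowed ⟦ ⟦ ⊕
  right : Allowed ⟧ ⟧ ⊖

record MoveRule (Q Γ : Set) : Set where
  constructor move
  field
    source    : Q
    read      : Cell Γ
    target    : Q
    write     : Cell Γ
    direction : Direction
    allowed   : Allowed read write direction

data MoveStep {Q Γ : Set} : MoveRule Q Γ → Rel (StateWord Q Γ) 0ℓ where
  forward : ∀ {p X q Y s u v} →
      MoveStep (move p X q Y ⊕ s) (u ⟨ p ⟩ (X ∷ v)) ((u ∷ʳ Y) ⟨ q ⟩ v)
  backward : ∀ {p X q Y s u C v} →
      MoveStep (move p X q Y ⊖ s)
               ((u ∷ʳ C) ⟨ p ⟩ (X ∷ v)) (u ⟨ q ⟩ (C ∷ Y ∷ v))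

------------------------------------------------------------------------
-- Labeled linearly bounded Turing machines

data NotLeftMarker {Γ : Set} : Cell Γ → Set where
  sym : ∀ B → NotLeftMarker (sym B)
  ⟧   : NotLeftMarker ⟧

-- insert p X a q A is the rule  p X –a→ q A X ;
-- delete p A q     is the rule  p A –ε→ q .
data Rule (Q Γ A : Set) : Set where
  ofMove : MoveRule Q Γ → Rule Q Γ A
  insert : Q → (X : Cell Γ) → A → Q → Γ → NotLeftMarker X → Rule Q Γ A
  delete : Q → Γ → Q → Rule Q Γ A

module _ {Q Γ A : Set} where

  lhsState : Rule Q Γ A → Q
  lhsState (ofMove r)           = MoveRule.source r
  lhsState (insert p _ _ _ _ _) = p
  lhsState (delete p _ _)       = p

  -- nothing represents ε.
  label : Rule Q Γ A → Maybe A
  label (ofMove _)           = nothing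
  label (insert _ _ a _ _ _) = just a
  label (delete _ _ _)       = nothing

record LLBM (A : Set) : Set₁ where
  field
    Γ        : Set
    Γ-finite : Finite Γ
    input    : A ↣ Γ
    Q        : Set
    Q-finite : Finite Q
    q₀       : Q
    F        : List Q
    δ        : List (Rule Q Γ A)

module _ {A : Set} (M : LLBM A) where
  open LLBM M

  -- Every step from a configuration leads to a configuration.
  data Step : Maybe A → Rel (StateWord Q Γ) 0ℓ where
    moving    : ∀ {r c c′} → ofMove r ∈ δ → MoveStep r c c′ → Step nothing c c′
    deleting  : ∀ {p B q u v} → delete p B q ∈ δ →
                Step nothing (u ⟨ p ⟩ (sym B ∷ v)) (u ⟨ q ⟩ v)
    inserting : ∀ {p X a q B s u v} → insert p X a q B s ∈ δ →
                Step (just a) (u ⟨ p ⟩ (X ∷ v)) (u ⟨ q ⟩ (sym B ∷ X ∷ v))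

data Kind : Set where
  external internal : Kind

record Normalized {A : Set} (M : LLBM A) : Set where
  open LLBM M
  field
    kind           : Q → Kind
    final-external : ∀ {q} → q ∈ F → kind q ≡ external
    letter-rules   : ∀ {r a} → r ∈ δ → label r ≡ just a → kind (lhsState r) ≡ external
    ε-rules        : ∀ {r} → r ∈ δ → label r ≡ nothing → kind (lhsState r) ≡ internal
    total          : ∀ p (X : Cell Γ) → kind p ≡ internal →
                     ∃ λ q → ∃ λ Y → ∃ λ d → ∃ λ s → ofMove (move p X q Y d s) ∈ δ

module _ {A : Set} (M : LLBM A) (N : Normalized M) where
  open LLBM M
  open Normalized N

  IsExternalConfiguration : Pred (StateWord Q Γ) 0ℓ
  IsExternalConfiguration c = IsConfiguration c × kind (state c) ≡ external

  transitionGraph : Graph (StateWord Q Γ) A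
  transitionGraph (c , a , c′) =
    IsExternalConfiguration c × IsExternalConfiguration c′ ×
    ∃ λ d → Step M (just a) c d × Star (Step M nothing) d c′

------------------------------------------------------------------------
-- Word rewriting

RewritingSystem : Set → Set
RewritingSystem Γ = List (List Γ × List Γ)

module _ {Γ : Set} (R : RewritingSystem Γ) where

  data Rewrite : Rel (List Γ) 0ℓ where
    rewriting : ∀ {l r} u v → (l , r) ∈ R → Rewrite (u ++ l ++ v) (u ++ r ++ v)

  NF : Pred (List Γ) 0ℓ
  NF w = ∀ {l r} u v → (l , r) ∈ R → w ≢ u ++ l ++ v

  LengthDecreasing : Set
  LengthDecreasing = All (λ { (l , r) → length r ≤ length l }) R

  cayleyGraph : {A : Set} → A ↣ Γ → Graph (List Γ) A
  cayleyGraph ι (u , a , v) =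
    NF u × NF v × Star Rewrite (u ++ [ Injection.to ι a ]) v

------------------------------------------------------------------------
-- Context-sensitive languages and transductions

-- Nondeterministic linearly bounded Turing machines: the head stays
-- between the end-markers, which are never overwritten.
record LBM (A : Set) : Set₁ where
  field
    Γ        : Set
    Γ-finite : Finite Γ
    input    : A ↣ Γ
    Q        : Set
    Q-finite : Finite Q
    q₀       : Q
    F        : List Q
    δ        : List (MoveRule Q Γ)

  LBMStep : Rel (StateWord Q Γ) 0ℓ
  LBMStep c c′ = ∃ λ r → r ∈ δ × MoveStep r c c′

  initial : List A → StateWord Q Γ
  initial w =
    [ ⟦ ] ⟨ q₀ ⟩ (map (λ a → sym (Injection.to input a)) w ++ [ ⟧ ])

  Accepts : Pred (List A) 0ℓ
  Accepts w = ∃ λ c → Star LBMStep (initial w) c × state c ∈ F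

ContextSensitive : {A : Set} → Pred (List A) 0ℓ → Set₁
ContextSensitive {A} L = Σ (LBM A) λ M → ∀ w → L w ⇔ LBM.Accepts M w

Transduction : Set → Set₁
Transduction Γ = Pred (List Γ × List Γ) 0ℓ

module _ {Γ : Set} (T : Transduction Γ) where

  -- The language of all u # v with (u , v) in T, over Maybe Γ, where
  -- nothing plays the role of the fresh letter #.
  graphLanguage : Pred (List (Maybe Γ)) 0ℓ
  graphLanguage w =
    ∃₂ λ u v → T (u , v) × w ≡ map just u ++ nothing ∷ map just v

  IncrementalBy : ℕ → Set
  IncrementalBy k = ∀ {u v} → T (u , v) → length v ≤ length u + k

  IncrementalContextSensitive : Set₁
  IncrementalContextSensitive = ∃ λ k → IncrementalBy k × ContextSensitive graphLanguage

transductionGraph : {Γ A : Set} → (A → Transduction Γ) → Graph (List Γ) A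
transductionGraph T (u , a , v) = T a (u , v)

------------------------------------------------------------------------
-- The three presentations of a graph

module _ {V A : Set} (G : Graph V A) where

  IsTransitionGraph : Set₁
  IsTransitionGraph =
    Σ (LLBM A) λ M → Σ (Normalized M) λ N → G ≅ transitionGraph M N

  IsCayleyTypeGraph : Set₁
  IsCayleyTypeGraph =
    Σ Set λ Γ → Finite Γ × Σ (A ↣ Γ) λ ι → Σ (RewritingSystem Γ) λ R →
    LengthDecreasing R × G ≅ cayleyGraph R ι

  IsTransductionGraph : Set₁
  IsTransductionGraph =
    Σ Set λ Γ → Finite Γ × Σ (A → Transduction Γ) λ T →
    (∀ a → IncrementalContextSensitive (T a)) × G ≅ transductionGraph T

{-# OPTIONS --safe #-}
module Submission where

-- The three presentations are translated into each other in a cycle.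
--
-- A rewriting system simulates a normalized machine on words u q v; the
-- letter appended at the right end travels to the head, and rules l → l
-- exclude the words that are not external configurations from the normal
-- forms.
--
-- The machines needed for the other two translations are sweep machines,
-- whose head runs from end to end while a finite transducer rewrites the
-- tape; they simulate every rewriting system within the space of the tape.
-- So u # v is accepted by rewriting u a and matching the result with v.  A
-- labeled machine for transductions guesses v and simulates the acceptor of
-- u # v.  As it gains a single cell per letter, each of its cells holds a
-- block of letters, so that k-incremental growth fits into the new cell.

open import Defs
open import Data.Bool using (Bool; true; false)
open import Data.Empty using (⊥; ⊥-elim)
open import Data.Fin using (Fin; zero; suc)
import Data.Fin.Properties as Fin
open import Data.List using (List; []; _∷_; [_]; _++_; _∷ʳ_; map; length; filter; allFin; concat; concatMap;
  catMaybes; replicate; take; foldr; initLast; _∷ʳ′_)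
open import Data.List.Membership.Propositional using (_∈_)
open import Data.List.Membership.Propositional.Properties using (∈-map⁺; ∈-map⁻; ∈-filter⁺; ∈-filter⁻; ∈-allFin;
  ∈-++⁺ˡ; ∈-++⁺ʳ; ∈-++⁻; ∈-concat⁺′; ∈-concat⁻′)
open import Data.List.Properties
open import Data.List.Relation.Unary.All as All using (All; []; _∷_)
import Data.List.Relation.Unary.All.Properties as All
open import Data.List.Relation.Unary.Any as Any using (here; there)
open import Data.List.Extrema.Nat using (max; xs≤max)
open import Data.Maybe as Maybe using (Maybe; just; nothing)
import Data.Maybe.Properties as Maybe
open import Data.Nat as ℕ using (ℕ; zero; suc; _+_; _*_; _∸_; _≤_; _<_; _⊔_; z≤n; s≤s)
import Data.Nat.Properties as ℕ
open import Data.Product as Product using (Σ; ∃; ∃₂; _×_; _,_; proj₁; proj₂)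
import Data.Product.Properties as Product
open import Data.Product.Function.NonDependent.Propositional using (_×-↔_)
open import Data.Sum as Sum using (_⊎_; inj₁; inj₂)
open import Data.Sum.Function.Propositional using (_⊎-↔_)
import Data.Sum.Properties as Sum
open import Data.Unit using (⊤; tt)
open import Data.Vec as Vec using (Vec; []; _∷_; toList)
import Data.Vec.Properties as Vec
open import Function using (_↔_; _↣_; _⇔_; Injection; Inverse; Equivalence; mk↔ₛ′; mk⇔; mk↣; _∘_; id; case_of_)
import Function.Construct.Composition as Composition
open import Level using (0ℓ)
open import Function.Properties.Inverse using (↔⇒↣; ↔-sym; ↔-trans)
open import Relation.Binary using (Rel; DecidableEquality)
open import Relation.Binary.Construct.Closure.ReflexiveTransitive as Star using (Star; ε; _◅_; _◅◅_)
open import Relation.Binary.PropositionalEquality as ≡ using (_≡_; _≢_; refl; cong; cong₂; subst; subst₂)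
open import Relation.Binary.PropositionalEquality.WithK using (≡-irrelevant)
open import Relation.Nullary using (¬_; Dec; yes; no)
open import Relation.Nullary.Decidable as Dec using (_×-dec_; _⊎-dec_; ¬?)

-- Finite types

-- An isomorphism relates only vertices that lie on edges. A translation therefore consists of an
-- injective coding of the old vertices such that edges go to edges and every new edge joins two
-- codes (`code⇒≅`); words that code nothing are harmless as long as no edge touches them. The last
-- condition is the delicate one. Cutting a word into blocks is not unique, so one cutting is
-- declared canonical, and the sweeps test it at the source and at the target of each edge. A
-- rewriting system sees only short factors, so there the travelling letter does part of the test.
-- Loops `l → l` are admissible because length-decreasing only means `|l| ≥ |r|`. The acceptor of
-- `u # v` overwrites its tape, so a copy of the guessed `v` has to be kept beside it; this copy
-- becomes the next vertex.

abstract
  Finite-↔ : {A B : Set} → A ↔ B → Finite B → Finite A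
  Finite-↔ A↔B (n , B↔Fin) = n , ↔-trans A↔B B↔Fin

  Finite-⊤ : Finite ⊤
  Finite-⊤ = 1 , mk↔ₛ′ (λ _ → zero) (λ _ → tt) (λ { zero → refl }) (λ _ → refl)

  Finite-⊎ : {A B : Set} → Finite A → Finite B → Finite (A ⊎ B)
  Finite-⊎ (m , A↔Fin) (n , B↔Fin) = m + n , ↔-trans (A↔Fin ⊎-↔ B↔Fin) (↔-sym Fin.+↔⊎)

  Finite-× : {A B : Set} → Finite A → Finite B → Finite (A × B)
  Finite-× (m , A↔Fin) (n , B↔Fin) = m * n , ↔-trans (A↔Fin ×-↔ B↔Fin) (↔-sym Fin.*↔×)

  Finite-ΣFin : ∀ n {B : Fin n → Set} → (∀ i → Finite (B i)) → Finite (Σ (Fin n) B)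
  Finite-ΣFin zero    B-finite = 0 , mk↔ₛ′ (λ ()) (λ ()) (λ ()) (λ ())
  Finite-ΣFin (suc n) {B} B-finite =
    Finite-↔ Σ↔⊎ (Finite-⊎ (B-finite zero) (Finite-ΣFin n (λ i → B-finite (suc i))))
    where
    to : Σ (Fin (suc n)) B → B zero ⊎ Σ (Fin n) (λ i → B (suc i))
    to (zero , b)  = inj₁ b
    to (suc i , b) = inj₂ (i , b)
    from : B zero ⊎ Σ (Fin n) (λ i → B (suc i)) → Σ (Fin (suc n)) B
    from (inj₁ b)       = zero , b
    from (inj₂ (i , b)) = suc i , b
    Σ↔⊎ : Σ (Fin (suc n)) B ↔ (B zero ⊎ Σ (Fin n) (λ i → B (suc i)))
    Σ↔⊎ = mk↔ₛ′ to from (λ { (inj₁ b) → refl ; (inj₂ (i , b)) → refl })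
                         (λ { (zero , b) → refl ; (suc i , b) → refl })

module _ {A : Set} (A-finite : Finite A) where

  private
    index : A → Fin (proj₁ A-finite)
    index = Inverse.to (proj₂ A-finite)

    element : Fin (proj₁ A-finite) → A
    element = Inverse.from (proj₂ A-finite)

    element∘index : ∀ x → element (index x) ≡ x
    element∘index = Inverse.strictlyInverseʳ (proj₂ A-finite)

  abstract
    finite-≟ : DecidableEquality A
    finite-≟ = Fin.inj⇒≟ (↔⇒↣ (proj₂ A-finite))

    elements : List A
    elements = map element (allFin (proj₁ A-finite))

    ∈-elements : ∀ x → x ∈ elements
    ∈-elements x = subst (_∈ elements) (element∘index x) (∈-map⁺ element (∈-allFin (index x)))

    ∃? : {P : A → Set} → (∀ x → Dec (P x)) → Dec (∃ P)
    ∃? {P} P? = Dec.map′ (λ { (i , p) → element i , p })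
                         (λ { (x , p) → index x , subst P (≡.sym (element∘index x)) p })
                         (Fin.any? (λ i → P? (element i)))

  module _ {P : A → Set} (P? : ∀ x → Dec (P x)) {R : Set} (f : A → R) where

    abstract
      -- Rules are listed as images of a finite type of instructions cut down by a decidable
      -- condition; `select⁺` and `select⁻` then exchange membership in the list for legality of an
      -- instruction.
      select : List R
      select = map f (filter P? elements)

      select⁺ : ∀ {x} → P x → f x ∈ select
      select⁺ {x} p = ∈-map⁺ f (∈-filter⁺ P? (∈-elements x) p)

      select⁻ : ∀ {r} → r ∈ select → ∃ λ x → P x × r ≡ f x
      select⁻ r∈ with ∈-map⁻ f r∈
      ... | x , x∈ , r≡fx = x , proj₂ (∈-filter⁻ P? {xs = elements} x∈) , r≡fx

abstract
  Finite-Σ : {A : Set} {B : A → Set} → Finite A → (∀ x → Finite (B x)) → Finite (Σ A B)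
  Finite-Σ {A} {B} (n , A↔Fin) B-finite =
    Finite-↔ (mk↔ₛ′ to from to∘from from∘to) (Finite-ΣFin n (λ i → B-finite (element i)))
    where
    element : Fin n → A
    element = Inverse.from A↔Fin
    element∘index : ∀ x → element (Inverse.to A↔Fin x) ≡ x
    element∘index = Inverse.strictlyInverseʳ A↔Fin
    index∘element : ∀ i → Inverse.to A↔Fin (element i) ≡ i
    index∘element = Inverse.strictlyInverseˡ A↔Fin
    to : Σ A B → Σ (Fin n) (λ i → B (element i))
    to (x , b) = Inverse.to A↔Fin x , subst B (≡.sym (element∘index x)) b
    from : Σ (Fin n) (λ i → B (element i)) → Σ A B
    from (i , b) = element i , b
    from∘to : ∀ p → from (to p) ≡ p
    from∘to (x , b) = Product.Σ-≡,≡→≡ (element∘index x , ≡.subst-subst-sym (element∘index x))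
    -- Once `p` is `refl`, `q` is a loop, trivial by uniqueness of identity proofs; the two
    -- transports thus cancel without `q` being built from `p`.
    transport : ∀ {i j} (p : i ≡ j) (q : element j ≡ element i) {b : B (element j)} →
                subst (λ i → B (element i)) p (subst B q b) ≡ b
    transport refl refl = refl
    to∘from : ∀ p → to (from p) ≡ p
    to∘from (i , b) = Product.Σ-≡,≡→≡ (index∘element i , transport (index∘element i) (≡.sym (element∘index (element i))))

  -- A retract of a finite type is finite: it is the set of fixed points of an idempotent map.
  Finite-retract : {A C : Set} → Finite C → (from : C → A) → (∀ x → ∃ λ c → from c ≡ x) → Finite A
  Finite-retract {A} {C} C-finite from section = Finite-↔ A↔fixed (Finite-Σ C-finite fixed-finite)
    where
    to : A → C
    to x = proj₁ (section x)
    Fixed : C → Set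
    Fixed c = to (from c) ≡ c
    fixed-finite : ∀ c → Finite (Fixed c)
    fixed-finite c with finite-≟ C-finite (to (from c)) c
    ... | yes p = 1 , mk↔ₛ′ (λ _ → zero) (λ _ → p) (λ { zero → refl }) (≡-irrelevant p)
    ... | no ¬p = 0 , mk↔ₛ′ (λ p → ⊥-elim (¬p p)) (λ ()) (λ ()) (λ p → ⊥-elim (¬p p))
    A↔fixed : A ↔ Σ C Fixed
    A↔fixed = mk↔ₛ′ (λ x → to x , cong to (proj₂ (section x))) (λ (c , _) → from c)
      (λ (c , fixed) → fixed-≡ fixed _) (λ x → proj₂ (section x))
      where
      fixed-≡ : ∀ {c d} → c ≡ d → {p : Fixed c} (q : Fixed d) → (c , p) ≡ (d , q)
      fixed-≡ refl {p} q = cong (_ ,_) (≡-irrelevant p q)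

  Finite-Maybe : {A : Set} → Finite A → Finite (Maybe A)
  Finite-Maybe A-finite = Finite-retract (Finite-⊎ Finite-⊤ A-finite)
    (λ { (inj₁ _) → nothing ; (inj₂ x) → just x })
    (λ { nothing → inj₁ tt , refl ; (just x) → inj₂ x , refl })

  Finite-Bool : Finite Bool
  Finite-Bool = Finite-retract (Finite-⊎ Finite-⊤ Finite-⊤)
    (λ { (inj₁ _) → true ; (inj₂ _) → false })
    (λ { true → inj₁ tt , refl ; false → inj₂ tt , refl })

  Finite-Cell : {A : Set} → Finite A → Finite (Cell A)
  Finite-Cell A-finite = Finite-retract (Finite-⊎ A-finite Finite-Bool)
    (λ { (inj₁ x) → sym x ; (inj₂ true) → ⟦ ; (inj₂ false) → ⟧ })
    (λ { (sym x) → inj₁ x , refl ; ⟦ → inj₂ true , refl ; ⟧ → inj₂ false , refl })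

  Finite-Vec : {A : Set} → Finite A → ∀ n → Finite (Vec A n)
  Finite-Vec A-finite zero    =
    Finite-↔ (mk↔ₛ′ (λ _ → tt) (λ _ → []) (λ _ → refl) (λ { [] → refl })) Finite-⊤
  Finite-Vec A-finite (suc n) =
    Finite-↔ (mk↔ₛ′ (λ { (x ∷ xs) → x , xs }) (λ { (x , xs) → x ∷ xs }) (λ { (x , xs) → refl }) (λ { (x ∷ xs) → refl }))
             (Finite-× A-finite (Finite-Vec A-finite n))

-- Words of length at most n

BoundedList : Set → ℕ → Set
BoundedList A zero    = ⊤
BoundedList A (suc n) = Maybe (A × BoundedList A n)

abstract
  Finite-BoundedList : {A : Set} → Finite A → ∀ n → Finite (BoundedList A n)
  Finite-BoundedList A-finite zero    = Finite-⊤
  Finite-BoundedList A-finite (suc n) = Finite-Maybe (Finite-× A-finite (Finite-BoundedList A-finite n))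

module _ {A : Set} where

  truncate : ∀ n → List A → BoundedList A n
  truncate zero    _        = tt
  truncate (suc n) []       = nothing
  truncate (suc n) (x ∷ xs) = just (x , truncate n xs)

  word : ∀ {n} → BoundedList A n → List A
  word {zero}  _               = []
  word {suc n} nothing         = []
  word {suc n} (just (x , xs)) = x ∷ word xs

  word-truncate : ∀ n w → length w ≤ n → word (truncate n w) ≡ w
  word-truncate zero    []      _         = refl
  word-truncate (suc n) []      _         = refl
  word-truncate (suc n) (x ∷ w) (s≤s |w|≤n) = cong (x ∷_) (word-truncate n w |w|≤n)

  truncate-word : ∀ {n} (b : BoundedList A n) → truncate n (word b) ≡ b
  truncate-word {zero}  _              = refl
  truncate-word {suc n} nothing        = refl
  truncate-word {suc n} (just (x , b)) = cong (λ b → just (x , b)) (truncate-word b)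

  length-word : ∀ {n} (b : BoundedList A n) → length (word b) ≤ n
  length-word {zero}  _              = z≤n
  length-word {suc n} nothing        = z≤n
  length-word {suc n} (just (x , b)) = s≤s (length-word b)

  word-injective : ∀ {n} {b b′ : BoundedList A n} → word b ≡ word b′ → b ≡ b′
  word-injective {n} {b} {b′} eq =
    ≡.trans (≡.sym (truncate-word b)) (≡.trans (cong (truncate n) eq) (truncate-word b′))

-- Isomorphisms of graphs

module _ {V W X A : Set} {G : Graph V A} {H : Graph W A} {K : Graph X A} where

  ≅-trans : G ≅ H → H ≅ K → G ≅ K
  ≅-trans (ρ , ρ-edges) (τ , τ-edges) =
    Composition.bijection τ ρ ,
    λ x a y → mk⇔ (Equivalence.to (ρ-edges _ a _) ∘ Equivalence.to (τ-edges x a y))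
                  (Equivalence.from (τ-edges x a y) ∘ Equivalence.from (ρ-edges _ a _))

module _ {V W A : Set} {G : Graph V A} {H : Graph W A} (code : V → W)
  (code-injective : ∀ {x y} → InSupport G x → InSupport G y → code x ≡ code y → x ≡ y)
  (code-edge : ∀ {x a y} → G (x , a , y) → H (code x , a , code y))
  (decode-edge : ∀ {s a t} → H (s , a , t) → ∃₂ λ x y → s ≡ code x × t ≡ code y × G (x , a , y)) where

  private
    decode : ∀ {s} → InSupport H s → ∃ λ x → s ≡ code x × InSupport G x
    decode (a , t , inj₁ e) with decode-edge e
    ... | x , y , s≡ , t≡ , g = x , s≡ , a , y , inj₁ g
    decode (a , t , inj₂ e) with decode-edge e
    ... | x , y , s≡ , t≡ , g = y , t≡ , a , x , inj₂ g

    encode : ∀ {x} → InSupport G x → InSupport H (code x)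
    encode (a , y , inj₁ g) = a , code y , inj₁ (code-edge g)
    encode (a , y , inj₂ g) = a , code y , inj₂ (code-edge g)

    to : Σ W (InSupport H) → Σ V (InSupport G)
    to (s , s∈) = proj₁ (decode s∈) , proj₂ (proj₂ (decode s∈))

    code-to : ∀ s → proj₁ s ≡ code (proj₁ (to s))
    code-to (s , s∈) = proj₁ (proj₂ (decode s∈))

    -- `decode` picks a preimage from the edge that witnesses membership in the support, while
    -- vertices are compared without that edge. Injectivity of `code` makes the result independent
    -- of the witness.
    to-unique : ∀ s {x} → InSupport G x → proj₁ s ≡ code x → proj₁ (to s) ≡ x
    to-unique s x∈ s≡ = code-injective (proj₂ (to s)) x∈ (≡.trans (≡.sym (code-to s)) s≡)

  -- `code` need not hit all of `W`: a vertex of `H` lies on an edge, and `decode-edge` shows it to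
  -- be a code. The bijection in `_≅_` runs from `H` back to `G`, hence it is the decoding.
  code⇒≅ : G ≅ H
  code⇒≅ = record
    { to        = to
    ; cong      = λ {s} {t} s≡t → to-unique s (proj₂ (to t)) (≡.trans s≡t (code-to t))
    ; bijective = (λ {s} {t} eq → ≡.trans (code-to s) (≡.trans (cong code eq) (≡.sym (code-to t))))
                , λ { (x , x∈) → (code x , encode x∈) , λ {s} s≡ → to-unique s x∈ s≡ }
    } , λ s a t → mk⇔
      (λ e → let (x , y , s≡ , t≡ , g) = decode-edge e in
        subst₂ (λ x y → G (x , a , y)) (≡.sym (to-unique s (a , y , inj₁ g) s≡))
                                       (≡.sym (to-unique t (a , x , inj₂ g) t≡)) g)
      (λ g → subst₂ (λ s t → H (s , a , t)) (≡.sym (code-to s)) (≡.sym (code-to t)) (code-edge g))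

-- Sweeps

-- Words are read from right to left.
data Run {D X Y : Set} (trans : D → X → Y → D → Set) : D → List X → List Y → D → Set where
  []  : ∀ {d} → Run trans d [] [] d
  _∷_ : ∀ {d d′ d″ x y u v} → trans d′ x y d″ → Run trans d u v d′ → Run trans d (x ∷ u) (y ∷ v) d″

-- The head repeatedly sweeps over the tape from right to left; at the left
-- end it either starts another sweep in a new state or stops.
record SweepMachine (Δ : Set) : Set₁ where
  field
    D        : Set
    D-finite : Finite D
    trans    : D → Δ → Δ → D → Set
    trans?   : ∀ d x y d′ → Dec (trans d x y d′)
    turn     : D → D → Set
    turn?    : ∀ d d′ → Dec (turn d d′)
    stop     : D → Set
    stop?    : ∀ d → Dec (stop d)

  Pass : Rel (D × List Δ) 0ℓ
  Pass (d , w) (d′ , w′) = ∃ λ e → Run trans d w w′ e × turn e d′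

  Computes : D → Rel (List Δ) 0ℓ
  Computes d w w′ = ∃ λ d₁ → ∃ λ w₁ → ∃ λ d₂ →
    Star Pass (d , w) (d₁ , w₁) × Run trans d₁ w₁ w′ d₂ × stop d₂

module _ {Δ : Set} where

  cells : List Δ → List (Cell Δ)
  cells w = map sym w

  tape : List Δ → List (Cell Δ)
  tape w = ⟦ ∷ cells w ++ [ ⟧ ]

  cells-∷ʳ : ∀ w x → cells (w ∷ʳ x) ≡ cells w ∷ʳ sym x
  cells-∷ʳ w x = map-++ sym w [ x ]

  ⟧-last : ∀ p {v} w → p ++ ⟧ ∷ v ≡ tape w → p ≡ ⟦ ∷ cells w × v ≡ []
  ⟧-last (X ∷ p) w eq = Product.map (cong₂ _∷_ (∷-injectiveˡ eq)) id (inside p w (∷-injectiveʳ eq))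
    where
    inside : ∀ p {v} w → p ++ ⟧ ∷ v ≡ cells w ++ [ ⟧ ] → p ≡ cells w × v ≡ []
    inside []          []      eq = refl , ∷-injectiveʳ eq
    inside (X ∷ [])    []      ()
    inside (X ∷ _ ∷ _) []      ()
    inside (X ∷ p)     (x ∷ w) eq = Product.map (cong₂ _∷_ (∷-injectiveˡ eq)) id (inside p w (∷-injectiveʳ eq))

  ∷ʳ-sym-last : ∀ p x w → p ∷ʳ sym x ≡ ⟦ ∷ cells w → ∃ λ w′ → w ≡ w′ ∷ʳ x × p ≡ ⟦ ∷ cells w′
  ∷ʳ-sym-last (X ∷ p) x w eq = Product.map id (Product.map id (cong₂ _∷_ (∷-injectiveˡ eq))) (inside p w (∷-injectiveʳ eq))
    where
    inside : ∀ p w → p ∷ʳ sym x ≡ cells w → ∃ λ w′ → w ≡ w′ ∷ʳ x × p ≡ cells w′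
    inside []          (_ ∷ [])    refl = [] , refl , refl
    inside []          (_ ∷ _ ∷ _) ()
    inside (X ∷ p)     (y ∷ w)     eq with inside p w (∷-injectiveʳ eq)
    ... | w′ , refl , refl = y ∷ w′ , refl , cong (_∷ cells w′) (∷-injectiveˡ eq)

  ∷ʳ-⟦-last : ∀ p w → p ∷ʳ ⟦ ≡ ⟦ ∷ cells w → p ≡ [] × w ≡ []
  ∷ʳ-⟦-last []      []      _  = refl , refl
  ∷ʳ-⟦-last (X ∷ p) w       eq = ⊥-elim (inside p w (∷-injectiveʳ eq))
    where
    inside : ∀ p w → p ∷ʳ ⟦ ≢ cells w
    inside []      (_ ∷ _) ()
    inside (X ∷ p) (_ ∷ w) eq = inside p w (∷-injectiveʳ eq)

module _ {Δ : Set} (𝓜 : SweepMachine Δ) where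
  open SweepMachine 𝓜

  -- `run d` is a sweep in progress. `ret d` takes the head to the right end and remembers the state
  -- in which the next sweep begins; it also serves as initial state, since a linearly bounded
  -- machine starts at the left end.
  data Control : Set where
    run ret : D → Control
    done    : Control

  Finite-Control : Finite Control
  Finite-Control = Finite-retract
    (Finite-⊎ (Finite-⊎ D-finite D-finite) Finite-⊤)
    (λ { (inj₁ (inj₁ d)) → run d
       ; (inj₁ (inj₂ d)) → ret d
       ; (inj₂ tt) → done })
    (λ { (run d) → inj₁ (inj₁ d) , refl
       ; (ret d) → inj₁ (inj₂ d) , refl
       ; done → inj₂ tt , refl })

  data Instruction : Set where
    return : D → Δ → Instruction
    start  : D → Instruction
    rewr   : D → Δ → Δ → D → Instruction
    turn′  : D → D → Instruction
    stop′  : D → Instruction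

  Legal : Instruction → Set
  Legal (return d x)     = ⊤
  Legal (start d)        = ⊤
  Legal (rewr d x y d′)  = trans d x y d′
  Legal (turn′ d d′)     = turn d d′
  Legal (stop′ d)        = stop d

  legal? : ∀ i → Dec (Legal i)
  legal? (return d x)    = yes tt
  legal? (start d)       = yes tt
  legal? (rewr d x y d′) = trans? d x y d′
  legal? (turn′ d d′)    = turn? d d′
  legal? (stop′ d)       = stop? d

  moveRule : Instruction → MoveRule Control Δ
  moveRule (return d x)    = move (ret d) (sym x) (ret d) (sym x) ⊕ (inner x x ⊕)
  moveRule (start d)       = move (ret d) ⟧ (run d) ⟧ ⊖ right
  moveRule (rewr d x y d′) = move (run d) (sym x) (run d′) (sym y) ⊖ (inner x y ⊖)
  moveRule (turn′ d d′)    = move (run d) ⟦ (ret d′) ⟦ ⊕ left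
  moveRule (stop′ d)       = move (run d) ⟦ done ⟦ ⊕ left

  Finite-Instruction : Finite Δ → Finite Instruction
  Finite-Instruction Δ-finite = Finite-retract
    (Finite-⊎ (Finite-× D-finite Δ-finite) (Finite-⊎ D-finite
      (Finite-⊎ (Finite-× D-finite (Finite-× Δ-finite (Finite-× Δ-finite D-finite)))
      (Finite-⊎ (Finite-× D-finite D-finite) D-finite))))
    (λ { (inj₁ (d , x)) → return d x
       ; (inj₂ (inj₁ d)) → start d
       ; (inj₂ (inj₂ (inj₁ (d , x , y , d′)))) → rewr d x y d′
       ; (inj₂ (inj₂ (inj₂ (inj₁ (d , d′))))) → turn′ d d′
       ; (inj₂ (inj₂ (inj₂ (inj₂ d)))) → stop′ d })
    (λ { (return d x) → inj₁ (d , x) , refl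
       ; (start d) → inj₂ (inj₁ d) , refl
       ; (rewr d x y d′) → inj₂ (inj₂ (inj₁ (d , x , y , d′))) , refl
       ; (turn′ d d′) → inj₂ (inj₂ (inj₂ (inj₁ (d , d′)))) , refl
       ; (stop′ d) → inj₂ (inj₂ (inj₂ (inj₂ d))) , refl })

  _⟶_ : Rel (StateWord Control Δ) 0ℓ
  c ⟶ c′ = ∃ λ i → Legal i × MoveStep (moveRule i) c c′

  module _ where
    private
      step : ∀ {c c′} i → Legal i → MoveStep (moveRule i) c c′ → Star _⟶_ c c′
      step i l s = (i , l , s) ◅ ε

    return* : ∀ {d} u w v → Star _⟶_ (u ⟨ ret d ⟩ (cells w ++ v)) ((u ++ cells w) ⟨ ret d ⟩ v)
    return* {d} u []      v = subst (λ u′ → Star _⟶_ (u ⟨ ret d ⟩ v) (u′ ⟨ ret d ⟩ v)) (≡.sym (++-identityʳ u)) ε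
    return* {d} u (x ∷ w) v =
      (return d x , tt , forward) ◅
      subst (λ u′ → Star _⟶_ ((u ∷ʳ sym x) ⟨ ret d ⟩ (cells w ++ v)) (u′ ⟨ ret d ⟩ v))
            (∷ʳ-++ u (sym x) (cells w)) (return* (u ∷ʳ sym x) w v)

    -- The cell `X` left of the swept part is included because the head comes to rest on it; a left
    -- move is only possible if such a cell exists. The case `X = ⟦` is a whole sweep.
    sweep* : ∀ {d d′ w w′} → Run trans d w w′ d′ → ∀ u X →
             Star _⟶_ (((u ∷ʳ X) ++ cells w) ⟨ ret d ⟩ [ ⟧ ]) (u ⟨ run d′ ⟩ (X ∷ cells w′ ++ [ ⟧ ]))
    sweep* {d} [] u X =
      subst (λ p → Star _⟶_ (p ⟨ ret d ⟩ [ ⟧ ]) (u ⟨ run d ⟩ (X ∷ [ ⟧ ]))) (≡.sym (++-identityʳ (u ∷ʳ X)))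
            (step (start d) tt backward)
    sweep* {d} (_∷_ {x = x} {u = w} t ρ) u X =
      subst (λ p → Star _⟶_ (p ⟨ ret d ⟩ [ ⟧ ]) _) (∷ʳ-++ (u ∷ʳ X) (sym x) (cells w)) (sweep* ρ (u ∷ʳ X) (sym x))
      ◅◅ step (rewr _ _ _ _) t backward

    passes : ∀ {d w d′ w′} → Star Pass (d , w) (d′ , w′) →
             Star _⟶_ ((⟦ ∷ cells w) ⟨ ret d ⟩ [ ⟧ ]) ((⟦ ∷ cells w′) ⟨ ret d′ ⟩ [ ⟧ ])
    passes ε                                   = ε
    passes (_◅_ {j = d″ , w″} (e , ρ , t) ps) =
      sweep* ρ [] ⟦ ◅◅ step (turn′ _ _) t forward ◅◅ return* [ ⟦ ] w″ [ ⟧ ] ◅◅ passes ps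

    computes : ∀ {d w w′} → Computes d w w′ →
               Star _⟶_ ((⟦ ∷ cells w) ⟨ ret d ⟩ [ ⟧ ]) ([ ⟦ ] ⟨ done ⟩ (cells w′ ++ [ ⟧ ]))
    computes (_ , _ , _ , ps , ρ , s) = passes ps ◅◅ sweep* ρ [] ⟦ ◅◅ step (stop′ _) s forward

  module _ (d₀ : D) (w₀ : List Δ) (Done : List (Cell Δ) → List (Cell Δ) → Set)
           (finish : ∀ {w} → Computes d₀ w₀ w → Done [ ⟦ ] (cells w ++ [ ⟧ ])) where

    -- The invariant behind soundness. In `sweeping`, `w₁` is still unread, `w₂` has been replaced
    -- by `w₂′`, and `X` is the cell under the head. `Done` is a parameter because an acceptor halts
    -- in `done`, while the labeled machine goes on from there.
    data Reached : StateWord Control Δ → Set where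
      returning : ∀ {d w u v} → Star Pass (d₀ , w₀) (d , w) → u ++ v ≡ tape w → Reached (u ⟨ ret d ⟩ v)
      sweeping  : ∀ {d₁ w₁ w₂ d w₂′ u X} → Star Pass (d₀ , w₀) (d₁ , w₁ ++ w₂) → Run trans d₁ w₂ w₂′ d →
                  u ∷ʳ X ≡ ⟦ ∷ cells w₁ → Reached (u ⟨ run d ⟩ (X ∷ cells w₂′ ++ [ ⟧ ]))
      finished  : ∀ {u v} → Done u v → Reached (u ⟨ done ⟩ v)

    -- `start`, `turn′` and `stop′` read a marker, and a marker occurs only at its own end of the
    -- tape. So no sweep can begin or end in the middle of the word.
    reached-step : ∀ i {c c′} → Legal i → MoveStep (moveRule i) c c′ → Reached c → Reached c′
    reached-step (return d x) _ (forward {u = u} {v}) (returning ps eq) =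
      returning ps (≡.trans (∷ʳ-++ u (sym x) v) eq)
    reached-step (start d) _ (backward {u = u} {C}) (returning {w = w} ps eq)
      with ⟧-last (u ∷ʳ C) w eq
    ... | p≡ , refl = sweeping {w₂ = []} (subst (λ w → Star Pass _ (d , w)) (≡.sym (++-identityʳ w)) ps) [] p≡
    reached-step (rewr d x y d′) t (backward {u = u} {C}) (sweeping {w₁ = w₁} {w₂} ps ρ eq)
      with ∷ʳ-sym-last (u ∷ʳ C) x w₁ eq
    ... | w , refl , p≡ =
      sweeping {w₂ = x ∷ w₂} (subst (λ w → Star Pass _ (_ , w)) (∷ʳ-++ w x w₂) ps) (t ∷ ρ) p≡
    reached-step (turn′ d d′) t (forward {u = u}) (sweeping {w₁ = w₁} ps ρ eq)
      with refl , refl ← ∷ʳ-⟦-last u w₁ eq = returning (ps ◅◅ (d , ρ , t) ◅ ε) refl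
    reached-step (stop′ d) s (forward {u = u}) (sweeping {w₁ = w₁} ps ρ eq)
      with refl , refl ← ∷ʳ-⟦-last u w₁ eq = finished (finish (_ , _ , _ , ps , ρ , s))

  module _ {B : Set} (Δ-finite : Finite Δ) (input : B ↣ Δ) (d₀ : D) where
    private
      emb : B → Δ
      emb = Injection.to input

    sweepLBM : LBM B
    sweepLBM = record
      { Γ = Δ ; Γ-finite = Δ-finite ; input = input
      ; Q = Control ; Q-finite = Finite-Control ; q₀ = ret d₀ ; F = [ done ]
      ; δ = select (Finite-Instruction Δ-finite) legal? moveRule }

    open LBM sweepLBM using (LBMStep; initial; Accepts)

    private
      to-LBM : ∀ {c c′} → c ⟶ c′ → LBMStep c c′
      to-LBM (i , l , s) = moveRule i , select⁺ (Finite-Instruction Δ-finite) legal? moveRule {i} l , s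

      initial-cells : ∀ w → initial w ≡ [ ⟦ ] ⟨ ret d₀ ⟩ (cells (map emb w) ++ [ ⟧ ])
      initial-cells w = cong (λ v → [ ⟦ ] ⟨ ret d₀ ⟩ (v ++ [ ⟧ ])) (map-∘ w)

    sweepLBM-complete : ∀ {w w′} → Computes d₀ (map emb w) w′ → Accepts w
    sweepLBM-complete {w} {w′} r =
      [ ⟦ ] ⟨ done ⟩ (cells w′ ++ [ ⟧ ]) ,
      subst (λ c → Star LBMStep c ([ ⟦ ] ⟨ done ⟩ (cells w′ ++ [ ⟧ ]))) (≡.sym (initial-cells w))
            (Star.map to-LBM (return* [ ⟦ ] (map emb w) [ ⟧ ] ◅◅ computes r)) ,
      here refl

    sweepLBM-sound : ∀ {w} → Accepts w → ∃ (Computes d₀ (map emb w))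
    sweepLBM-sound {w} (c , steps , here refl) = result (reach steps (subst Reach (≡.sym (initial-cells w)) (returning ε refl)))
      where
      Reach : StateWord Control Δ → Set
      Reach = Reached d₀ (map emb w) (λ _ _ → ∃ (Computes d₀ (map emb w))) (λ r → _ , r)
      reach : ∀ {c c′} → Star LBMStep c c′ → Reach c → Reach c′
      reach ε                     r = r
      reach ((_ , r∈ , s) ◅ steps) r with select⁻ (Finite-Instruction Δ-finite) legal? moveRule r∈
      ... | i , l , refl = reach steps (reached-step _ _ _ _ i l s r)
      result : ∀ {u v} → Reach (u ⟨ done ⟩ v) → ∃ (Computes d₀ (map emb w))
      result (finished r) = r

-- Labeled machines driven by sweeps

module SweepLLBM {Δ A : Set} (𝓜 : SweepMachine Δ) (Δ-finite : Finite Δ) (A-finite : Finite A) (input : A ↣ Δ)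
                 (blank : Δ) (entry : A → SweepMachine.D 𝓜) where
  open SweepMachine 𝓜

  private
    _≟_ : DecidableEquality Δ
    _≟_ = finite-≟ Δ-finite

  erase : List Δ → List Δ
  erase = filter (λ x → ¬? (x ≟ blank))

  erase-blank : ∀ w → erase (blank ∷ w) ≡ erase w
  erase-blank w = filter-reject (λ x → ¬? (x ≟ blank)) (λ x≢x → x≢x refl)

  erase-keep : ∀ {x} w → x ≢ blank → erase (x ∷ w) ≡ x ∷ erase w
  erase-keep w x≢ = filter-accept (λ x → ¬? (x ≟ blank)) x≢

  erase-++ : ∀ u v → erase (u ++ v) ≡ erase u ++ erase v
  erase-++ = filter-++ (λ x → ¬? (x ≟ blank))

  -- Between two letters the control is in the state idle with the head on
  -- the right marker.
  data Control⁺ : Set where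
    mv             : Control 𝓜 → Control⁺
    idle back sink : Control⁺

  private
    Finite-Control⁺ : Finite Control⁺
    Finite-Control⁺ = Finite-retract
      (Finite-⊎ (Finite-Control 𝓜) (Finite-Maybe Finite-Bool))
      (λ { (inj₁ q) → mv q
         ; (inj₂ nothing) → idle
         ; (inj₂ (just true)) → back
         ; (inj₂ (just false)) → sink })
      (λ { (mv q) → inj₁ q , refl
         ; idle → inj₂ nothing , refl
         ; back → inj₂ (just true) , refl
         ; sink → inj₂ (just false) , refl })

    kindOf : Control⁺ → Kind
    kindOf idle = external
    kindOf _    = internal

    kind-internal? : ∀ q → Dec (kindOf q ≡ internal)
    kind-internal? (mv q) = yes refl
    kind-internal? idle   = no (λ ())
    kind-internal? back   = yes refl
    kind-internal? sink   = yes refl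

    -- `crash` provides the move that normalization demands for every internal state and every cell.
    -- It leads to `sink`, which is internal and never left, so no edge arises from it.
    data Instr : Set where
      sys   : Instruction 𝓜 → Instr
      crash : Control⁺ → Cell Δ → Instr
      walk  : Δ → Instr
      ends  : Maybe (Maybe Δ) → Instr
      ins   : A → Instr

    Legal⁺ : Instr → Set
    Legal⁺ (sys i)     = Legal 𝓜 i
    Legal⁺ (crash q _) = kindOf q ≡ internal
    Legal⁺ (walk x)    = x ≢ blank
    Legal⁺ (ends _)    = ⊤
    Legal⁺ (ins _)     = ⊤

    legal⁺? : ∀ i → Dec (Legal⁺ i)
    legal⁺? (sys i)     = legal? 𝓜 i
    legal⁺? (crash q _) = kind-internal? q
    legal⁺? (walk x)    = ¬? (x ≟ blank)
    legal⁺? (ends _)    = yes tt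
    legal⁺? (ins _)     = yes tt

    Finite-Instr : Finite Instr
    Finite-Instr = Finite-retract
      (Finite-⊎ (Finite-Instruction 𝓜 Δ-finite) (Finite-⊎ (Finite-× Finite-Control⁺ (Finite-Cell Δ-finite))
        (Finite-⊎ Δ-finite (Finite-⊎ (Finite-Maybe (Finite-Maybe Δ-finite)) A-finite))))
      (λ { (inj₁ i) → sys i
         ; (inj₂ (inj₁ (q , X))) → crash q X
         ; (inj₂ (inj₂ (inj₁ x))) → walk x
         ; (inj₂ (inj₂ (inj₂ (inj₁ e)))) → ends e
         ; (inj₂ (inj₂ (inj₂ (inj₂ a)))) → ins a })
      (λ { (sys i) → inj₁ i , refl
         ; (crash q X) → inj₂ (inj₁ (q , X)) , refl
         ; (walk x) → inj₂ (inj₂ (inj₁ x)) , refl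
         ; (ends e) → inj₂ (inj₂ (inj₂ (inj₁ e))) , refl
         ; (ins a) → inj₂ (inj₂ (inj₂ (inj₂ a))) , refl })

    lift : MoveRule (Control 𝓜) Δ → MoveRule Control⁺ Δ
    lift (move p X q Y d s) = move (mv p) X (mv q) Y d s

    crashRule : Control⁺ → Cell Δ → MoveRule Control⁺ Δ
    crashRule q ⟦       = move q ⟦ sink ⟦ ⊕ left
    crashRule q ⟧       = move q ⟧ sink ⟧ ⊖ right
    crashRule q (sym x) = move q (sym x) sink (sym x) ⊕ (inner x x ⊕)

    endRule : Maybe (Maybe Δ) → Rule Control⁺ Δ A
    endRule nothing         = delete (mv done) blank (mv done)
    endRule (just nothing)  = ofMove (move back ⟦ idle ⟦ ⊕ left)
    endRule (just (just x)) = ofMove (move back (sym x) idle (sym x) ⊕ (inner x x ⊕))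

    rule : Instr → Rule Control⁺ Δ A
    rule (sys i)     = ofMove (lift (moveRule 𝓜 i))
    rule (crash q X) = ofMove (crashRule q X)
    rule (walk x)    = ofMove (move (mv done) (sym x) (mv done) (sym x) ⊕ (inner x x ⊕))
    rule (ends e)    = endRule e
    -- The inserted cell is blank; the letter itself survives in the state `entry a`.
    rule (ins a)     = insert idle ⟧ a (mv (ret (entry a))) blank ⟧

    -- A move on `⟧` has to go left, so `idle` cannot be entered on the right marker directly:
    -- `back` visits the neighbouring cell and returns.
    rightEnd : Rule Control⁺ Δ A
    rightEnd = ofMove (move (mv done) ⟧ back ⟧ ⊖ right)

    rules : List (Rule Control⁺ Δ A)
    rules = rightEnd ∷ select Finite-Instr legal⁺? rule

  sweepLLBM : LLBM A
  sweepLLBM = record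
    { Γ = Δ ; Γ-finite = Δ-finite ; input = input
    ; Q = Control⁺ ; Q-finite = Finite-Control⁺ ; q₀ = idle ; F = [] ; δ = rules }

  private
    legal⁺ : ∀ {i} → Legal⁺ i → rule i ∈ rules
    legal⁺ {i} l = there (select⁺ Finite-Instr legal⁺? rule {i} l)

    data View (r : Rule Control⁺ Δ A) : Set where
      view  : ∀ i → Legal⁺ i → r ≡ rule i → View r
      viewᵉ : r ≡ rightEnd → View r

    ∈rules : ∀ {r} → r ∈ rules → View r
    ∈rules (here r≡) = viewᵉ r≡
    ∈rules (there r∈) with select⁻ Finite-Instr legal⁺? rule r∈
    ... | i , l , r≡ = view i l r≡

    lift-internal : ∀ i → kindOf (MoveRule.source (lift (moveRule 𝓜 i))) ≡ internal
    lift-internal (return d x)    = refl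
    lift-internal (start d)       = refl
    lift-internal (rewr d x y d′) = refl
    lift-internal (turn′ d d′)    = refl
    lift-internal (stop′ d)       = refl

    letter-rule : ∀ {r a} → View r → label r ≡ just a → kindOf (lhsState r) ≡ external
    letter-rule (view (sys i) _ refl) ()
    letter-rule (view (crash q X) _ refl) ()
    letter-rule (view (walk x) _ refl) ()
    letter-rule (view (ends nothing) _ refl) ()
    letter-rule (view (ends (just nothing)) _ refl) ()
    letter-rule (view (ends (just (just x))) _ refl) ()
    letter-rule (view (ins a) _ refl) _ = refl
    letter-rule (viewᵉ refl) ()

    ε-rule : ∀ {r} → View r → label r ≡ nothing → kindOf (lhsState r) ≡ internal
    ε-rule (view (sys i) _ refl)                _ = lift-internal i
    ε-rule (view (crash q ⟦) l refl)            _ = l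
    ε-rule (view (crash q ⟧) l refl)            _ = l
    ε-rule (view (crash q (sym x)) l refl)      _ = l
    ε-rule (view (walk x) _ refl)               _ = refl
    ε-rule (view (ends nothing) _ refl)         _ = refl
    ε-rule (view (ends (just nothing)) _ refl)  _ = refl
    ε-rule (view (ends (just (just x))) _ refl) _ = refl
    ε-rule (view (ins a) _ refl) ()
    ε-rule (viewᵉ refl)                         _ = refl

    total : ∀ p (X : Cell Δ) → kindOf p ≡ internal →
            ∃ λ q → ∃ λ Y → ∃ λ d → ∃ λ s → ofMove (move p X q Y d s) ∈ rules
    total p ⟦       k = _ , _ , _ , _ , legal⁺ {crash p ⟦} k
    total p ⟧       k = _ , _ , _ , _ , legal⁺ {crash p ⟧} k
    total p (sym x) k = _ , _ , _ , _ , legal⁺ {crash p (sym x)} k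

  sweepLLBM-normalized : Normalized sweepLLBM
  sweepLLBM-normalized = record
    { kind           = kindOf
    ; final-external = λ ()
    ; letter-rules   = λ r∈ → letter-rule (∈rules r∈)
    ; ε-rules        = λ r∈ → ε-rule (∈rules r∈)
    ; total          = total
    }

  idleAt : List Δ → StateWord Control⁺ Δ
  idleAt w = (⟦ ∷ cells w) ⟨ idle ⟩ [ ⟧ ]

  idleAt-injective : ∀ {w w′} → idleAt w ≡ idleAt w′ → w ≡ w′
  idleAt-injective eq = map-injective (λ { refl → refl }) (∷-injectiveʳ (cong before eq))

  private
    Stepᵋ : Rel (StateWord Control⁺ Δ) 0ℓ
    Stepᵋ = Step sweepLLBM nothing

    liftConfig : StateWord (Control 𝓜) Δ → StateWord Control⁺ Δ
    liftConfig (u ⟨ q ⟩ v) = u ⟨ mv q ⟩ v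

    lift-step : ∀ {r c c′} → MoveStep r c c′ → MoveStep (lift r) (liftConfig c) (liftConfig c′)
    lift-step forward  = forward
    lift-step backward = backward

    lift-steps : ∀ {c c′} → Star (_⟶_ 𝓜) c c′ → Star Stepᵋ (liftConfig c) (liftConfig c′)
    lift-steps = Star.gmap liftConfig (λ { (i , l , s) → moving (legal⁺ {sys i} l) (lift-step s) })

    erase* : ∀ u w → Star Stepᵋ (u ⟨ mv done ⟩ (cells w ++ [ ⟧ ])) ((u ++ cells (erase w)) ⟨ mv done ⟩ [ ⟧ ])
    erase* u []      = subst (λ p → Star Stepᵋ (u ⟨ mv done ⟩ [ ⟧ ]) (p ⟨ mv done ⟩ [ ⟧ ])) (≡.sym (++-identityʳ u)) ε
    erase* u (x ∷ w) = case x ≟ blank of λ where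
      (yes refl) → deleting (legal⁺ {ends nothing} tt) ◅
                   subst (λ w′ → Star Stepᵋ _ ((u ++ cells w′) ⟨ mv done ⟩ [ ⟧ ])) (≡.sym (erase-blank w)) (erase* u w)
      (no x≢)    → moving (legal⁺ {walk x} x≢) forward ◅
                   subst (λ p → Star Stepᵋ _ (p ⟨ mv done ⟩ [ ⟧ ]))
                         (≡.trans (∷ʳ-++ u (sym x) _) (cong (λ w′ → u ++ cells w′) (≡.sym (erase-keep w x≢))))
                         (erase* (u ∷ʳ sym x) w)

    stop-at-end : ∀ u X → (∃ λ p → ofMove (move back X idle X ⊕ p) ∈ rules) →
                  Star Stepᵋ ((u ∷ʳ X) ⟨ mv done ⟩ [ ⟧ ]) ((u ∷ʳ X) ⟨ idle ⟩ [ ⟧ ])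
    stop-at-end u X (_ , r∈) = moving (here refl) backward ◅ moving r∈ forward ◅ ε

    snoc-view : ∀ w → ∃ λ u → ∃ λ X → ⟦ ∷ cells w ≡ u ∷ʳ X × ∃ λ p → ofMove (move back X idle X ⊕ p) ∈ rules
    snoc-view w with initLast w
    ... | []           = [] , ⟦ , refl , _ , legal⁺ {ends (just nothing)} tt
    ... | w′ ∷ʳ′ x = ⟦ ∷ cells w′ , sym x , cong (⟦ ∷_) (cells-∷ʳ w′ x) , _ , legal⁺ {ends (just (just x))} tt

    finish-run : ∀ w → Star Stepᵋ ([ ⟦ ] ⟨ mv done ⟩ (cells w ++ [ ⟧ ])) (idleAt (erase w))
    finish-run w with snoc-view (erase w)
    ... | u , X , eq , r = erase* [ ⟦ ] w ◅◅
      subst (λ p → Star Stepᵋ (p ⟨ mv done ⟩ [ ⟧ ]) (p ⟨ idle ⟩ [ ⟧ ])) (≡.sym eq) (stop-at-end u X r)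

    idleAt-external : ∀ w → IsExternalConfiguration sweepLLBM sweepLLBM-normalized (idleAt w)
    idleAt-external w = ((λ ()) , w , refl) , refl

  sweepLLBM-complete : ∀ {w a w′} → Computes (entry a) (w ∷ʳ blank) w′ →
    transitionGraph sweepLLBM sweepLLBM-normalized (idleAt w , a , idleAt (erase w′))
  sweepLLBM-complete {w} {a} {w′} r =
    idleAt-external w , idleAt-external (erase w′) , _ , inserting (legal⁺ {ins a} tt) ,
    -- After the insertion the head stands on the new blank; one return step takes it to `⟧`, where
    -- the sweep starts.
    moving (legal⁺ {sys (return (entry a) blank)} tt) forward ◅
    subst (λ p → Star Stepᵋ (p ⟨ mv (ret (entry a)) ⟩ [ ⟧ ]) (idleAt (erase w′)))
          (cong (⟦ ∷_) (cells-∷ʳ w blank))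
          (lift-steps (computes 𝓜 r) ◅◅ finish-run w′)

  sweepLLBM-sound : ∀ {c a c′} → transitionGraph sweepLLBM sweepLLBM-normalized (c , a , c′) →
    ∃₂ λ w w′ → c ≡ idleAt w × c′ ≡ idleAt (erase w′) × Computes (entry a) (w ∷ʳ blank) w′
  sweepLLBM-sound {c} {a} {c′} (((_ , w , c-tape) , _) , (_ , c′-external) , d , first , rest) = begins first c-tape rest
    where
    -- Blanks are removed from left to right: `w₁` has been cleaned, `w₂` is still as computed. The
    -- split is one of the unerased word, so that the same computation serves throughout the
    -- deletion.
    data Erasing (W : List Δ) : List (Cell Δ) → List (Cell Δ) → Set where
      erasing : ∀ w₁ w₂ {u v} → Computes (entry a) W (w₁ ++ w₂) →
                u ≡ ⟦ ∷ cells (erase w₁) → v ≡ cells w₂ ++ [ ⟧ ] → Erasing W u v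

    Reach : List Δ → StateWord (Control 𝓜) Δ → Set
    Reach W = Reached 𝓜 (entry a) W (Erasing W) (λ {w′} r → erasing [] w′ r refl refl)

    -- `crashed` records nothing about the tape: `sink` has only moves to `sink`, and an edge ends
    -- in an external state.
    data Reach⁺ (W : List Δ) : StateWord Control⁺ Δ → Set where
      controlled : ∀ {u q v} → Reach W (u ⟨ q ⟩ v) → Reach⁺ W (u ⟨ mv q ⟩ v)
      retreated  : ∀ {u X w′} → Computes (entry a) W w′ → u ∷ʳ X ≡ ⟦ ∷ cells (erase w′) →
                   Reach⁺ W (u ⟨ back ⟩ (X ∷ [ ⟧ ]))
      stopped    : ∀ {u w′} → Computes (entry a) W w′ → u ≡ ⟦ ∷ cells (erase w′) → Reach⁺ W (u ⟨ idle ⟩ [ ⟧ ])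
      crashed    : ∀ {u v} → Reach⁺ W (u ⟨ sink ⟩ v)

    crash-step : ∀ {W c c′} p X → MoveStep (crashRule p X) c c′ → Reach⁺ W c′
    crash-step p ⟦       forward  = crashed
    crash-step p ⟧       backward = crashed
    crash-step p (sym x) forward  = crashed

    sys-step : ∀ {W} i {c c′} → Legal 𝓜 i → MoveStep (lift (moveRule 𝓜 i)) c c′ → Reach⁺ W c → Reach⁺ W c′
    sys-step i@(return d x)    l s@forward  (controlled r) = controlled (reached-step 𝓜 _ _ _ _ i l forward r)
    sys-step i@(start d)       l s@backward (controlled r) = controlled (reached-step 𝓜 _ _ _ _ i l backward r)
    sys-step i@(rewr d x y d′) l s@backward (controlled r) = controlled (reached-step 𝓜 _ _ _ _ i l backward r)
    sys-step i@(turn′ d d′)    l s@forward  (controlled r) = controlled (reached-step 𝓜 _ _ _ _ i l forward r)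
    sys-step i@(stop′ d)       l s@forward  (controlled r) = controlled (reached-step 𝓜 _ _ _ _ i l forward r)

    walk-step : ∀ {W u x v} → x ≢ blank → Erasing W u (sym x ∷ v) → Erasing W (u ∷ʳ sym x) v
    walk-step x≢ (erasing w₁ [] r u≡ ())
    walk-step {W} {x = x} x≢ (erasing w₁ (.x ∷ w₂) r refl refl) =
      erasing (w₁ ∷ʳ x) w₂ (subst (Computes (entry a) W) (≡.sym (∷ʳ-++ w₁ x w₂)) r)
              (cong (⟦ ∷_) (≡.sym (≡.trans (cong cells erase-∷ʳ) (cells-∷ʳ (erase w₁) x)))) refl
      where
      erase-∷ʳ : erase (w₁ ∷ʳ x) ≡ erase w₁ ∷ʳ x
      erase-∷ʳ = ≡.trans (erase-++ w₁ [ x ]) (cong (erase w₁ ++_) (erase-keep [] x≢))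

    delete-step : ∀ {W u v} → Erasing W u (sym blank ∷ v) → Erasing W u v
    delete-step (erasing w₁ [] r u≡ ())
    delete-step {W} (erasing w₁ (.blank ∷ w₂) r refl refl) =
      erasing (w₁ ∷ʳ blank) w₂ (subst (Computes (entry a) W) (≡.sym (∷ʳ-++ w₁ blank w₂)) r)
              (cong (λ w → ⟦ ∷ cells w) (≡.sym erase-∷ʳ)) refl
      where
      erase-∷ʳ : erase (w₁ ∷ʳ blank) ≡ erase w₁
      erase-∷ʳ = ≡.trans (erase-++ w₁ [ blank ])
                (≡.trans (cong (erase w₁ ++_) (erase-blank [])) (++-identityʳ _))

    retreat-step : ∀ {W u X v} → Erasing W (u ∷ʳ X) (⟧ ∷ v) → Reach⁺ W (u ⟨ back ⟩ (X ∷ ⟧ ∷ v))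
    retreat-step {W} (erasing w₁ [] r u≡ refl) =
      retreated (subst (Computes (entry a) W) (++-identityʳ w₁) r) u≡
    retreat-step (erasing w₁ (_ ∷ _) r u≡ ())

    delete-done : ∀ {W u v} → Reach⁺ W (u ⟨ mv done ⟩ (sym blank ∷ v)) → Reach⁺ W (u ⟨ mv done ⟩ v)
    delete-done (controlled (finished e)) = controlled (finished (delete-step e))

    step : ∀ {W c c′} → Stepᵋ c c′ → Reach⁺ W c → Reach⁺ W c′
    step (moving r∈ s) r with ∈rules r∈
    step (moving r∈ s) r | view (sys i) l refl = sys-step i l s r
    step (moving r∈ s) r | view (crash p ⟦) l refl = crash-step p ⟦ s
    step (moving r∈ s) r | view (crash p ⟧) l refl = crash-step p ⟧ s
    step (moving r∈ s) r | view (crash p (sym x)) l refl = crash-step p (sym x) s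
    step (moving r∈ forward) (controlled (finished e)) | view (walk x) x≢ refl = controlled (finished (walk-step x≢ e))
    step (moving r∈ forward) (retreated r eq) | view (ends (just nothing)) _ refl = stopped r eq
    step (moving r∈ forward) (retreated r eq) | view (ends (just (just x))) _ refl = stopped r eq
    step (moving r∈ backward) (controlled (finished e)) | viewᵉ refl = retreat-step e
    step (deleting r∈) r with ∈rules r∈
    step (deleting r∈) r | view (ends nothing) _ refl = delete-done r
    step (deleting r∈) r | view (ends (just nothing)) _ ()
    step (deleting r∈) r | view (ends (just (just x))) _ ()

    steps : ∀ {W c c′} → Star Stepᵋ c c′ → Reach⁺ W c → Reach⁺ W c′
    steps ε        r = r
    steps (s ◅ ss) r = steps ss (step s r)

    result : ∀ {W c′} → kindOf (state c′) ≡ external → Reach⁺ W c′ →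
             ∃ λ w′ → c′ ≡ idleAt (erase w′) × Computes (entry a) W w′
    result _ (stopped {w′ = w′} r refl) = w′ , refl , r

    begins : ∀ {c d} → Step sweepLLBM (just a) c d → before c ++ after c ≡ tape w → Star Stepᵋ d c′ →
             ∃₂ λ w w′ → c ≡ idleAt w × c′ ≡ idleAt (erase w′) × Computes (entry a) (w ∷ʳ blank) w′
    begins (inserting r∈) eq ss with ∈rules r∈
    begins (inserting r∈) eq ss | view (ends nothing) _ ()
    begins (inserting r∈) eq ss | view (ends (just nothing)) _ ()
    begins (inserting r∈) eq ss | view (ends (just (just x))) _ ()
    begins (inserting {u = u} {v} r∈) eq ss | view (ins a) _ refl with ⟧-last u w eq
    ... | refl , refl with result c′-external (steps ss (controlled (returning {w = w ∷ʳ blank} ε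
                            (cong (⟦ ∷_) (≡.sym (≡.trans (cong (_++ [ ⟧ ]) (cells-∷ʳ w blank)) (∷ʳ-++ (cells w) (sym blank) [ ⟧ ])))))))
    ... | w′ , c′≡ , r = w , w′ , refl , c′≡ , r

-- Transducers

record Transducer (X Y : Set) : Set₁ where
  field
    State      : Set
    finite     : Finite State
    trans      : State → X → Y → State → Set
    trans?     : ∀ d x y d′ → Dec (trans d x y d′)
    accepting  : State → Set
    accepting? : ∀ d → Dec (accepting d)

  Transduces : State → List X → List Y → Set
  Transduces d u v = ∃ λ d′ → Run trans d u v d′ × accepting d′

module _ {D X Y : Set} {trans : D → X → Y → D → Set} where

  Run-++ : ∀ {d e d′ u u′ v v′} → Run trans d v v′ e → Run trans e u u′ d′ → Run trans d (u ++ v) (u′ ++ v′) d′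
  Run-++ ρ []      = ρ
  Run-++ ρ (t ∷ σ) = t ∷ Run-++ ρ σ

  Run-split : ∀ {d d′} u {v} u′ {v′} → length u ≡ length u′ → Run trans d (u ++ v) (u′ ++ v′) d′ →
              ∃ λ e → Run trans d v v′ e × Run trans e u u′ d′
  Run-split []      []        _  ρ       = _ , ρ , []
  Run-split (x ∷ u) (y ∷ u′) eq (t ∷ ρ) =
    Product.map id (Product.map id (t ∷_)) (Run-split u u′ (ℕ.suc-injective eq) ρ)

  module _ (D-finite : Finite D) (trans? : ∀ d x y d′ → Dec (trans d x y d′)) where

    run? : ∀ d u v d′ → Dec (Run trans d u v d′)
    run? d []      []      d′ = Dec.map′ (λ { refl → [] }) (λ { [] → refl }) (finite-≟ D-finite d d′)
    run? d []      (_ ∷ _) d′ = no λ ()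
    run? d (_ ∷ _) []      d′ = no λ ()
    run? d (x ∷ u) (y ∷ v) d′ =
      Dec.map′ (λ { (e , ρ , t) → t ∷ ρ }) (λ { (t ∷ ρ) → _ , ρ , t })
               (∃? D-finite (λ e → run? d u v e ×-dec trans? e x y d′))

-- Blocks

module _ {X : Set} {K : ℕ} where

  flat : List (Vec X K) → List X
  flat W = concatMap toList W

  length-flat : ∀ W → length (flat W) ≡ length W * K
  length-flat []      = refl
  length-flat (B ∷ W) = ≡.trans (length-++ (toList B)) (cong₂ _+_ (Vec.length-toList B) (length-flat W))

  unflat : ∀ n t → length t ≡ n * K → ∃ λ W → flat W ≡ t × length W ≡ n
  unflat zero    []      _  = [] , refl , refl
  unflat (suc n) t       eq with chop K t (ℕ.≤-trans (ℕ.m≤m+n K _) (ℕ.≤-reflexive (≡.sym eq)))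
    where
    chop : ∀ k t → k ≤ length t → ∃₂ λ (B : Vec X k) s → toList B ++ s ≡ t
    chop zero    t       _         = [] , t , refl
    chop (suc k) (x ∷ t) (s≤s k≤) with chop k t k≤
    ... | B , s , refl = x ∷ B , s , refl
  ... | B , s , refl with unflat n s (ℕ.+-cancelˡ-≡ K _ _ (≡.trans (cong (_+ length s) (≡.sym (Vec.length-toList B)))
                                       (≡.trans (≡.sym (length-++ (toList B))) eq)))
  ... | W , refl , refl = B ∷ W , refl , refl

module _ {X : Set} (𝒯 : Transducer X X) (K : ℕ) where
  open Transducer 𝒯

  -- A single transition covers a whole run over the `K` letters of a block, so the states stay the
  -- same and only the alphabet grows.
  blockwise : Transducer (Vec X K) (Vec X K)
  blockwise = record
    { State = State ; finite = finite
    ; trans  = λ d B B′ d′ → Run trans d (toList B) (toList B′) d′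
    ; trans? = λ d B B′ d′ → run? finite trans? d (toList B) (toList B′) d′
    ; accepting = accepting ; accepting? = accepting? }

  blockwise-sound : ∀ {d W W′ d′} → Run (Transducer.trans blockwise) d W W′ d′ → Run trans d (flat W) (flat W′) d′
  blockwise-sound []      = []
  blockwise-sound (t ∷ ρ) = Run-++ (blockwise-sound ρ) t

  blockwise-complete : ∀ {d d′} W W′ → length W ≡ length W′ → Run trans d (flat W) (flat W′) d′ →
                       Run (Transducer.trans blockwise) d W W′ d′
  blockwise-complete []      []        _  [] = []
  blockwise-complete (B ∷ W) (B′ ∷ W′) eq ρ
    with Run-split (toList B) (toList B′) (≡.trans (Vec.length-toList B) (≡.sym (Vec.length-toList B′))) ρ
  ... | e , ρ₁ , ρ₂ = ρ₂ ∷ blockwise-complete W W′ (ℕ.suc-injective eq) ρ₁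

-- Three phases

module _ {I V : Set} (pre : Transducer I V) (loc : Transducer V V) (post : Transducer V I)
         (l₀ : Transducer.State loc) (p₀ : Transducer.State post) where
  private
    module Pre  = Transducer pre
    module Loc  = Transducer loc
    module Post = Transducer post

    D : Set
    D = Pre.State ⊎ Loc.State ⊎ Post.State

    IV : (I → V → Set) → I ⊎ V → I ⊎ V → Set
    IV R (inj₁ x) (inj₂ y) = R x y
    IV R (inj₁ _) (inj₁ _) = ⊥
    IV R (inj₂ _) _        = ⊥

    VV : (V → V → Set) → I ⊎ V → I ⊎ V → Set
    VV R (inj₂ x) (inj₂ y) = R x y
    VV R (inj₂ _) (inj₁ _) = ⊥
    VV R (inj₁ _) _        = ⊥

    VI : (V → I → Set) → I ⊎ V → I ⊎ V → Set
    VI R (inj₂ x) (inj₁ y) = R x y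
    VI R (inj₂ _) (inj₂ _) = ⊥
    VI R (inj₁ _) _        = ⊥

    IV? : ∀ {R} → (∀ x y → Dec (R x y)) → ∀ x y → Dec (IV R x y)
    IV? R? (inj₁ x) (inj₂ y) = R? x y
    IV? R? (inj₁ _) (inj₁ _) = no λ ()
    IV? R? (inj₂ _) _        = no λ ()

    VV? : ∀ {R} → (∀ x y → Dec (R x y)) → ∀ x y → Dec (VV R x y)
    VV? R? (inj₂ x) (inj₂ y) = R? x y
    VV? R? (inj₂ _) (inj₁ _) = no λ ()
    VV? R? (inj₁ _) _        = no λ ()

    VI? : ∀ {R} → (∀ x y → Dec (R x y)) → ∀ x y → Dec (VI R x y)
    VI? R? (inj₂ x) (inj₁ y) = R? x y
    VI? R? (inj₂ _) (inj₂ _) = no λ ()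
    VI? R? (inj₁ _) _        = no λ ()

    trans : D → I ⊎ V → I ⊎ V → D → Set
    trans (inj₁ d)        x y (inj₁ d′)        = IV (λ x y → Pre.trans d x y d′) x y
    trans (inj₂ (inj₁ d)) x y (inj₂ (inj₁ d′)) = VV (λ x y → Loc.trans d x y d′) x y
    trans (inj₂ (inj₂ d)) x y (inj₂ (inj₂ d′)) = VI (λ x y → Post.trans d x y d′) x y
    trans (inj₁ _)        _ _ (inj₂ _)         = ⊥
    trans (inj₂ (inj₁ _)) _ _ (inj₁ _)         = ⊥
    trans (inj₂ (inj₁ _)) _ _ (inj₂ (inj₂ _))  = ⊥
    trans (inj₂ (inj₂ _)) _ _ (inj₁ _)         = ⊥
    trans (inj₂ (inj₂ _)) _ _ (inj₂ (inj₁ _))  = ⊥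

    trans? : ∀ d x y d′ → Dec (trans d x y d′)
    trans? (inj₁ d)        x y (inj₁ d′)        = IV? (λ x y → Pre.trans? d x y d′) x y
    trans? (inj₂ (inj₁ d)) x y (inj₂ (inj₁ d′)) = VV? (λ x y → Loc.trans? d x y d′) x y
    trans? (inj₂ (inj₂ d)) x y (inj₂ (inj₂ d′)) = VI? (λ x y → Post.trans? d x y d′) x y
    trans? (inj₁ _)        _ _ (inj₂ _)         = no λ ()
    trans? (inj₂ (inj₁ _)) _ _ (inj₁ _)         = no λ ()
    trans? (inj₂ (inj₁ _)) _ _ (inj₂ (inj₂ _))  = no λ ()
    trans? (inj₂ (inj₂ _)) _ _ (inj₁ _)         = no λ ()
    trans? (inj₂ (inj₂ _)) _ _ (inj₂ (inj₁ _))  = no λ ()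

    ready : D → Set
    ready (inj₁ d)        = Pre.accepting d
    ready (inj₂ (inj₁ d)) = Loc.accepting d
    ready (inj₂ (inj₂ d)) = ⊥

    ready? : ∀ d → Dec (ready d)
    ready? (inj₁ d)        = Pre.accepting? d
    ready? (inj₂ (inj₁ d)) = Loc.accepting? d
    ready? (inj₂ (inj₂ d)) = no λ ()

    -- The number of local passes is left to nondeterminism, zero included. No sweep follows `post`,
    -- for `ready` is empty there.
    turn : D → D → Set
    turn d d′ = ready d × (d′ ≡ inj₂ (inj₁ l₀) ⊎ d′ ≡ inj₂ (inj₂ p₀))

    D-finite : Finite D
    D-finite = Finite-⊎ Pre.finite (Finite-⊎ Loc.finite Post.finite)

    turn? : ∀ d d′ → Dec (turn d d′)
    turn? d d′ = ready? d ×-dec (finite-≟ D-finite d′ (inj₂ (inj₁ l₀)) ⊎-dec finite-≟ D-finite d′ (inj₂ (inj₂ p₀)))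

    stop : D → Set
    stop (inj₁ _)        = ⊥
    stop (inj₂ (inj₁ _)) = ⊥
    stop (inj₂ (inj₂ d)) = Post.accepting d

    stop? : ∀ d → Dec (stop d)
    stop? (inj₁ _)        = no λ ()
    stop? (inj₂ (inj₁ _)) = no λ ()
    stop? (inj₂ (inj₂ d)) = Post.accepting? d

  threePhase : SweepMachine (I ⊎ V)
  threePhase = record
    { D = D ; D-finite = D-finite ; trans = trans ; trans? = trans?
    ; turn = turn ; turn? = turn? ; stop = stop ; stop? = stop? }

  open SweepMachine threePhase using (Pass; Computes)

  private
    pre-run : ∀ {d u v d′} → Run Pre.trans d u v d′ → Run trans (inj₁ d) (map inj₁ u) (map inj₂ v) (inj₁ d′)
    pre-run []      = []
    pre-run (t ∷ ρ) = t ∷ pre-run ρ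

    loc-run : ∀ {d u v d′} → Run Loc.trans d u v d′ →
              Run trans (inj₂ (inj₁ d)) (map inj₂ u) (map inj₂ v) (inj₂ (inj₁ d′))
    loc-run []      = []
    loc-run (t ∷ ρ) = t ∷ loc-run ρ

    post-run : ∀ {d u v d′} → Run Post.trans d u v d′ →
               Run trans (inj₂ (inj₂ d)) (map inj₂ u) (map inj₁ v) (inj₂ (inj₂ d′))
    post-run []      = []
    post-run (t ∷ ρ) = t ∷ post-run ρ

    -- The letters reveal the phase: a transition of `pre` exists only on a letter from `I` and
    -- leaves one from `V`. So `U` may be arbitrary, and the tape left behind is fit for the other
    -- phases.
    pre-run⁻ : ∀ {d U V e} → Run trans (inj₁ d) U V e →
               ∃₂ λ u v → ∃ λ d′ → U ≡ map inj₁ u × V ≡ map inj₂ v × e ≡ inj₁ d′ × Run Pre.trans d u v d′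
    pre-run⁻ [] = [] , [] , _ , refl , refl , refl , []
    pre-run⁻ (_∷_ {d″ = e} {x} {y} t ρ) with pre-run⁻ ρ
    pre-run⁻ (_∷_ {d″ = inj₁ e} {inj₁ x} {inj₂ y} t ρ) | u , v , d′ , refl , refl , refl , σ =
      x ∷ u , y ∷ v , e , refl , refl , refl , t ∷ σ
    pre-run⁻ (_∷_ {d″ = inj₁ e} {inj₁ x} {inj₁ y} () ρ) | u , v , d′ , refl , refl , refl , σ
    pre-run⁻ (_∷_ {d″ = inj₁ e} {inj₂ x} {y} () ρ)      | u , v , d′ , refl , refl , refl , σ
    pre-run⁻ (_∷_ {d″ = inj₂ e} {x} {y} () ρ)           | u , v , d′ , refl , refl , refl , σ

    loc-run⁻ : ∀ {d u V e} → Run trans (inj₂ (inj₁ d)) (map inj₂ u) V e →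
               ∃₂ λ v d′ → V ≡ map inj₂ v × e ≡ inj₂ (inj₁ d′) × Run Loc.trans d u v d′
    loc-run⁻ {u = []} [] = [] , _ , refl , refl , []
    loc-run⁻ {u = _ ∷ _} (_∷_ {d″ = e} {y = y} t ρ) with loc-run⁻ ρ
    loc-run⁻ {u = _ ∷ _} (_∷_ {d″ = inj₂ (inj₁ e)} {y = inj₂ y} t ρ)  | v , d′ , refl , refl , σ =
      y ∷ v , e , refl , refl , t ∷ σ
    loc-run⁻ {u = _ ∷ _} (_∷_ {d″ = inj₂ (inj₁ e)} {y = inj₁ y} () ρ) | v , d′ , refl , refl , σ
    loc-run⁻ {u = _ ∷ _} (_∷_ {d″ = inj₂ (inj₂ e)} () ρ)              | v , d′ , refl , refl , σ
    loc-run⁻ {u = _ ∷ _} (_∷_ {d″ = inj₁ e} () ρ)                     | v , d′ , refl , refl , σ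

    post-run⁻ : ∀ {d u V e} → Run trans (inj₂ (inj₂ d)) (map inj₂ u) V e →
                ∃₂ λ v d′ → V ≡ map inj₁ v × e ≡ inj₂ (inj₂ d′) × Run Post.trans d u v d′
    post-run⁻ {u = []} [] = [] , _ , refl , refl , []
    post-run⁻ {u = _ ∷ _} (_∷_ {d″ = e} {y = y} t ρ) with post-run⁻ ρ
    post-run⁻ {u = _ ∷ _} (_∷_ {d″ = inj₂ (inj₂ e)} {y = inj₁ y} t ρ)  | v , d′ , refl , refl , σ =
      y ∷ v , e , refl , refl , t ∷ σ
    post-run⁻ {u = _ ∷ _} (_∷_ {d″ = inj₂ (inj₂ e)} {y = inj₂ y} () ρ) | v , d′ , refl , refl , σ
    post-run⁻ {u = _ ∷ _} (_∷_ {d″ = inj₂ (inj₁ e)} () ρ)              | v , d′ , refl , refl , σ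
    post-run⁻ {u = _ ∷ _} (_∷_ {d″ = inj₁ e} () ρ)                     | v , d′ , refl , refl , σ

  threePhase-complete : ∀ {d u v v′ w} → Pre.Transduces d u v → Star (Loc.Transduces l₀) v v′ → Post.Transduces p₀ v′ w →
                        Computes (inj₁ d) (map inj₁ u) (map inj₁ w)
  threePhase-complete {v′ = v′} {w} (d′ , ρ , accepts) steps (p , σ , p-accepts) = go (pre-run ρ) accepts steps
    where
    go : ∀ {d U v e} → Run trans d U (map inj₂ v) e → ready e → Star (Loc.Transduces l₀) v v′ → Computes d U (map inj₁ w)
    go ρ r ε = _ , _ , _ , (_ , ρ , r , inj₂ refl) ◅ ε , post-run σ , p-accepts
    go ρ r ((_ , τ , acc) ◅ ss) with go (loc-run τ) acc ss
    ... | _ , _ , _ , passes , last , s = _ , _ , _ , (_ , ρ , r , inj₁ refl) ◅ passes , last , s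

  threePhase-sound : ∀ {d U W} → Computes (inj₁ d) U W →
    ∃₂ λ u w → ∃₂ λ v v′ → U ≡ map inj₁ u × W ≡ map inj₁ w ×
      Pre.Transduces d u v × Star (Loc.Transduces l₀) v v′ × Post.Transduces p₀ v′ w
  threePhase-sound {W = W} (_ , _ , _ , passes , last , s) = pre-sound passes last s
    where
    post-sound : ∀ {v d₁ W₁ d₂} → Star Pass (inj₂ (inj₂ p₀) , map inj₂ v) (d₁ , W₁) → Run trans d₁ W₁ W d₂ → stop d₂ →
                 ∃ λ w → W ≡ map inj₁ w × Post.Transduces p₀ v w
    post-sound ε ρ s with post-run⁻ ρ
    ... | w , d′ , refl , refl , σ = w , refl , d′ , σ , s
    post-sound ((e , ρ , r , _) ◅ _) _ _ with post-run⁻ ρ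
    post-sound ((e , ρ , () , _) ◅ _) _ _ | w , d′ , refl , refl , σ

    loc-sound : ∀ {v d₁ W₁ d₂} → Star Pass (inj₂ (inj₁ l₀) , map inj₂ v) (d₁ , W₁) → Run trans d₁ W₁ W d₂ → stop d₂ →
                ∃₂ λ v′ w → W ≡ map inj₁ w × Star (Loc.Transduces l₀) v v′ × Post.Transduces p₀ v′ w
    loc-sound ε ρ s with loc-run⁻ ρ
    loc-sound ε ρ () | v , d′ , refl , refl , σ
    loc-sound ((e , ρ , r , next) ◅ ps) last s with loc-run⁻ ρ
    loc-sound ((e , ρ , r , inj₁ refl) ◅ ps) last s | v , d′ , refl , refl , σ with loc-sound ps last s
    ... | v′ , w , eq , steps , end = v′ , w , eq , (d′ , σ , r) ◅ steps , end
    loc-sound ((e , ρ , r , inj₂ refl) ◅ ps) last s | v , d′ , refl , refl , σ with post-sound ps last s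
    ... | w , eq , end = v , w , eq , (d′ , σ , r) ◅ ε , end

    pre-sound : ∀ {d U d₁ W₁ d₂} → Star Pass (inj₁ d , U) (d₁ , W₁) → Run trans d₁ W₁ W d₂ → stop d₂ →
      ∃₂ λ u w → ∃₂ λ v v′ → U ≡ map inj₁ u × W ≡ map inj₁ w ×
        Pre.Transduces d u v × Star (Loc.Transduces l₀) v v′ × Post.Transduces p₀ v′ w
    pre-sound ε ρ s with pre-run⁻ ρ
    pre-sound ε ρ () | u , v , d′ , refl , refl , refl , σ
    pre-sound ((e , ρ , r , next) ◅ ps) last s with pre-run⁻ ρ
    pre-sound ((e , ρ , r , inj₁ refl) ◅ ps) last s | u , v , d′ , refl , refl , refl , σ with loc-sound ps last s
    ... | v′ , w , eq , steps , end = u , w , v , v′ , refl , eq , (d′ , σ , r) , steps , end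
    pre-sound ((e , ρ , r , inj₂ refl) ◅ ps) last s | u , v , d′ , refl , refl , refl , σ with post-sound ps last s
    ... | w , eq , end = u , w , v , v , refl , eq , (d′ , σ , r) , ε , end

-- Length-preserving local rewriting; a rule is given as the list of its letter replacements

module _ {X : Set} where

  data Local (P : List (List (X × X))) : Rel (List X) 0ℓ where
    local : ∀ {ρ} u v → ρ ∈ P → Local P (u ++ map proj₁ ρ ++ v) (u ++ map proj₂ ρ ++ v)

  Local-length : ∀ {P w w′} → Local P w w′ → length w ≡ length w′
  Local-length (local {ρ} u v _) = ≡.trans (length-++ u) (≡.trans (cong (length u +_)
    (≡.trans (length-++ (map proj₁ ρ)) (≡.trans (cong (_+ length v) (≡.trans (length-map proj₁ ρ) (≡.sym (length-map proj₂ ρ))))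
    (≡.sym (length-++ (map proj₂ ρ)))))) (≡.sym (length-++ u)))

  Local-++ : ∀ {P} s {w w′} → Local P w w′ → Local P (s ++ w) (s ++ w′)
  Local-++ {P} s (local {ρ} u v ρ∈) =
    subst₂ (Local P) (++-assoc s u _) (++-assoc s u _) (local (s ++ u) v ρ∈)

maxLength : {X : Set} → List (List X) → ℕ
maxLength = foldr (λ ρ m → length ρ ⊔ m) 0

∈⇒length≤maxLength : ∀ {X : Set} {P : List (List X)} {ρ} → ρ ∈ P → length ρ ≤ maxLength P
∈⇒length≤maxLength {P = ρ ∷ P} (here refl) = ℕ.m≤m⊔n (length ρ) (maxLength P)
∈⇒length≤maxLength {P = ρ ∷ P} (there ρ∈)  = ℕ.≤-trans (∈⇒length≤maxLength ρ∈) (ℕ.m≤n⊔m (length ρ) (maxLength P))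

module _ {X : Set} (X-finite : Finite X) (P : List (List (X × X))) where
  private
    m : ℕ
    m = maxLength P

    _≟_ : DecidableEquality X
    _≟_ = finite-≟ X-finite

    _≟*_ : DecidableEquality (List (X × X))
    _≟*_ = ≡-dec (Product.≡-dec _≟_ _≟_)

    -- just b: the prefix b of the chosen rule is still to be read.
    trans : Maybe (BoundedList (X × X) m) → X → X → Maybe (BoundedList (X × X) m) → Set
    trans nothing  x y nothing   = x ≡ y
    trans nothing  x y (just b)  = word b ∷ʳ (x , y) ∈ P
    trans (just b) x y nothing   = ⊥
    trans (just b) x y (just b′) = word b ≡ word b′ ∷ʳ (x , y) ⊎ word b ≡ [] × x ≡ y × word b′ ≡ []

    trans? : ∀ d x y d′ → Dec (trans d x y d′)
    trans? nothing  x y nothing   = x ≟ y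
    trans? nothing  x y (just b)  = Any.any? (λ ρ → (word b ∷ʳ (x , y)) ≟* ρ) P
    trans? (just b) x y nothing   = no λ ()
    trans? (just b) x y (just b′) = (word b ≟* (word b′ ∷ʳ (x , y))) ⊎-dec ((word b ≟* []) ×-dec (x ≟ y) ×-dec (word b′ ≟* []))

    accepting : Maybe (BoundedList (X × X) m) → Set
    accepting nothing  = ⊤
    accepting (just b) = word b ≡ []

    accepting? : ∀ d → Dec (accepting d)
    accepting? nothing  = yes tt
    accepting? (just b) = word b ≟* []

  localTransducer : Transducer X X
  localTransducer = record
    { State = Maybe (BoundedList (X × X) m)
    ; finite = Finite-Maybe (Finite-BoundedList (Finite-× X-finite X-finite) m)
    ; trans = trans ; trans? = trans? ; accepting = accepting ; accepting? = accepting? }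

  open Transducer localTransducer using (Transduces)

  private
    -- Describes the suffix read so far: `v` was copied before the rule was chosen, `c` is the part
    -- of the rule already applied, `u` was copied after its completion. As long as a nonempty
    -- prefix `b` is outstanding, nothing can lie to the left of `c`, so `u` is empty.
    Partial : Maybe (BoundedList (X × X) m) → List X → List X → Set
    Partial nothing  w w′ = w ≡ w′
    Partial (just b) w w′ = ∃₂ λ c u → ∃ λ v → (word b ++ c) ∈ P × (u ≡ [] ⊎ word b ≡ []) ×
                            w ≡ u ++ map proj₁ c ++ v × w′ ≡ u ++ map proj₂ c ++ v

    partial : ∀ {w w′ d} → Run trans nothing w w′ d → Partial d w w′
    partial [] = refl
    partial (_∷_ {d′ = d′} {d″} t ρ) with partial ρ
    partial (_∷_ {d′ = nothing} {nothing} refl ρ) | refl = refl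
    partial (_∷_ {d′ = nothing} {just b} {x} {y} {u} t ρ) | refl = [ (x , y) ] , [] , u , t , inj₁ refl , refl , refl
    partial (_∷_ {d′ = just b} {just b′} {x} {y} (inj₁ eq) ρ) | c , u , v , ∈P , inj₂ b≡[] , _
      with () ← ++-conicalʳ (word b′) [ (x , y) ] (≡.trans (≡.sym eq) b≡[])
    partial (_∷_ {d′ = just b} {just b′} {x} {y} (inj₁ eq) ρ) | c , .[] , v , ∈P , inj₁ refl , refl , refl =
      (x , y) ∷ c , [] , v , subst (_∈ P) (≡.trans (cong (_++ c) eq) (∷ʳ-++ (word b′) (x , y) c)) ∈P , inj₁ refl , refl , refl
    partial (_∷_ {d′ = just b} {just b′} {x} {y} (inj₂ (b≡[] , refl , b′≡[])) ρ) | c , u , v , ∈P , _ , refl , refl =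
      c , x ∷ u , v , subst (λ b → (b ++ c) ∈ P) (≡.trans b≡[] (≡.sym b′≡[])) ∈P , inj₂ b′≡[] , refl , refl

  -- A pass that chooses no rule is a mere copy; hence a `Star`, of length at most one.
  local-sound : ∀ {w w′} → Transduces nothing w w′ → Star (Local P) w w′
  local-sound (nothing , ρ , _) with refl ← partial ρ = ε
  local-sound (just b , ρ , b≡[]) with partial ρ
  ... | c , u , v , ∈P , _ , refl , refl = local u v (subst (λ b → (b ++ c) ∈ P) b≡[] ∈P) ◅ ε

  local-complete : ∀ {w w′} → Local P w w′ → Transduces nothing w w′
  local-complete (local {ρ} u v ρ∈) = Product.map id (Product.map (Run-++ (consume ρ v [] refl)) id) (finish ρ)
    where
    -- The state after the suffix `c` of the rule has been read and the prefix `a` is outstanding.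
    -- With `c` empty no rule has been chosen yet; an empty rule thus amounts to copying in state
    -- `nothing`.
    pending : List (X × X) → List (X × X) → Maybe (BoundedList (X × X) m)
    pending a []      = nothing
    pending a (_ ∷ _) = just (truncate m a)

    copy : ∀ v → Run trans nothing v v nothing
    copy []      = []
    copy (x ∷ v) = refl ∷ copy v

    word-pending : ∀ a c → a ++ c ≡ ρ → word (truncate m a) ≡ a
    word-pending a c eq = word-truncate m a (ℕ.≤-trans (ℕ.m≤m+n (length a) (length c))
      (ℕ.≤-trans (ℕ.≤-reflexive (≡.trans (≡.sym (length-++ a)) (cong length eq))) (∈⇒length≤maxLength ρ∈)))

    consume : ∀ c v a → a ++ c ≡ ρ → Run trans nothing (map proj₁ c ++ v) (map proj₂ c ++ v) (pending a c)
    consume []            v a eq = copy v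
    consume ((x , y) ∷ []) v a eq =
      subst (_∈ P) (≡.trans (≡.sym eq) (cong (_∷ʳ (x , y)) (≡.sym (word-pending a _ eq)))) ρ∈ ∷ copy v
    consume ((x , y) ∷ c@(_ ∷ _)) v a eq =
      inj₁ (≡.trans (word-pending (a ∷ʳ (x , y)) c eq′) (cong (_∷ʳ (x , y)) (≡.sym (word-pending a _ eq))))
      ∷ consume c v (a ∷ʳ (x , y)) eq′
      where
      eq′ : (a ∷ʳ (x , y)) ++ c ≡ ρ
      eq′ = ≡.trans (∷ʳ-++ a (x , y) c) eq

    finish : ∀ c → ∃ λ d → Run trans (pending [] c) u u d × accepting d
    finish []      = nothing , copy u , tt
    finish (_ ∷ _) = _ , skip u , word-pending [] ρ refl
      where
      skip : ∀ u → Run trans (just (truncate m [])) u u (just (truncate m []))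
      skip []      = []
      skip (x ∷ u) = inj₂ (word-pending [] ρ refl , refl , word-pending [] ρ refl) ∷ skip u

-- Rewriting within bounded space, the unused cells (nothing) being spread over the word

Bounded : {X : Set} → RewritingSystem X → ℕ → Rel (List X) 0ℓ
Bounded S B w w′ = Rewrite S w w′ × length w′ ≤ B

module _ {X : Set} where

  -- The shorter side is filled up with blanks, so the rule becomes length-preserving and occupies
  -- as many cells as its longer side.
  pad : List X → List X → List (Maybe X × Maybe X)
  pad []      []      = []
  pad (x ∷ l) []      = (just x , nothing) ∷ pad l []
  pad []      (y ∷ r) = (nothing , just y) ∷ pad [] r
  pad (x ∷ l) (y ∷ r) = (just x , just y) ∷ pad l r

  catMaybes-pad₁ : ∀ l r → catMaybes (map proj₁ (pad l r)) ≡ l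
  catMaybes-pad₁ []      []      = refl
  catMaybes-pad₁ (x ∷ l) []      = cong (x ∷_) (catMaybes-pad₁ l [])
  catMaybes-pad₁ []      (y ∷ r) = catMaybes-pad₁ [] r
  catMaybes-pad₁ (x ∷ l) (y ∷ r) = cong (x ∷_) (catMaybes-pad₁ l r)

  catMaybes-pad₂ : ∀ l r → catMaybes (map proj₂ (pad l r)) ≡ r
  catMaybes-pad₂ []      []      = refl
  catMaybes-pad₂ (x ∷ l) []      = catMaybes-pad₂ l []
  catMaybes-pad₂ []      (y ∷ r) = cong (y ∷_) (catMaybes-pad₂ [] r)
  catMaybes-pad₂ (x ∷ l) (y ∷ r) = cong (y ∷_) (catMaybes-pad₂ l r)

  length-pad : ∀ l r → length (pad l r) ≡ length l ⊔ length r
  length-pad []      []      = refl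
  length-pad (x ∷ l) []      = cong suc (≡.trans (length-pad l []) (ℕ.⊔-identityʳ (length l)))
  length-pad []      (y ∷ r) = cong suc (length-pad [] r)
  length-pad (x ∷ l) (y ∷ r) = cong suc (length-pad l r)

  blanks : List (Maybe X) → ℕ
  blanks []            = 0
  blanks (nothing ∷ w) = suc (blanks w)
  blanks (just x ∷ w)  = blanks w

  length≡letters+blanks : ∀ w → length w ≡ length (catMaybes w) + blanks w
  length≡letters+blanks []            = refl
  length≡letters+blanks (nothing ∷ w) = ≡.trans (cong suc (length≡letters+blanks w)) (≡.sym (ℕ.+-suc _ _))
  length≡letters+blanks (just x ∷ w)  = cong suc (length≡letters+blanks w)

  catMaybes-blanks : ∀ n → catMaybes (replicate n nothing) ≡ ([] {A = X})
  catMaybes-blanks zero    = refl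
  catMaybes-blanks (suc n) = catMaybes-blanks n

module _ {X : Set} (X-finite : Finite X) (S : RewritingSystem X) where
  private
    swaps : X → List (List (Maybe X × Maybe X))
    swaps x = ((just x , nothing) ∷ (nothing , just x) ∷ []) ∷ ((nothing , just x) ∷ (just x , nothing) ∷ []) ∷ []

  spaced : List (List (Maybe X × Maybe X))
  spaced = map (λ { (l , r) → pad l r }) S ++ concat (map swaps (elements X-finite))

  private
    pad∈ : ∀ {l r} → (l , r) ∈ S → pad l r ∈ spaced
    pad∈ lr∈ = ∈-++⁺ˡ (∈-map⁺ (λ { (l , r) → pad l r }) lr∈)

    swap∈ : ∀ {x ρ} → ρ ∈ swaps x → ρ ∈ spaced
    swap∈ {x} ρ∈ = ∈-++⁺ʳ _ (∈-concat⁺′ ρ∈ (∈-map⁺ swaps (∈-elements X-finite x)))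

    Steps : Rel (List (Maybe X)) _
    Steps = Star (Local spaced)

    under : ∀ s {w w′} → Steps w w′ → Steps (s ++ w) (s ++ w′)
    under s = Star.gmap (s ++_) (Local-++ s)

    shift→ : ∀ w z → Steps (nothing ∷ map just w ++ z) (map just w ++ nothing ∷ z)
    shift→ []      z = ε
    shift→ (x ∷ w) z = local [] (map just w ++ z) (swap∈ {x} (there (here refl))) ◅ under [ just x ] (shift→ w z)

    shift← : ∀ w z → Steps (map just w ++ nothing ∷ z) (nothing ∷ map just w ++ z)
    shift← []      z = ε
    shift← (x ∷ w) z = under [ just x ] (shift← w z) ◅◅ local [] (map just w ++ z) (swap∈ {x} (here refl)) ◅ ε

    gathered : List (Maybe X) → List (Maybe X)
    gathered w = map just (catMaybes w) ++ replicate (blanks w) nothing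

    gather : ∀ w → Steps w (gathered w)
    gather []            = ε
    gather (just x ∷ w)  = under [ just x ] (gather w)
    gather (nothing ∷ w) = under [ nothing ] (gather w) ◅◅ shift→ (catMaybes w) _

    spread : ∀ w → Steps (gathered w) w
    spread []            = ε
    spread (just x ∷ w)  = under [ just x ] (spread w)
    spread (nothing ∷ w) = shift← (catMaybes w) _ ◅◅ under [ nothing ] (spread w)

  -- Swaps are reversible, so both words are linked to the arrangement with all letters in front.
  -- That arrangement depends only on the letters and on the number of blanks, which the length
  -- determines.
  spaced-rearrange : ∀ w w′ → length w ≡ length w′ → catMaybes w ≡ catMaybes w′ → Star (Local spaced) w w′
  spaced-rearrange w w′ |w|≡ cat≡ = subst (Steps w) gathered≡ (gather w) ◅◅ spread w′
    where
    blanks≡ : blanks w ≡ blanks w′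
    blanks≡ = ℕ.+-cancelˡ-≡ (length (catMaybes w)) _ _
      (≡.trans (≡.sym (length≡letters+blanks w)) (≡.trans |w|≡
      (≡.trans (length≡letters+blanks w′) (cong (λ c → length c + blanks w′) (≡.sym cat≡)))))
    gathered≡ : gathered w ≡ gathered w′
    gathered≡ = cong₂ (λ c b → map just c ++ replicate b nothing) cat≡ blanks≡

  private
    -- With the padded rule in place, the word takes `|u| + max |l| |r| + |v|` cells, which is the
    -- length of `c` or of `c′`. Both are at most `B`, so no further space is needed; the spare
    -- blanks are moved to the right end beforehand.
    spaced-step : ∀ {B c c′} w → length w ≡ B → catMaybes w ≡ c → length c ≤ B → Bounded S B c c′ →
                  ∃ λ w′ → Star (Local spaced) w w′ × length w′ ≡ B × catMaybes w′ ≡ c′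
    spaced-step {B} w |w|≡ cat≡ |c|≤ (rewriting {l} {r} u v lr∈ , |c′|≤) =
      result , spaced-rearrange w input (≡.trans |w|≡ (≡.sym |input|)) (≡.trans cat≡ (≡.sym (contents proj₁ (catMaybes-pad₁ l r))))
                ◅◅ local (map just u) rest (pad∈ lr∈) ◅ ε ,
      ≡.trans (≡.sym (Local-length (local {P = spaced} (map just u) rest (pad∈ lr∈)))) |input| ,
      contents proj₂ (catMaybes-pad₂ l r)
      where
      used : ℕ
      used = length u + (length l ⊔ length r + length v)
      rest input result : List (Maybe X)
      rest = map just v ++ replicate (B ∸ used) nothing
      input = map just u ++ map proj₁ (pad l r) ++ rest
      result = map just u ++ map proj₂ (pad l r) ++ rest
      used≤ : used ≤ B
      used≤ with ℕ.≤-total (length l) (length r)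
      ... | inj₁ l≤r = ℕ.≤-trans (ℕ.≤-reflexive (≡.trans (cong (λ m → length u + (m + length v)) (ℕ.m≤n⇒m⊔n≡n l≤r))
                                 (≡.sym (≡.trans (length-++ u) (cong (length u +_) (length-++ r)))))) |c′|≤
      ... | inj₂ r≤l = ℕ.≤-trans (ℕ.≤-reflexive (≡.trans (cong (λ m → length u + (m + length v)) (ℕ.m≥n⇒m⊔n≡m r≤l))
                                 (≡.sym (≡.trans (length-++ u) (cong (length u +_) (length-++ l)))))) |c|≤
      |input| : length input ≡ B
      |input| =
        ≡.trans (length-++ (map just u)) (≡.trans (cong₂ _+_ (length-map just u)
          (≡.trans (length-++ (map proj₁ (pad l r))) (cong₂ _+_ (≡.trans (length-map proj₁ (pad l r)) (length-pad l r))
            (≡.trans (length-++ (map just v)) (cong₂ _+_ (length-map just v) (length-replicate (B ∸ used)))))))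
        (≡.trans (cong (length u +_) (≡.sym (ℕ.+-assoc (length l ⊔ length r) (length v) _)))
        (≡.trans (≡.sym (ℕ.+-assoc (length u) _ _)) (ℕ.m+[n∸m]≡n used≤))))
      contents : ∀ (side : Maybe X × Maybe X → Maybe X) {m} → catMaybes (map side (pad l r)) ≡ m →
                catMaybes (map just u ++ map side (pad l r) ++ rest) ≡ u ++ m ++ v
      contents side eq =
        ≡.trans (catMaybes-++ (map just u) _) (cong₂ _++_ (mapMaybe-just u)
        (≡.trans (catMaybes-++ (map side (pad l r)) rest) (cong₂ _++_ eq
        (≡.trans (catMaybes-++ (map just v) _)
        (≡.trans (cong₂ _++_ (mapMaybe-just v) (catMaybes-blanks (B ∸ used))) (++-identityʳ v))))))

  spaced-complete : ∀ {B c c′} w w′ → length w ≡ B → length w′ ≡ B → catMaybes w ≡ c → catMaybes w′ ≡ c′ →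
                    length c ≤ B → Star (Bounded S B) c c′ → Star (Local spaced) w w′
  spaced-complete w w′ |w|≡ |w′|≡ cat≡ cat′≡ _ ε =
    spaced-rearrange w w′ (≡.trans |w|≡ (≡.sym |w′|≡)) (≡.trans cat≡ (≡.sym cat′≡))
  spaced-complete w w′ |w|≡ |w′|≡ cat≡ cat′≡ |c|≤ (s ◅ ss) with spaced-step w |w|≡ cat≡ |c|≤ s
  ... | w₁ , steps , |w₁|≡ , cat₁≡ = steps ◅◅ spaced-complete w₁ w′ |w₁|≡ |w′|≡ cat₁≡ cat′≡ (proj₂ s) ss

  spaced-sound : ∀ {w w′} → Local spaced w w′ → Star (Rewrite S) (catMaybes w) (catMaybes w′)
  spaced-sound (local {ρ} u v ρ∈) with ∈-++⁻ (map (λ { (l , r) → pad l r }) S) ρ∈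
  ... | inj₁ ∈pads with ∈-map⁻ (λ { (l , r) → pad l r }) ∈pads
  ... | (l , r) , lr∈ , refl = subst₂ (Star (Rewrite S)) (≡.sym (contents proj₁ (catMaybes-pad₁ l r)))
                                      (≡.sym (contents proj₂ (catMaybes-pad₂ l r)))
                                      (rewriting (catMaybes u) (catMaybes v) lr∈ ◅ ε)
    where
    contents : ∀ (side : Maybe X × Maybe X → Maybe X) {m} → catMaybes (map side (pad l r)) ≡ m →
              catMaybes (u ++ map side (pad l r) ++ v) ≡ catMaybes u ++ m ++ catMaybes v
    contents side eq = ≡.trans (catMaybes-++ u _) (cong (catMaybes u ++_)
                     (≡.trans (catMaybes-++ (map side (pad l r)) v) (cong (_++ catMaybes v) eq)))
  spaced-sound (local {ρ} u v ρ∈) | inj₂ ∈swaps with ∈-concat⁻′ (map swaps (elements X-finite)) ∈swaps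
  ... | _ , ρ∈ys , ys∈ with ∈-map⁻ swaps ys∈
  spaced-sound (local {ρ} u v ρ∈) | inj₂ ∈swaps | _ , here refl , ys∈ | x , _ , refl =
    subst (Star (Rewrite S) _) (≡.trans (catMaybes-++ u (just x ∷ nothing ∷ v)) (≡.sym (catMaybes-++ u (nothing ∷ just x ∷ v)))) ε
  spaced-sound (local {ρ} u v ρ∈) | inj₂ ∈swaps | _ , there (here refl) , ys∈ | x , _ , refl =
    subst (Star (Rewrite S) _) (≡.trans (catMaybes-++ u (nothing ∷ just x ∷ v)) (≡.sym (catMaybes-++ u (just x ∷ nothing ∷ v)))) ε

-- Bounded rewriting as a sweep machine

content : ∀ {X : Set} {K : ℕ} → List (Vec (Maybe X) K) → List X
content W = catMaybes (flat W)

module _ {I X : Set} {K : ℕ} (X-finite : Finite X) (S : RewritingSystem X)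
         (pre : Transducer I (Vec (Maybe X) K)) (post : Transducer (Vec (Maybe X) K) I)
         (p₀ : Transducer.State post) where
  private
    spacedTransducer : Transducer (Maybe X) (Maybe X)
    spacedTransducer = localTransducer (Finite-Maybe X-finite) (spaced X-finite S)

    loc : Transducer (Vec (Maybe X) K) (Vec (Maybe X) K)
    loc = blockwise spacedTransducer K

  boundedMachine : SweepMachine (I ⊎ Vec (Maybe X) K)
  boundedMachine = threePhase pre loc post nothing p₀

  private
    -- Rewriting ignores block borders but keeps the length, so every intermediate word can be cut
    -- into blocks again, and uniquely.
    loc-complete : ∀ W W′ → length W ≡ length W′ → Star (Local (spaced X-finite S)) (flat W) (flat W′) →
                   Star (Transducer.Transduces loc nothing) W W′
    loc-complete W W′ |W|≡ steps = go W refl |W|≡ steps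
      where
      split-injective : ∀ {k} (B B′ : Vec (Maybe X) k) {s s′} → toList B ++ s ≡ toList B′ ++ s′ → B ≡ B′ × s ≡ s′
      split-injective []      []       eq = refl , eq
      split-injective (x ∷ B) (y ∷ B′) eq =
        Product.map (cong₂ _∷_ (∷-injectiveˡ eq)) id (split-injective B B′ (∷-injectiveʳ eq))
      flat-injective : ∀ U U′ → length U ≡ length U′ → flat U ≡ flat U′ → U ≡ U′
      flat-injective []      []       _  _  = refl
      flat-injective (B ∷ U) (B′ ∷ U′) eq f with split-injective B B′ f
      ... | refl , f′ = cong (B ∷_) (flat-injective U U′ (ℕ.suc-injective eq) f′)
      go : ∀ W {t} → t ≡ flat W → length W ≡ length W′ → Star (Local (spaced X-finite S)) t (flat W′) →
           Star (Transducer.Transduces loc nothing) W W′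
      go W eq |W|≡ ε = subst (Star _ W) (≡.sym (flat-injective W′ W (≡.sym |W|≡) eq)) ε
      go W refl |W|≡ (_◅_ {j = t} s ss)
        with unflat (length W) t (≡.trans (≡.sym (Local-length s)) (length-flat W))
      ... | W₁ , refl , |W₁|≡ with local-complete (Finite-Maybe X-finite) (spaced X-finite S) s
      ... | d , ρ , acc = (d , blockwise-complete spacedTransducer K W W₁ (≡.sym |W₁|≡) ρ , acc)
                          ◅ go W₁ refl (≡.trans |W₁|≡ |W|≡) ss

    loc-sound : ∀ {W W′} → Star (Transducer.Transduces loc nothing) W W′ → Star (Rewrite S) (content W) (content W′)
    loc-sound = Star.kleisliStar content λ { (d , ρ , acc) →
      Star.kleisliStar catMaybes (spaced-sound X-finite S)
        (local-sound (Finite-Maybe X-finite) (spaced X-finite S) (d , blockwise-sound spacedTransducer K ρ , acc)) }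

  open SweepMachine boundedMachine using (Computes)

  boundedMachine-complete : ∀ {d u w} W W′ → Transducer.Transduces pre d u W → length W ≡ length W′ →
    Star (Bounded S (length W * K)) (content W) (content W′) → Transducer.Transduces post p₀ W′ w →
    Computes (inj₁ d) (map inj₁ u) (map inj₁ w)
  boundedMachine-complete W W′ r |W|≡ steps s = threePhase-complete pre loc post nothing p₀ r
    (loc-complete W W′ |W|≡ (spaced-complete X-finite S (flat W) (flat W′) (length-flat W)
      (≡.trans (length-flat W′) (cong (_* K) (≡.sym |W|≡))) refl refl
      (ℕ.≤-trans (ℕ.m≤m+n _ (blanks (flat W))) (ℕ.≤-reflexive (≡.trans (≡.sym (length≡letters+blanks (flat W))) (length-flat W))))
      steps)) s

  boundedMachine-sound : ∀ {d U U′} → Computes (inj₁ d) U U′ →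
    ∃₂ λ u w → ∃₂ λ W W′ → U ≡ map inj₁ u × U′ ≡ map inj₁ w × Transducer.Transduces pre d u W ×
      Star (Rewrite S) (content W) (content W′) × Transducer.Transduces post p₀ W′ w
  boundedMachine-sound r with threePhase-sound pre loc post nothing p₀ r
  ... | u , w , W , W′ , U≡ , U′≡ , pre-ok , steps , post-ok = u , w , W , W′ , U≡ , U′≡ , pre-ok , loc-sound steps , post-ok

-- Rewriting

module _ {X : Set} {R : RewritingSystem X} where

  Rewrite-++ˡ : ∀ s {w w′} → Rewrite R w w′ → Rewrite R (s ++ w) (s ++ w′)
  Rewrite-++ˡ s (rewriting u v lr∈) =
    subst₂ (Rewrite R) (++-assoc s u _) (++-assoc s u _) (rewriting (s ++ u) v lr∈)

  Rewrite-++ʳ : ∀ s {w w′} → Rewrite R w w′ → Rewrite R (w ++ s) (w′ ++ s)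
  Rewrite-++ʳ s (rewriting {l} {r} u v lr∈) =
    subst₂ (Rewrite R) (assoc l) (assoc r) (rewriting u (v ++ s) lr∈)
    where
    assoc : ∀ m → u ++ m ++ v ++ s ≡ (u ++ m ++ v) ++ s
    assoc m = ≡.sym (≡.trans (++-assoc u (m ++ v) s) (cong (u ++_) (++-assoc m v s)))

  under : ∀ s {w w′} → Star (Rewrite R) w w′ → Star (Rewrite R) (s ++ w) (s ++ w′)
  under s = Star.gmap (s ++_) (Rewrite-++ˡ s)

  rule : ∀ {l r} v → (l , r) ∈ R → Star (Rewrite R) (l ++ v) (r ++ v)
  rule v lr∈ = rewriting [] v lr∈ ◅ ε

  module _ (decreasing : LengthDecreasing R) where

    Rewrite-length : ∀ {w w′} → Rewrite R w w′ → length w′ ≤ length w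
    Rewrite-length (rewriting {l} {r} u v lr∈) =
      ℕ.≤-trans (ℕ.≤-reflexive (|++| r)) (ℕ.≤-trans (ℕ.+-monoʳ-≤ (length u) (ℕ.+-monoˡ-≤ (length v) (All.lookup decreasing lr∈)))
                (ℕ.≤-reflexive (≡.sym (|++| l))))
      where
      |++| : ∀ m → length (u ++ m ++ v) ≡ length u + (length m + length v)
      |++| m = ≡.trans (length-++ u) (cong (length u +_) (length-++ m))

    Rewrite*-length : ∀ {w w′} → Star (Rewrite R) w w′ → length w′ ≤ length w
    Rewrite*-length ε        = ℕ.≤-refl
    Rewrite*-length (s ◅ ss) = ℕ.≤-trans (Rewrite*-length ss) (Rewrite-length s)

    bounded : ∀ {B w w′} → length w ≤ B → Star (Rewrite R) w w′ → Star (Bounded R B) w w′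
    bounded |w|≤ ε        = ε
    bounded |w|≤ (s ◅ ss) = (s , |w′|≤) ◅ bounded |w′|≤ ss
      where |w′|≤ = ℕ.≤-trans (Rewrite-length s) |w|≤

-- Normal forms are recognised from right to left by an automaton that
-- remembers as many letters as the longest left-hand side has.

module NormalForms {Γ : Set} (Γ-finite : Finite Γ) (R : RewritingSystem Γ) where

  Fresh : List Γ → Set
  Fresh w = ∀ ρ → ρ ∈ R → take (length (proj₁ ρ)) w ≢ proj₁ ρ

  Fresh? : ∀ w → Dec (Fresh w)
  Fresh? w = Dec.map′ (λ all ρ ρ∈ → All.lookup all ρ∈) (λ fresh → All.tabulate (λ {ρ} ρ∈ → fresh ρ ρ∈))
    (All.all? (λ { (l , _) → ¬? (≡-dec (finite-≟ Γ-finite) (take (length l) w) l) }) R)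

  Clean : List Γ → Set
  Clean []      = ⊤
  Clean (x ∷ w) = Fresh (x ∷ w) × Clean w

  window : ℕ
  window = maxLength (map proj₁ R)

  private
    take-++ : ∀ (l v : List Γ) → take (length l) (l ++ v) ≡ l
    take-++ []      v = refl
    take-++ (x ∷ l) v = cong (x ∷_) (take-++ l v)

    starts : ∀ (l w : List Γ) → take (length l) w ≡ l → ∃ λ v → w ≡ l ++ v
    starts []      w       eq = w , refl
    starts (x ∷ l) (y ∷ w) eq = Product.map id (cong₂ _∷_ (∷-injectiveˡ eq)) (starts l w (∷-injectiveʳ eq))

  -- `Clean` inspects the nonempty suffixes, since the automaton tests after each letter. `Fresh []`
  -- covers the remaining suffix: it fails exactly if some left-hand side is empty.
  NF⇒Clean : ∀ {w} → NF R w → Clean w × Fresh []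
  NF⇒Clean {w} nf = clean [] w refl , λ { ([] , _) lr∈ _ → nf [] w lr∈ refl ; (x ∷ l , _) lr∈ () }
    where
    clean : ∀ u v → w ≡ u ++ v → Clean v
    clean u []      _  = tt
    clean u (x ∷ v) eq =
      (λ (l , _) lr∈ t → let (v′ , v≡) = starts l (x ∷ v) t in nf u v′ lr∈ (≡.trans eq (cong (u ++_) v≡))) ,
      clean (u ∷ʳ x) v (≡.trans eq (≡.sym (∷ʳ-++ u x v)))

  Clean⇒NF : ∀ {w} → Clean w → Fresh [] → NF R w
  Clean⇒NF {w} clean fresh {l} u v lr∈ eq = go u w clean eq
    where
    now : ∀ w → Fresh w → w ≢ l ++ v
    now w fresh eq = fresh _ lr∈ (≡.trans (cong (take (length l)) eq) (take-++ l v))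
    go : ∀ u w → Clean w → w ≢ u ++ l ++ v
    go []      []      _           eq = now [] fresh eq
    go []      (x ∷ w) (fresh , _) eq = now (x ∷ w) fresh eq
    go (y ∷ u) (x ∷ w) (_ , clean) eq = go u w clean (∷-injectiveʳ eq)

  private
    take-truncate : ∀ k m (w : List Γ) → k ≤ m → take k (word (truncate m w)) ≡ take k w
    take-truncate zero    m       w       _         = refl
    take-truncate (suc k) (suc m) []      _         = refl
    take-truncate (suc k) (suc m) (x ∷ w) (s≤s k≤m) = cong (x ∷_) (take-truncate k m w k≤m)

    take-window : ∀ {l r} w → (l , r) ∈ R → take (length l) (word (truncate window w)) ≡ take (length l) w
    take-window {l} w lr∈ = take-truncate (length l) window w (∈⇒length≤maxLength (∈-map⁺ proj₁ lr∈))

  Fresh-window : ∀ w → Fresh w → Fresh (word (truncate window w))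
  Fresh-window w fresh ρ lr∈ eq = fresh ρ lr∈ (≡.trans (≡.sym (take-window w lr∈)) eq)

  Fresh-window⁻ : ∀ w → Fresh (word (truncate window w)) → Fresh w
  Fresh-window⁻ w fresh ρ lr∈ eq = fresh ρ lr∈ (≡.trans (take-window w lr∈) eq)

  push : Γ → BoundedList Γ window → BoundedList Γ window
  push x b = truncate window (x ∷ word b)

  -- The letter that `push` may drop lies beyond the window of the longer word as well. Hence the
  -- window is a legitimate automaton state: its successor depends on it and on the new letter
  -- alone.
  push-truncate : ∀ x w → push x (truncate window w) ≡ truncate window (x ∷ w)
  push-truncate x w = go window
    where
    forget : ∀ m w → truncate m (word (truncate (suc m) w)) ≡ truncate {Γ} m w
    forget zero    w       = refl
    forget (suc m) []      = refl
    forget (suc m) (x ∷ w) = cong (λ b → just (x , b)) (forget m w)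
    go : ∀ m → truncate m (x ∷ word (truncate m w)) ≡ truncate m (x ∷ w)
    go zero    = refl
    go (suc m) = cong (λ b → just (x , b)) (forget m w)

-- From rewriting systems to transductions

data Side : Set where
  𝐋 𝐑 𝐌 : Side

Finite-Side : Finite Side
Finite-Side = Finite-retract
  (Finite-Maybe Finite-Bool)
  (λ { nothing → 𝐋
     ; (just true) → 𝐑
     ; (just false) → 𝐌 })
  (λ { 𝐋 → nothing , refl
     ; 𝐑 → just true , refl
     ; 𝐌 → just false , refl })

-- The tape holds a shuffle of a left word and a right word; a letter 𝐌 x
-- belongs to both.  The left word is rewritten, and u # v is accepted if
-- all letters can eventually be matched.
module _ {Γ : Set} (Γ-finite : Finite Γ) (𝓡 : RewritingSystem Γ) (decreasing : LengthDecreasing 𝓡) where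
  open NormalForms Γ-finite 𝓡

  private
    Sym : Set
    Sym = Side × Γ

    Sym-finite : Finite Sym
    Sym-finite = Finite-× Finite-Side Γ-finite

    on : Side → List Γ → List Sym
    on s w = map (s ,_) w

    length-on : ∀ s w → length (on s w) ≡ length w
    length-on s w = length-map (λ x → s , x) w

    leftRule : List Γ × List Γ → List Sym × List Sym
    leftRule (l , r) = on 𝐋 l , on 𝐋 r

    swapRule : Γ × Γ → List Sym × List Sym
    swapRule (x , y) = (𝐋 , x) ∷ (𝐑 , y) ∷ [] , (𝐑 , y) ∷ (𝐋 , x) ∷ []

    matchRule : Γ → List Sym × List Sym
    matchRule x = (𝐋 , x) ∷ (𝐑 , x) ∷ [] , (𝐌 , x) ∷ []

    S : RewritingSystem Sym
    S = map leftRule 𝓡 ++ map swapRule (elements (Finite-× Γ-finite Γ-finite)) ++ map matchRule (elements Γ-finite)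

    data IsRule : List Sym × List Sym → Set where
      isLeft  : ∀ {l r} → (l , r) ∈ 𝓡 → IsRule (leftRule (l , r))
      isSwap  : ∀ x y → IsRule (swapRule (x , y))
      isMatch : ∀ x → IsRule (matchRule x)

    ∈S : ∀ {ρ} → ρ ∈ S → IsRule ρ
    ∈S ρ∈ with ∈-++⁻ (map leftRule 𝓡) ρ∈
    ... | inj₁ ρ∈₁ with ∈-map⁻ leftRule ρ∈₁
    ... | _ , lr∈ , refl = isLeft lr∈
    ∈S ρ∈ | inj₂ ρ∈₂ with ∈-++⁻ (map swapRule (elements (Finite-× Γ-finite Γ-finite))) ρ∈₂
    ... | inj₁ ρ∈₃ with ∈-map⁻ swapRule ρ∈₃
    ... | _ , _ , refl = isSwap _ _
    ∈S ρ∈ | inj₂ ρ∈₂ | inj₂ ρ∈₄ with ∈-map⁻ matchRule ρ∈₄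
    ... | _ , _ , refl = isMatch _

    left∈ : ∀ {l r} → (l , r) ∈ 𝓡 → leftRule (l , r) ∈ S
    left∈ lr∈ = ∈-++⁺ˡ (∈-map⁺ leftRule lr∈)

    swap∈ : ∀ x y → swapRule (x , y) ∈ S
    swap∈ x y = ∈-++⁺ʳ (map leftRule 𝓡) (∈-++⁺ˡ (∈-map⁺ swapRule (∈-elements (Finite-× Γ-finite Γ-finite) (x , y))))

    match∈ : ∀ x → matchRule x ∈ S
    match∈ x = ∈-++⁺ʳ (map leftRule 𝓡) (∈-++⁺ʳ (map swapRule (elements (Finite-× Γ-finite Γ-finite)))
                                                (∈-map⁺ matchRule (∈-elements Γ-finite x)))

    S-decreasing : LengthDecreasing S
    S-decreasing = All.tabulate (λ ρ∈ → go (∈S ρ∈))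
      where
      go : ∀ {ρ} → IsRule ρ → length (proj₂ ρ) ≤ length (proj₁ ρ)
      go (isLeft {l} {r} lr∈) = subst₂ _≤_ (≡.sym (length-on 𝐋 r)) (≡.sym (length-on 𝐋 l)) (All.lookup decreasing lr∈)
      go (isSwap x y)         = ℕ.≤-refl
      go (isMatch x)          = s≤s z≤n

    leftLetter rightLetter : Sym → List Γ
    leftLetter (𝐋 , x) = [ x ]
    leftLetter (𝐑 , x) = []
    leftLetter (𝐌 , x) = [ x ]
    rightLetter (𝐋 , x) = []
    rightLetter (𝐑 , x) = [ x ]
    rightLetter (𝐌 , x) = [ x ]

    leftWord rightWord : List Sym → List Γ
    leftWord  = concatMap leftLetter
    rightWord = concatMap rightLetter

    leftWord-on : ∀ w → leftWord (on 𝐋 w) ≡ w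
    leftWord-on []      = refl
    leftWord-on (x ∷ w) = cong (x ∷_) (leftWord-on w)

    rightWord-on : ∀ w → rightWord (on 𝐑 w) ≡ w
    rightWord-on []      = refl
    rightWord-on (x ∷ w) = cong (x ∷_) (rightWord-on w)

    leftWord-right : ∀ w → leftWord (on 𝐑 w) ≡ []
    leftWord-right []      = refl
    leftWord-right (x ∷ w) = leftWord-right w

    rightWord-left : ∀ w → rightWord (on 𝐋 w) ≡ []
    rightWord-left []      = refl
    rightWord-left (x ∷ w) = rightWord-left w

    concatMap-++₃ : ∀ (f : Sym → List Γ) u m v → concatMap f (u ++ m ++ v) ≡ concatMap f u ++ concatMap f m ++ concatMap f v
    concatMap-++₃ f u m v = ≡.trans (concatMap-++ f u (m ++ v)) (cong (concatMap f u ++_) (concatMap-++ f m v))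

    -- A letter `𝐌` counts on both sides, so swapping and matching change neither word. A left rule
    -- replaces a factor of the left word and touches no right letter.
    sound-step : ∀ {w w′} → Rewrite S w w′ → Star (Rewrite 𝓡) (leftWord w) (leftWord w′) × rightWord w ≡ rightWord w′
    sound-step (rewriting u v ρ∈) = go (∈S ρ∈)
      where
      go : ∀ {l r} → IsRule (l , r) → Star (Rewrite 𝓡) (leftWord (u ++ l ++ v)) (leftWord (u ++ r ++ v)) ×
                                      rightWord (u ++ l ++ v) ≡ rightWord (u ++ r ++ v)
      go {l} {r} ρ = subst₂ (Star (Rewrite 𝓡)) (≡.sym (concatMap-++₃ leftLetter u l v)) (≡.sym (concatMap-++₃ leftLetter u r v)) (lefts ρ)
                   , ≡.trans (concatMap-++₃ rightLetter u l v) (≡.trans (cong (λ m → rightWord u ++ m ++ rightWord v) (rights ρ))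
                                                                        (≡.sym (concatMap-++₃ rightLetter u r v)))
        where
        lefts : IsRule (l , r) → Star (Rewrite 𝓡) (leftWord u ++ leftWord l ++ leftWord v) (leftWord u ++ leftWord r ++ leftWord v)
        lefts (isLeft {l′} {r′} lr∈) =
          subst₂ (λ l r → Star (Rewrite 𝓡) (leftWord u ++ l ++ leftWord v) (leftWord u ++ r ++ leftWord v))
                 (≡.sym (leftWord-on l′)) (≡.sym (leftWord-on r′)) (rewriting (leftWord u) (leftWord v) lr∈ ◅ ε)
        lefts (isSwap x y) = ε
        lefts (isMatch x)  = ε
        rights : IsRule (l , r) → rightWord l ≡ rightWord r
        rights (isLeft {l′} {r′} lr∈) = ≡.trans (rightWord-left l′) (≡.sym (rightWord-left r′))
        rights (isSwap x y) = refl
        rights (isMatch x)  = refl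

    sound : ∀ {w w′} → Star (Rewrite S) w w′ → Star (Rewrite 𝓡) (leftWord w) (leftWord w′) × rightWord w ≡ rightWord w′
    sound ε        = ε , refl
    sound (s ◅ ss) with sound-step s | sound ss
    ... | s₁ , eq₁ | s₂ , eq₂ = s₁ ◅◅ s₂ , ≡.trans eq₁ eq₂

    rewrite-left : ∀ {w w′} v → Star (Rewrite 𝓡) w w′ → Star (Rewrite S) (on 𝐋 w ++ v) (on 𝐋 w′ ++ v)
    rewrite-left v = Star.gmap (λ w → on 𝐋 w ++ v) λ { (rewriting {l} {r} s t lr∈) →
      Rewrite-++ʳ v (subst₂ (Rewrite S) (on-++₃ s l t) (on-++₃ s r t) (rewriting (on 𝐋 s) (on 𝐋 t) (left∈ lr∈))) }
      where
      on-++₃ : ∀ u m v → on 𝐋 u ++ on 𝐋 m ++ on 𝐋 v ≡ on 𝐋 (u ++ m ++ v)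
      on-++₃ u m v = ≡.sym (≡.trans (map-++ (𝐋 ,_) u (m ++ v)) (cong (on 𝐋 u ++_) (map-++ (𝐋 ,_) m v)))

    overtake : ∀ w y v → Star (Rewrite S) (on 𝐋 w ++ (𝐑 , y) ∷ v) ((𝐑 , y) ∷ on 𝐋 w ++ v)
    overtake []      y v = ε
    overtake (x ∷ w) y v = under [ (𝐋 , x) ] (overtake w y v) ◅◅ rule (on 𝐋 w ++ v) (swap∈ x y)

    match : ∀ w → Star (Rewrite S) (on 𝐋 w ++ on 𝐑 w) (on 𝐌 w)
    match []      = ε
    match (x ∷ w) = under [ (𝐋 , x) ] (overtake w x (on 𝐑 w)) ◅◅ rule (on 𝐋 w ++ on 𝐑 w) (match∈ x)
                    ◅◅ under [ (𝐌 , x) ] (match w)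

    -- One letter per block suffices: `u`, `a` and `v` fill exactly the cells of `u # v`, since `a`
    -- takes the place of `#`, and no rule of `S` lengthens the word.
    Block : Set
    Block = Vec (Maybe Sym) 1

    blocks : Side → List Γ → List Block
    blocks s w = map (λ x → just (s , x) ∷ []) w

    content-blocks : ∀ s w V → content (blocks s w ++ V) ≡ on s w ++ content V
    content-blocks s []      V = refl
    content-blocks s (x ∷ w) V = cong ((s , x) ∷_) (content-blocks s w V)

    Block-≟ : DecidableEquality Block
    Block-≟ = Vec.≡-dec (Maybe.≡-dec (finite-≟ Sym-finite))

    Window : Set
    Window = BoundedList Γ window

    Pushed : Side → Window → Γ → Block → Window → Set
    Pushed s b x y b′ = b′ ≡ push x b × Fresh (word b′) × y ≡ just (s , x) ∷ []

    Pushed? : ∀ s b x y b′ → Dec (Pushed s b x y b′)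
    Pushed? s b x y b′ = finite-≟ (Finite-BoundedList Γ-finite _) b′ _ ×-dec Fresh? (word b′) ×-dec Block-≟ y _

    empty : Window
    empty = truncate _ []

  module _ {a : Γ} where
    private
      -- true while reading v, false while reading u
      trans : Bool × Window → Maybe Γ → Block → Bool × Window → Set
      trans (true , b)  (just x) y (true , b′)  = Pushed 𝐑 b x y b′
      trans (false , b) (just x) y (false , b′) = Pushed 𝐋 b x y b′
      trans (true , b)  nothing  y (false , b′) = b′ ≡ empty × Fresh (word b′) × y ≡ just (𝐋 , a) ∷ []
      trans (false , _) (just _) _ (true , _)   = ⊥
      trans (true , _)  (just _) _ (false , _)  = ⊥
      trans (true , _)  nothing  _ (true , _)   = ⊥
      trans (false , _) nothing  _ _            = ⊥

      trans? : ∀ d x y d′ → Dec (trans d x y d′)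
      trans? (true , b)  (just x) y (true , b′)  = Pushed? 𝐑 b x y b′
      trans? (false , b) (just x) y (false , b′) = Pushed? 𝐋 b x y b′
      trans? (true , b)  nothing  y (false , b′) =
        finite-≟ (Finite-BoundedList Γ-finite _) b′ _ ×-dec Fresh? (word b′) ×-dec Block-≟ y _
      trans? (false , _) (just _) _ (true , _)   = no λ ()
      trans? (true , _)  (just _) _ (false , _)  = no λ ()
      trans? (true , _)  nothing  _ (true , _)   = no λ ()
      trans? (false , _) nothing  _ _            = no λ ()

      pre : Transducer (Maybe Γ) Block
      pre = record
        { State = Bool × Window ; finite = Finite-× Finite-Bool (Finite-BoundedList Γ-finite _)
        ; trans = trans ; trans? = trans?
        ; accepting = λ d → proj₁ d ≡ false ; accepting? = λ d → finite-≟ Finite-Bool (proj₁ d) false }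

      Matched : Maybe Sym → Set
      Matched z = z ≡ nothing ⊎ ∃ λ x → z ≡ just (𝐌 , x)

      Matched? : ∀ z → Dec (Matched z)
      Matched? z = Maybe.≡-dec (finite-≟ Sym-finite) z nothing
                   ⊎-dec ∃? Γ-finite (λ x → Maybe.≡-dec (finite-≟ Sym-finite) z (just (𝐌 , x)))

      post : Transducer Block (Maybe Γ)
      post = record
        { State = ⊤ ; finite = Finite-⊤
        ; trans = λ _ B y _ → All Matched (toList B) × y ≡ nothing
        ; trans? = λ _ B y _ → All.all? Matched? (toList B) ×-dec Maybe.≡-dec (finite-≟ Γ-finite) y nothing
        ; accepting = λ _ → ⊤ ; accepting? = λ _ → yes tt }

      -- The window is emptied at `#`, so no left-hand side is sought across the border between `u`
      -- and `v`. The test made there is `Fresh []`.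
      Scanned : List (Maybe Γ) → List Block → Bool × Window → Set
      Scanned W V (true , b)  = ∃ λ v → W ≡ map just v × V ≡ blocks 𝐑 v × b ≡ truncate _ v × Clean v
      Scanned W V (false , b) = ∃₂ λ u v → W ≡ map just u ++ nothing ∷ map just v ×
        V ≡ blocks 𝐋 u ++ (just (𝐋 , a) ∷ []) ∷ blocks 𝐑 v × b ≡ truncate _ u ×
        Clean u × Clean v × Fresh []

      push-clean : ∀ {x} w {b} → b ≡ push x (truncate _ w) → Fresh (word b) →
                   b ≡ truncate _ (x ∷ w) × Fresh (x ∷ w)
      push-clean {x} w b≡ fresh = b≡′ , Fresh-window⁻ (x ∷ w) (subst (λ b → Fresh (word b)) b≡′ fresh)
        where b≡′ = ≡.trans b≡ (push-truncate x w)

      scanned : ∀ {W V d} → Run trans (true , empty) W V d → Scanned W V d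
      scanned [] = [] , refl , refl , refl , tt
      scanned (_∷_ {d′ = d′} {d″} {x} t ρ) with scanned ρ
      scanned (_∷_ {d′ = true , _} {true , b} {just x} (b≡ , fresh , refl) ρ) | v , refl , refl , refl , clean
        with push-clean v b≡ fresh
      ... | b≡′ , fresh′ = x ∷ v , refl , refl , b≡′ , fresh′ , clean
      scanned (_∷_ {d′ = true , _} {false , b} {nothing} (refl , fresh , refl) ρ) | v , refl , refl , refl , clean =
        [] , v , refl , refl , refl , tt , clean , Fresh-window⁻ [] fresh
      scanned (_∷_ {d′ = false , _} {false , b} {just x} (b≡ , fresh , refl) ρ) | u , v , refl , refl , refl , clean , rest
        with push-clean u b≡ fresh
      ... | b≡′ , fresh′ = x ∷ u , v , refl , refl , b≡′ , (fresh′ , clean) , rest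

      scan-right : ∀ v → Clean v → Run trans (true , empty) (map just v) (blocks 𝐑 v) (true , truncate _ v)
      scan-right []      _               = []
      scan-right (x ∷ v) (fresh , clean) =
        (≡.sym (push-truncate x v) , Fresh-window (x ∷ v) fresh , refl) ∷ scan-right v clean

      scan-left : ∀ u → Clean u → Run trans (false , empty) (map just u) (blocks 𝐋 u) (false , truncate _ u)
      scan-left []      _               = []
      scan-left (x ∷ u) (fresh , clean) =
        (≡.sym (push-truncate x u) , Fresh-window (x ∷ u) fresh , refl) ∷ scan-left u clean

      T : Transduction Γ
      T (u , v) = NF 𝓡 u × NF 𝓡 v × Star (Rewrite 𝓡) (u ++ [ a ]) v

      machine : SweepMachine (Maybe Γ ⊎ Block)
      machine = boundedMachine Sym-finite S pre post tt

      Δ-finite : Finite (Maybe Γ ⊎ Block)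
      Δ-finite = Finite-⊎ (Finite-Maybe Γ-finite) (Finite-Vec (Finite-Maybe Sym-finite) 1)

      input : Maybe Γ ↣ (Maybe Γ ⊎ Block)
      input = mk↣ Sum.inj₁-injective

      lbm : LBM (Maybe Γ)
      lbm = sweepLBM machine Δ-finite input (inj₁ (true , empty))

      start-content : ∀ u v → content (blocks 𝐋 u ++ (just (𝐋 , a) ∷ []) ∷ blocks 𝐑 v) ≡ on 𝐋 (u ++ [ a ]) ++ on 𝐑 v
      start-content u v =
        ≡.trans (content-blocks 𝐋 u _)
        (≡.trans (cong (λ w → on 𝐋 u ++ (𝐋 , a) ∷ w) (≡.trans (cong content (≡.sym (++-identityʳ (blocks 𝐑 v))))
                                                     (≡.trans (content-blocks 𝐑 v []) (++-identityʳ (on 𝐑 v)))))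
        (≡.trans (≡.sym (∷ʳ-++ (on 𝐋 u) (𝐋 , a) (on 𝐑 v))) (cong (_++ on 𝐑 v) (≡.sym (map-++ (𝐋 ,_) u [ a ])))))

      module _ (u v : List Γ) where
        W W′ : List Block
        W  = blocks 𝐋 u ++ (just (𝐋 , a) ∷ []) ∷ blocks 𝐑 v
        W′ = blocks 𝐌 v ++ replicate (length W ∸ length v) (nothing ∷ [])

        v≤W : length v ≤ length W
        v≤W = ℕ.≤-trans (ℕ.≤-reflexive (≡.sym (length-map (λ x → just (𝐑 , x) ∷ []) v)))
              (ℕ.≤-trans (ℕ.n≤1+n _) (ℕ.≤-trans (ℕ.m≤n+m _ (length (blocks 𝐋 u))) (ℕ.≤-reflexive (≡.sym (length-++ (blocks 𝐋 u))))))

        W≡W′ : length W ≡ length W′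
        W≡W′ = ≡.sym (≡.trans (length-++ (blocks 𝐌 v))
                     (≡.trans (cong₂ _+_ (length-map _ v) (length-replicate (length W ∸ length v))) (ℕ.m+[n∸m]≡n v≤W)))

        content-W′ : content W′ ≡ on 𝐌 v
        content-W′ = ≡.trans (content-blocks 𝐌 v _) (≡.trans (cong (on 𝐌 v ++_) (none (length W ∸ length v))) (++-identityʳ (on 𝐌 v)))
          where
          none : ∀ n → content {Sym} (replicate n (nothing ∷ [])) ≡ []
          none zero    = refl
          none (suc n) = none n

        content≤ : length (content W) ≤ length W * 1
        content≤ = ℕ.≤-trans (length-catMaybes (flat W)) (ℕ.≤-reflexive (length-flat W))

        pre-run : Clean u → Clean v → Fresh [] →
                  Run trans (true , empty) (map just u ++ nothing ∷ map just v) W (false , truncate _ u)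
        pre-run u-clean v-clean fresh =
          Run-++ ((refl , Fresh-window [] fresh , refl) ∷ scan-right v v-clean) (scan-left u u-clean)

        matched-run : ∀ V → All (λ B → All Matched (toList B)) V → ∃ λ w → Run (Transducer.trans post) tt V w tt
        matched-run []      []       = [] , []
        matched-run (B ∷ V) (m ∷ ms) = nothing ∷ proj₁ (matched-run V ms) , (m , refl) ∷ proj₂ (matched-run V ms)

        post-run : ∃ λ w → Run (Transducer.trans post) tt W′ w tt
        post-run = matched-run W′
          (All.++⁺ (all-matched v) (All.replicate⁺ (length W ∸ length v) (inj₁ refl ∷ [])))
          where
          all-matched : ∀ v → All (λ B → All Matched (toList B)) (blocks 𝐌 v)
          all-matched []      = []
          all-matched (x ∷ v) = (inj₂ (x , refl) ∷ []) ∷ all-matched v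

        derivation⁺ : Star (Rewrite 𝓡) (u ++ [ a ]) v → Star (Bounded S (length W * 1)) (content W) (content W′)
        derivation⁺ steps = bounded S-decreasing content≤ (subst₂ (Star (Rewrite S)) (≡.sym (start-content u v)) (≡.sym content-W′)
          (rewrite-left (on 𝐑 v) steps ◅◅ match v))

        computes⁺ : T (u , v) → SweepMachine.Computes machine (inj₁ (true , empty))
                      (map inj₁ (map just u ++ nothing ∷ map just v)) (map inj₁ (proj₁ post-run))
        computes⁺ (u-nf , v-nf , steps) with NF⇒Clean u-nf | NF⇒Clean v-nf
        ... | u-clean , fresh | v-clean , _ = boundedMachine-complete Sym-finite S pre post tt W W′
          (_ , pre-run u-clean v-clean fresh , refl) W≡W′ (derivation⁺ steps) (tt , proj₂ post-run , tt)

      accepts : ∀ u v → T (u , v) → LBM.Accepts lbm (map just u ++ nothing ∷ map just v)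
      accepts u v t = sweepLBM-complete machine Δ-finite input (inj₁ (true , empty)) (computes⁺ u v t)

      matched : ∀ {V : List Block} {w} → Run (Transducer.trans post) tt V w tt → leftWord (content V) ≡ rightWord (content V)
      matched [] = refl
      matched (_∷_ {x = z ∷ []} (inj₁ refl ∷ [] , _) ρ)       = matched ρ
      matched (_∷_ {x = z ∷ []} (inj₂ (x , refl) ∷ [] , _) ρ) = cong (x ∷_) (matched ρ)

      -- The right word remains `v`, the left word is derived from `u a`, and at the end the two
      -- agree.
      derivation⁻ : ∀ u v w → Star (Rewrite S) (on 𝐋 (u ++ [ a ]) ++ on 𝐑 v) w → leftWord w ≡ rightWord w →
                    Star (Rewrite 𝓡) (u ++ [ a ]) v
      derivation⁻ u v w steps balanced = subst₂ (Star (Rewrite 𝓡)) left≡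
        (≡.trans balanced (≡.trans (≡.sym (proj₂ (sound steps))) right≡)) (proj₁ (sound steps))
        where
        left≡ : leftWord (on 𝐋 (u ++ [ a ]) ++ on 𝐑 v) ≡ u ++ [ a ]
        left≡ = ≡.trans (concatMap-++ leftLetter (on 𝐋 (u ++ [ a ])) (on 𝐑 v))
               (≡.trans (cong₂ _++_ (leftWord-on (u ++ [ a ])) (leftWord-right v)) (++-identityʳ _))
        right≡ : rightWord (on 𝐋 (u ++ [ a ]) ++ on 𝐑 v) ≡ v
        right≡ = ≡.trans (concatMap-++ rightLetter (on 𝐋 (u ++ [ a ])) (on 𝐑 v))
                         (cong₂ _++_ (rightWord-left (u ++ [ a ])) (rightWord-on v))

      in-language : ∀ {w b} {W W′ : List Block} → Scanned w W (false , b) → Star (Rewrite S) (content W) (content W′) →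
                    leftWord (content W′) ≡ rightWord (content W′) → graphLanguage T w
      in-language {W′ = W′} (u , v , refl , refl , _ , u-clean , v-clean , fresh) steps balanced =
        u , v , (Clean⇒NF u-clean fresh , Clean⇒NF v-clean fresh ,
                 derivation⁻ u v (content W′) (subst (λ w → Star (Rewrite S) w (content W′)) (start-content u v) steps) balanced) ,
        refl

      computes⁻ : ∀ {w w′} {W W′ : List Block} → Transducer.Transduces pre (true , empty) w W →
                  Star (Rewrite S) (content W) (content W′) → Transducer.Transduces post tt W′ w′ → graphLanguage T w
      computes⁻ {W′ = W′} ((false , b) , ρ , _) steps (_ , ρ′ , _) = in-language {W′ = W′} (scanned ρ) steps (matched ρ′)
      computes⁻ ((true , b) , ρ , ()) steps _

      accepted : ∀ w → LBM.Accepts lbm w → graphLanguage T w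
      accepted w acc = go (boundedMachine-sound Sym-finite S pre post tt
                            (proj₂ (sweepLBM-sound machine Δ-finite input (inj₁ (true , empty)) acc)))
        where
        go : ∀ {U′} →
             (∃₂ λ u u′ → ∃₂ λ W W′ → map inj₁ w ≡ map inj₁ u × U′ ≡ map inj₁ u′ ×
               Transducer.Transduces pre (true , empty) u W × Star (Rewrite S) (content W) (content W′) ×
               Transducer.Transduces post tt W′ u′) → graphLanguage T w
        go (u , u′ , W , W′ , eq , _ , pre-ok , steps , post-ok) =
          subst (graphLanguage T) (≡.sym (map-injective Sum.inj₁-injective eq)) (computes⁻ {W = W} {W′} pre-ok steps post-ok)

    rewritingTransduction : IncrementalContextSensitive T
    -- The increment is the appended letter `a`; rewriting never adds to it.
    rewritingTransduction = 1 ,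
      (λ { {u} (_ , _ , steps) → ℕ.≤-trans (Rewrite*-length decreasing steps) (ℕ.≤-reflexive (length-++ u)) }) ,
      lbm , λ w → mk⇔ (λ { (u , v , t , refl) → accepts u v t }) (accepted w)

Cayley⇒Transduction : ∀ {V A : Set} {G : Graph V A} → IsCayleyTypeGraph G → IsTransductionGraph G
Cayley⇒Transduction (Γ , Γ-finite , ι , 𝓡 , decreasing , iso) =
  Γ , Γ-finite , (λ a (u , v) → cayleyGraph 𝓡 ι (u , a , v)) ,
  (λ a → rewritingTransduction Γ-finite 𝓡 decreasing {Injection.to ι a}) , iso

-- A linearly bounded machine as a length-decreasing rewriting system

∷-split : ∀ {X Y : Set} (f : X → Y) w u {v} → map f w ≡ u ++ v → ∃₂ λ w₁ w₂ → w ≡ w₁ ++ w₂ × u ≡ map f w₁ × v ≡ map f w₂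
∷-split f w       []      eq = [] , w , refl , refl , ≡.sym eq
∷-split f (x ∷ w) (y ∷ u) eq with ∷-split f w u (∷-injectiveʳ eq)
... | w₁ , w₂ , refl , refl , refl = x ∷ w₁ , w₂ , refl , cong (_∷ map f w₁) (≡.sym (∷-injectiveˡ eq)) , refl

unique-inj₂ : ∀ {X Y : Set} u {y : Y} {v} s {y′ t} → map (inj₁ {A = X}) u ++ inj₂ y ∷ map inj₁ v ≡ s ++ inj₂ y′ ∷ t →
              s ≡ map inj₁ u × y ≡ y′ × t ≡ map inj₁ v
unique-inj₂ []      []      refl = refl , refl , refl
unique-inj₂ {X} {Y} [] {v = v} (_ ∷ s) eq = ⊥-elim (none v s (∷-injectiveʳ eq))
  where
  none : ∀ (v : List X) s {y′ : Y} {t} → map inj₁ v ≢ s ++ inj₂ y′ ∷ t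
  none []      []      ()
  none (x ∷ v) []      ()
  none (x ∷ v) (_ ∷ s) eq = none v s (∷-injectiveʳ eq)
unique-inj₂ (x ∷ u) (z ∷ s) eq =
  Product.map (cong₂ _∷_ (≡.sym (∷-injectiveˡ eq))) id (unique-inj₂ u s (∷-injectiveʳ eq))

module _ {B : Set} (M : LBM B) where
  open LBM M
  private
    Cells-finite : Finite (Cell Γ)
    Cells-finite = Finite-Cell Γ-finite

  -- The extra letter `†` announces acceptance and then eats the cells, so acceptance becomes
  -- derivability of the one word `[ † ]`, whatever the accepting configuration is.
  Letter : Set
  Letter = Cell Γ ⊎ Maybe Q

  Letter-finite : Finite Letter
  Letter-finite = Finite-⊎ Cells-finite (Finite-Maybe Q-finite)

  pattern cell X = inj₁ X
  pattern st q   = inj₂ (just q)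
  pattern †      = inj₂ nothing

  data MachineRule : List Letter × List Letter → Set where
    forwards  : ∀ {p X q Y s} → move p X q Y ⊕ s ∈ δ → MachineRule (st p ∷ cell X ∷ [] , cell Y ∷ st q ∷ [])
    backwards : ∀ {p X q Y s} C → move p X q Y ⊖ s ∈ δ →
                MachineRule (cell C ∷ st p ∷ cell X ∷ [] , st q ∷ cell C ∷ cell Y ∷ [])
    accept    : ∀ {q} → q ∈ F → MachineRule (st q ∷ [] , † ∷ [])
    eatˡ      : ∀ X → MachineRule (cell X ∷ † ∷ [] , † ∷ [])
    eatʳ      : ∀ X → MachineRule († ∷ cell X ∷ [] , † ∷ [])

  private
    moveRules : MoveRule Q Γ → RewritingSystem Letter
    moveRules (move p X q Y ⊕ s) = (st p ∷ cell X ∷ [] , cell Y ∷ st q ∷ []) ∷ []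
    moveRules (move p X q Y ⊖ s) =
      map (λ C → cell C ∷ st p ∷ cell X ∷ [] , st q ∷ cell C ∷ cell Y ∷ []) (elements Cells-finite)

    acceptRule : Q → List Letter × List Letter
    acceptRule q = st q ∷ [] , † ∷ []

    eatRules : Cell Γ → RewritingSystem Letter
    eatRules X = (cell X ∷ † ∷ [] , † ∷ []) ∷ († ∷ cell X ∷ [] , † ∷ []) ∷ []

  machineRules : RewritingSystem Letter
  machineRules = concat (map moveRules δ) ++ map acceptRule F ++ concat (map eatRules (elements Cells-finite))

  machineRules⁺ : ∀ {ρ} → MachineRule ρ → ρ ∈ machineRules
  machineRules⁺ (forwards r∈)    = ∈-++⁺ˡ (∈-concat⁺′ (here refl) (∈-map⁺ moveRules r∈))
  machineRules⁺ (backwards C r∈) = ∈-++⁺ˡ (∈-concat⁺′ (∈-map⁺ _ (∈-elements Cells-finite C)) (∈-map⁺ moveRules r∈))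
  machineRules⁺ (accept q∈)      = ∈-++⁺ʳ (concat (map moveRules δ)) (∈-++⁺ˡ (∈-map⁺ acceptRule q∈))
  machineRules⁺ (eatˡ X) = ∈-++⁺ʳ (concat (map moveRules δ)) (∈-++⁺ʳ (map acceptRule F)
    (∈-concat⁺′ (here refl) (∈-map⁺ eatRules (∈-elements Cells-finite X))))
  machineRules⁺ (eatʳ X) = ∈-++⁺ʳ (concat (map moveRules δ)) (∈-++⁺ʳ (map acceptRule F)
    (∈-concat⁺′ (there (here refl)) (∈-map⁺ eatRules (∈-elements Cells-finite X))))

  machineRules⁻ : ∀ {ρ} → ρ ∈ machineRules → MachineRule ρ
  machineRules⁻ ρ∈ with ∈-++⁻ (concat (map moveRules δ)) ρ∈
  ... | inj₁ ∈moves with ∈-concat⁻′ (map moveRules δ) ∈moves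
  ... | _ , ρ∈ys , ys∈ with ∈-map⁻ moveRules ys∈
  machineRules⁻ ρ∈ | inj₁ ∈moves | _ , here refl , ys∈ | move p X q Y ⊕ s , r∈ , refl = forwards r∈
  machineRules⁻ ρ∈ | inj₁ ∈moves | _ , ρ∈ys , ys∈ | move p X q Y ⊖ s , r∈ , refl with ∈-map⁻ _ ρ∈ys
  ... | C , _ , refl = backwards C r∈
  machineRules⁻ ρ∈ | inj₂ ∈rest with ∈-++⁻ (map acceptRule F) ∈rest
  ... | inj₁ ∈accept with ∈-map⁻ acceptRule ∈accept
  ... | q , q∈ , refl = accept q∈
  machineRules⁻ ρ∈ | inj₂ ∈rest | inj₂ ∈eat with ∈-concat⁻′ (map eatRules (elements Cells-finite)) ∈eat
  ... | _ , ρ∈ys , ys∈ with ∈-map⁻ eatRules ys∈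
  machineRules⁻ ρ∈ | inj₂ ∈rest | inj₂ ∈eat | _ , here refl , ys∈         | X , _ , refl = eatˡ X
  machineRules⁻ ρ∈ | inj₂ ∈rest | inj₂ ∈eat | _ , there (here refl) , ys∈ | X , _ , refl = eatʳ X

  hat : B → Letter
  hat b = cell (sym (Injection.to input b))

  opening : List Letter
  opening = cell ⟦ ∷ st q₀ ∷ []

  start-word : List B → List Letter
  start-word w = opening ++ map hat w ++ [ cell ⟧ ]

  private
    encode : StateWord Q Γ → List Letter
    encode (u ⟨ q ⟩ v) = map cell u ++ st q ∷ map cell v

    encode-initial : ∀ w → encode (initial w) ≡ start-word w
    encode-initial w = cong (opening ++_)
      (≡.trans (map-++ cell (map (λ b → sym (Injection.to input b)) w) [ ⟧ ]) (cong (_++ [ cell ⟧ ]) (≡.sym (map-∘ w))))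

    encode-step : ∀ {c c′} → LBMStep c c′ → Rewrite machineRules (encode c) (encode c′)
    encode-step (move p X q Y ⊕ s , r∈ , forward {u = u} {v}) =
      subst (Rewrite machineRules _) (≡.trans (≡.sym (∷ʳ-++ (map cell u) (cell Y) _))
                     (cong (_++ st q ∷ map cell v) (≡.sym (map-++ cell u [ Y ]))))
            (rewriting (map cell u) (map cell v) (machineRules⁺ (forwards r∈)))
    encode-step (move p X q Y ⊖ s , r∈ , backward {u = u} {C} {v}) =
      subst (λ w → Rewrite machineRules w (encode (u ⟨ q ⟩ (C ∷ Y ∷ v))))
            (≡.trans (≡.sym (∷ʳ-++ (map cell u) (cell C) _)) (cong (_++ st p ∷ cell X ∷ map cell v) (≡.sym (map-++ cell u [ C ]))))
            (rewriting (map cell u) (map cell v) (machineRules⁺ (backwards C r∈)))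

    devour : ∀ u v → Star (Rewrite machineRules) (map cell u ++ † ∷ map cell v) [ † ]
    devour []      []      = ε
    devour []      (X ∷ v) = rule (map cell v) (machineRules⁺ (eatʳ X)) ◅◅ devour [] v
    devour (X ∷ u) v       = under [ cell X ] (devour u v) ◅◅ rule [] (machineRules⁺ (eatˡ X))

  machineRules-complete : ∀ {w} → Accepts w → Star (Rewrite machineRules) (start-word w) [ † ]
  machineRules-complete {w} (u ⟨ q ⟩ v , steps , q∈) =
    subst (λ w → Star (Rewrite machineRules) w [ † ]) (encode-initial w)
      (Star.gmap encode encode-step steps ◅◅ under (map cell u) (rule (map cell v) (machineRules⁺ (accept q∈))) ◅◅ devour u v)

  private
    module _ (w₀ : List B) where
      -- Nothing is recorded about a word after `†` has appeared: its appearance already proves that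
      -- `w₀` is accepted.
      Reachable : List Letter → Set
      Reachable w = (∃ λ c → Star LBMStep (initial w₀) c × w ≡ encode c) ⊎ Accepts w₀

      reachable-step : ∀ {w w′} → Rewrite machineRules w w′ → Reachable w → Reachable w′
      reachable-step _ (inj₂ accepts) = inj₂ accepts
      reachable-step (rewriting s t ρ∈) (inj₁ (u ⟨ q ⟩ v , steps , eq)) = go u q v s t steps (machineRules⁻ ρ∈) eq
        where
        go : ∀ u q v s t {l r} → Star LBMStep (initial w₀) (u ⟨ q ⟩ v) → MachineRule (l , r) →
             s ++ l ++ t ≡ encode (u ⟨ q ⟩ v) → Reachable (s ++ r ++ t)
        go u q v s t steps (forwards r∈) eq with unique-inj₂ u s (≡.sym eq)
        go u q (X ∷ v) s t steps (forwards {Y = Y} r∈) eq | refl , refl , refl =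
          inj₁ (_ , steps ◅◅ (_ , r∈ , forward) ◅ ε ,
                ≡.trans (≡.sym (∷ʳ-++ (map cell u) (cell Y) _)) (cong (_++ _) (≡.sym (map-++ cell u [ Y ]))))
        go u q v s t steps (backwards C r∈) eq
          with unique-inj₂ u (s ∷ʳ cell C) (≡.trans (≡.sym eq) (≡.sym (∷ʳ-++ s (cell C) _)))
        ... | s≡ , refl , t≡ with ∷-split cell u s (≡.sym s≡)
        go u q (X ∷ v) s t steps (backwards C r∈) eq | s≡ , refl , refl | u′ , C′ ∷ [] , refl , refl , refl =
          inj₁ (_ , steps ◅◅ (_ , r∈ , backward) ◅ ε , refl)
        go u q v s t steps (accept q∈) eq with unique-inj₂ u s (≡.sym eq)
        ... | _ , refl , _ = inj₂ (_ , steps , q∈)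
        go u q v s t steps (eatˡ X) eq with unique-inj₂ u (s ∷ʳ cell X) (≡.trans (≡.sym eq) (≡.sym (∷ʳ-++ s (cell X) _)))
        ... | _ , () , _
        go u q v s t steps (eatʳ X) eq with unique-inj₂ u s (≡.sym eq)
        ... | _ , () , _

      reachable : ∀ {w w′} → Star (Rewrite machineRules) w w′ → Reachable w → Reachable w′
      reachable ε        r = r
      reachable (s ◅ ss) r = reachable ss (reachable-step s r)

  -- The condition on `z` is weaker than `z ≡ [ † ]` because it will be tested block by block,
  -- letter by letter. It suffices, as every word before acceptance contains a state.
  machineRules-sound : ∀ {w z} → Star (Rewrite machineRules) (start-word w) z → All (_≡ †) z → Accepts w
  machineRules-sound {w} steps all† = result (reachable w steps (inj₁ (_ , ε , ≡.sym (encode-initial w)))) all†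
    where
    no-state : ∀ u {q z} → ¬ All (_≡ †) (map cell u ++ st q ∷ z)
    no-state []      (() ∷ _)
    no-state (X ∷ u) (() ∷ _)
    result : ∀ {z} → Reachable w z → All (_≡ †) z → Accepts w
    result (inj₂ accepts)              _    = accepts
    result (inj₁ (u ⟨ q ⟩ v , _ , refl)) all† = ⊥-elim (no-state u all†)

  machineRules-shape : ∀ {l r} → (l , r) ∈ machineRules → l ≢ [] × r ≢ [] × length r ≤ length l
  machineRules-shape ρ∈ = go (machineRules⁻ ρ∈)
    where
    go : ∀ {l r} → MachineRule (l , r) → l ≢ [] × r ≢ [] × length r ≤ length l
    go (forwards _)    = (λ ()) , (λ ()) , ℕ.≤-refl
    go (backwards _ _) = (λ ()) , (λ ()) , ℕ.≤-refl
    go (accept _)      = (λ ()) , (λ ()) , ℕ.≤-refl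
    go (eatˡ _)        = (λ ()) , (λ ()) , s≤s z≤n
    go (eatʳ _)        = (λ ()) , (λ ()) , s≤s z≤n

-- Growing rewriting systems

Growing : {X : Set} → RewritingSystem X → Set
Growing R = ∀ {l r} → (l , r) ∈ R → length l ≤ length r

module _ {X : Set} {R : RewritingSystem X} (growing : Growing R) where

  private
    Rewrite-grows : ∀ {w w′} → Rewrite R w w′ → length w ≤ length w′
    Rewrite-grows (rewriting {l} {r} u v lr∈) =
      ℕ.≤-trans (ℕ.≤-reflexive (|++| l)) (ℕ.≤-trans (ℕ.+-monoʳ-≤ (length u) (ℕ.+-monoˡ-≤ (length v) (growing lr∈)))
                (ℕ.≤-reflexive (≡.sym (|++| r))))
      where
      |++| : ∀ m → length (u ++ m ++ v) ≡ length u + (length m + length v)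
      |++| m = ≡.trans (length-++ u) (cong (length u +_) (length-++ m))

  Rewrite*-grows : ∀ {w w′} → Star (Rewrite R) w w′ → length w ≤ length w′
  Rewrite*-grows ε        = ℕ.≤-refl
  Rewrite*-grows (s ◅ ss) = ℕ.≤-trans (Rewrite-grows s) (Rewrite*-grows ss)

  -- Lengths never go down, so a bound on the last word holds all along the derivation; `bounded` is
  -- the counterpart with a bound on the first word.
  growing-bounded : ∀ {B w w′} → length w′ ≤ B → Star (Rewrite R) w w′ → Star (Bounded R B) w w′
  growing-bounded |w′|≤ ε        = ε
  growing-bounded |w′|≤ (s ◅ ss) = (s , ℕ.≤-trans (Rewrite*-grows ss) |w′|≤) ◅ growing-bounded |w′|≤ ss

Rewrite-⊆ : ∀ {X : Set} {R R′ : RewritingSystem X} → (∀ {ρ} → ρ ∈ R → ρ ∈ R′) → ∀ {w w′} → Rewrite R w w′ → Rewrite R′ w w′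
Rewrite-⊆ R⊆R′ (rewriting u v lr∈) = rewriting u v (R⊆R′ lr∈)

collect : {X Y : Set} → (X → Maybe (List Y)) → List X → Maybe (List Y)
collect f []      = just []
collect f (x ∷ w) = Maybe.zipWith _++_ (f x) (collect f w)

collect-++ : ∀ {X Y : Set} (f : X → Maybe (List Y)) u {v y z} → collect f u ≡ just y → collect f v ≡ just z →
             collect f (u ++ v) ≡ just (y ++ z)
collect-++ f []      refl v≡ = v≡
collect-++ f (x ∷ u) u≡ v≡ with f x | collect f u in u′≡ | u≡
... | just y | just z | refl =
  ≡.trans (cong (Maybe.zipWith _++_ (just y)) (collect-++ f u u′≡ v≡)) (cong just (≡.sym (++-assoc y z _)))

-- The word U u G₂ ⟧ rewrites to † K v exactly if the machine accepts u # v: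
-- G₂ guesses v from right to left, keeping a copy K v, and then G₁ moves to
-- the left over u, so that the start word of the machine is written down.
module _ {Γ : Set} (Γ-finite : Finite Γ) (M : LBM (Maybe Γ)) where

  data Symbol : Set where
    U K   : Γ → Symbol
    G₁ G₂ : Symbol
    tp     : Letter M → Symbol

  Symbol-finite : Finite Symbol
  Symbol-finite = Finite-retract
    (Finite-⊎ (Finite-⊎ Γ-finite Γ-finite) (Finite-⊎ Finite-Bool (Letter-finite M)))
    (λ { (inj₁ (inj₁ x)) → U x
       ; (inj₁ (inj₂ x)) → K x
       ; (inj₂ (inj₁ true)) → G₁
       ; (inj₂ (inj₁ false)) → G₂
       ; (inj₂ (inj₂ z)) → tp z })
    (λ { (U x) → inj₁ (inj₁ x) , refl
       ; (K x) → inj₁ (inj₂ x) , refl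
       ; G₁ → inj₂ (inj₁ true) , refl
       ; G₂ → inj₂ (inj₁ false) , refl
       ; (tp z) → inj₂ (inj₂ z) , refl })

  private
    letter : Γ → Letter M
    letter x = hat M (just x)

    # : Letter M
    # = hat M nothing

    P : RewritingSystem (Letter M)
    P = machineRules M

    guessRule eatRule : Γ → List Symbol × List Symbol
    guessRule y = G₂ ∷ [] , G₂ ∷ tp (letter y) ∷ K y ∷ []
    eatRule x   = U x ∷ G₁ ∷ [] , G₁ ∷ tp (letter x) ∷ []

    commuteRule : Γ × Letter M → List Symbol × List Symbol
    commuteRule (y , z) = K y ∷ tp z ∷ [] , tp z ∷ K y ∷ []

    workRule : List (Letter M) × List (Letter M) → List Symbol × List Symbol
    workRule (l , r) = map tp l , map tp r

    -- The rules are divided by their effect on the length. A derivation that applies all growing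
    -- rules before the others is longest in between, and this gives its space bound.
    growRules workRules : RewritingSystem Symbol
    growRules = (G₂ ∷ [] , G₁ ∷ tp # ∷ []) ∷ (G₁ ∷ [] , map tp (opening M)) ∷
                map guessRule (elements Γ-finite) ++ map eatRule (elements Γ-finite)
    workRules = map commuteRule (elements (Finite-× Γ-finite (Letter-finite M))) ++ map workRule P

  guessAndRun : RewritingSystem Symbol
  guessAndRun = growRules ++ workRules

  private
    data IsGrowRule : List Symbol × List Symbol → Set where
      separate : IsGrowRule (G₂ ∷ [] , G₁ ∷ tp # ∷ [])
      open′    : IsGrowRule (G₁ ∷ [] , map tp (opening M))
      guess    : ∀ y → IsGrowRule (guessRule y)
      eat      : ∀ x → IsGrowRule (eatRule x)

    data IsWorkRule : List Symbol × List Symbol → Set where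
      commute : ∀ y z → IsWorkRule (commuteRule (y , z))
      work    : ∀ {l r} → (l , r) ∈ P → IsWorkRule (workRule (l , r))

    growRules⁻ : ∀ {ρ} → ρ ∈ growRules → IsGrowRule ρ
    growRules⁻ (here refl)         = separate
    growRules⁻ (there (here refl)) = open′
    growRules⁻ (there (there ρ∈)) with ∈-++⁻ (map guessRule (elements Γ-finite)) ρ∈
    ... | inj₁ ρ∈₁ with ∈-map⁻ guessRule ρ∈₁
    ... | y , _ , refl = guess y
    growRules⁻ (there (there ρ∈)) | inj₂ ρ∈₂ with ∈-map⁻ eatRule ρ∈₂
    ... | x , _ , refl = eat x

    workRules⁻ : ∀ {ρ} → ρ ∈ workRules → IsWorkRule ρ
    workRules⁻ ρ∈ with ∈-++⁻ (map commuteRule (elements (Finite-× Γ-finite (Letter-finite M)))) ρ∈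
    ... | inj₁ ρ∈₁ with ∈-map⁻ commuteRule ρ∈₁
    ... | (y , z) , _ , refl = commute y z
    workRules⁻ ρ∈ | inj₂ ρ∈₂ with ∈-map⁻ workRule ρ∈₂
    ... | _ , lr∈ , refl = work lr∈

    guess∈ : ∀ y → guessRule y ∈ growRules
    guess∈ y = there (there (∈-++⁺ˡ (∈-map⁺ guessRule (∈-elements Γ-finite y))))

    eat∈ : ∀ x → eatRule x ∈ growRules
    eat∈ x = there (there (∈-++⁺ʳ (map guessRule (elements Γ-finite)) (∈-map⁺ eatRule (∈-elements Γ-finite x))))

    commute∈ : ∀ y z → commuteRule (y , z) ∈ workRules
    commute∈ y z = ∈-++⁺ˡ (∈-map⁺ commuteRule (∈-elements (Finite-× Γ-finite (Letter-finite M)) (y , z)))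

    work∈ : ∀ {l r} → (l , r) ∈ P → workRule (l , r) ∈ workRules
    work∈ lr∈ = ∈-++⁺ʳ (map commuteRule (elements (Finite-× Γ-finite (Letter-finite M)))) (∈-map⁺ workRule lr∈)

    growing : Growing growRules
    growing ρ∈ = go (growRules⁻ ρ∈)
      where
      go : ∀ {l r} → IsGrowRule (l , r) → length l ≤ length r
      go separate  = s≤s z≤n
      go open′     = s≤s z≤n
      go (guess y) = s≤s z≤n
      go (eat x)   = ℕ.≤-refl

    decreasing : LengthDecreasing workRules
    decreasing = All.tabulate (λ ρ∈ → go (workRules⁻ ρ∈))
      where
      go : ∀ {ρ} → IsWorkRule ρ → length (proj₂ ρ) ≤ length (proj₁ ρ)
      go (commute y z)    = ℕ.≤-refl
      go (work {l} {r} lr∈) = subst₂ _≤_ (≡.sym (length-map tp r)) (≡.sym (length-map tp l))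
                                     (proj₂ (proj₂ (machineRules-shape M lr∈)))

  guessAndRun-lhs : ∀ {l r} → (l , r) ∈ guessAndRun → l ≢ []
  guessAndRun-lhs ρ∈ with ∈-++⁻ growRules ρ∈
  ... | inj₁ ρ∈₁ = grow (growRules⁻ ρ∈₁)
    where
    grow : ∀ {l r} → IsGrowRule (l , r) → l ≢ []
    grow separate ()
    grow open′ ()
    grow (guess y) ()
    grow (eat x) ()
  ... | inj₂ ρ∈₂ = work′ (workRules⁻ ρ∈₂)
    where
    work′ : ∀ {l r} → IsWorkRule (l , r) → l ≢ []
    work′ (commute y z) ()
    work′ (work {[]} lr∈) _ = proj₁ (machineRules-shape M lr∈) refl
    work′ (work {_ ∷ _} lr∈) ()

  initialPhrase : List Γ → List Symbol
  initialPhrase u = map U u ++ G₂ ∷ tp (cell ⟧) ∷ []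

  copySymbol : Symbol → Maybe (List Γ)
  copySymbol (K y) = just [ y ]
  copySymbol (tp †) = just []
  copySymbol _     = nothing

  private
    -- For suitable guesses of the G₂ in t, the phrase t, preceded by the
    -- still unread letters U υ, becomes the word α of the machine and the
    -- copy κ.
    data Completes : List Γ → List Symbol → List (Letter M) → List Γ → Set where
      []  : Completes [] [] [] []
      U   : ∀ {υ x t α κ} → Completes (υ ∷ʳ x) t α κ → Completes υ (U x ∷ t) α κ
      K   : ∀ {y t α κ} → Completes [] t α κ → Completes [] (K y ∷ t) α (y ∷ κ)
      tp   : ∀ {z t α κ} → Completes [] t α κ → Completes [] (tp z ∷ t) (z ∷ α) κ
      G₁  : ∀ {υ t α κ} → Completes [] t α κ → Completes υ (G₁ ∷ t) (opening M ++ map letter υ ++ α) κ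
      G₂  : ∀ {υ t α κ} w → Completes [] t α κ →
            Completes υ (G₂ ∷ t) (opening M ++ map letter υ ++ # ∷ map letter w ++ α) (w ++ κ)

    -- Guesses are settled only as the rules are applied, so the simulation runs backwards: a
    -- completion of the later phrase determines one of the earlier phrase, and the machine word of
    -- the earlier one derives that of the later one.
    Pulls : List Symbol → List Symbol → Set
    Pulls t t′ = ∀ {υ α′ κ} → Completes υ t′ α′ κ → ∃ λ α → Completes υ t α κ × Star (Rewrite P) α α′

    pulls-under : ∀ u {t t′} → Pulls t t′ → Pulls (u ++ t) (u ++ t′)
    pulls-under []       p κ     = p κ
    pulls-under (_ ∷ u) p (U κ) = Product.map id (Product.map U id) (pulls-under u p κ)
    pulls-under (_ ∷ u) p (K κ) = Product.map id (Product.map K id) (pulls-under u p κ)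
    pulls-under (_ ∷ u) p (tp {z} κ) = Product.map (z ∷_) (Product.map tp (under [ z ])) (pulls-under u p κ)
    pulls-under (_ ∷ u) p (G₁ {υ} κ) =
      Product.map (λ α → opening M ++ map letter υ ++ α) (Product.map G₁ (λ s → under (opening M) (under (map letter υ) s)))
                  (pulls-under u p κ)
    pulls-under (_ ∷ u) p (G₂ {υ} w κ) =
      Product.map (λ α → opening M ++ map letter υ ++ # ∷ map letter w ++ α)
                  (Product.map (G₂ w) (λ s → under (opening M) (under (map letter υ) (under [ # ] (under (map letter w) s)))))
                  (pulls-under u p κ)

    ≡⇒Star : ∀ {w w′} → w ≡ w′ → Star (Rewrite P) w w′
    ≡⇒Star refl = ε

    letters-∷ʳ : ∀ w y α → map letter (w ∷ʳ y) ++ α ≡ map letter w ++ letter y ∷ α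
    letters-∷ʳ w y α = ≡.trans (cong (_++ α) (map-++ letter w [ y ])) (∷ʳ-++ (map letter w) (letter y) α)

    completes-map : ∀ r {t α κ} → Completes [] (map tp r ++ t) α κ → ∃ λ α′ → α ≡ r ++ α′ × Completes [] t α′ κ
    completes-map []      κ     = _ , refl , κ
    completes-map (z ∷ r) (tp κ) with completes-map r κ
    ... | α′ , refl , κ′ = α′ , refl , κ′

    map-completes : ∀ l {t α κ} → Completes [] t α κ → Completes [] (map tp l ++ t) (l ++ α) κ
    map-completes []      κ = κ
    map-completes (z ∷ l) κ = tp (map-completes l κ)

    -- A growing rule writes down a piece of what `Completes` anticipates: `guess y` the last letter
    -- of the pending guess, `eat x` the last unread letter, `separate` the end of the guess,
    -- `open′` the start of the tape. The machine word is unchanged, hence no steps of `P`.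
    pulls-grow : ∀ {l r} s → IsGrowRule (l , r) → Pulls (l ++ s) (r ++ s)
    pulls-grow s separate (G₁ (tp κ)) = _ , G₂ [] κ , ε
    pulls-grow s open′ (tp (tp κ)) = _ , G₁ κ , ε
    pulls-grow s (guess y) (G₂ {υ} {κ = .(y ∷ _)} w (tp {α = α} (K {κ = κ′} κ))) =
      _ , subst (Completes _ _ _) (∷ʳ-++ w y κ′) (G₂ (w ∷ʳ y) κ) ,
      ≡⇒Star (cong (λ α′ → opening M ++ map letter υ ++ # ∷ α′) (letters-∷ʳ w y α))
    pulls-grow s (eat x) (G₁ {υ} (tp {α = α} κ)) =
      _ , U (G₁ κ) , ≡⇒Star (cong (opening M ++_) (letters-∷ʳ υ x α))

    -- Empty right-hand sides have to be excluded here: a leading `tp` ensures that no unread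
    -- letters are pending in front of the phrase, so that the left-hand side may stand there.
    pulls-work : ∀ {l r} s → IsWorkRule (l , r) → Pulls (l ++ s) (r ++ s)
    pulls-work s (commute y z) (tp (K κ)) = _ , K (tp κ) , ε
    pulls-work s (work {l} {[]} lr∈) κ = ⊥-elim (proj₁ (proj₂ (machineRules-shape M lr∈)) refl)
    pulls-work s (work {l} {z ∷ r} lr∈) (tp κ) with completes-map r κ
    ... | α′ , refl , κ′ = _ , map-completes l κ′ , rule α′ lr∈

    pulls : ∀ {t t′} → Rewrite guessAndRun t t′ → Pulls t t′
    pulls (rewriting u s ρ∈) with ∈-++⁻ growRules ρ∈
    ... | inj₁ ρ∈₁ = pulls-under u (pulls-grow s (growRules⁻ ρ∈₁))
    ... | inj₂ ρ∈₂ = pulls-under u (pulls-work s (workRules⁻ ρ∈₂))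

    pulls* : ∀ {t t′} → Star (Rewrite guessAndRun) t t′ → Pulls t t′
    pulls* ε        κ = _ , κ , ε
    pulls* (s ◅ ss) κ with pulls* ss κ
    ... | α₁ , κ₁ , steps₁ with pulls s κ₁
    ... | α₀ , κ₀ , steps₀ = α₀ , κ₀ , steps₀ ◅◅ steps₁

    copy-completes : ∀ t {v} → collect copySymbol t ≡ just v → ∃ λ α → Completes [] t α v × All (_≡ †) α
    copy-completes []        refl = [] , [] , []
    copy-completes (K y ∷ t) eq with collect copySymbol t in copy≡ | eq
    ... | just v | refl with copy-completes t copy≡
    ... | α , κ , all† = α , K κ , all†
    copy-completes (tp † ∷ t) eq with collect copySymbol t in copy≡ | eq
    ... | just v | refl with copy-completes t copy≡
    ... | α , κ , all† = † ∷ α , tp κ , refl ∷ all†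
    copy-completes (U _ ∷ t) ()
    copy-completes (G₁ ∷ t) ()
    copy-completes (G₂ ∷ t) ()
    copy-completes (tp (cell _) ∷ t) ()
    copy-completes (tp (st _) ∷ t) ()

    -- The initial phrase holds no copy, so the whole copy `v` read at the end must come from the
    -- guess of `G₂`. This ties the word on the tape of the machine to the copy.
    completes-initial : ∀ u {υ α v} → Completes υ (initialPhrase u) α v →
                        α ≡ opening M ++ map letter (υ ++ u) ++ # ∷ map letter v ++ [ cell ⟧ ]
    completes-initial []      {υ} (G₂ w (tp [])) =
      ≡.trans (cong (λ υ → opening M ++ map letter υ ++ # ∷ map letter w ++ [ cell ⟧ ]) (≡.sym (++-identityʳ υ)))
              (cong (λ v → opening M ++ map letter (υ ++ []) ++ # ∷ map letter v ++ [ cell ⟧ ]) (≡.sym (++-identityʳ w)))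
    completes-initial (x ∷ u) {υ} {v = v} (U κ) = ≡.trans (completes-initial u κ)
      (cong (λ υ → opening M ++ map letter υ ++ # ∷ map letter v ++ [ cell ⟧ ]) (∷ʳ-++ υ x u))

    pair : List Γ → List Γ → List (Maybe Γ)
    pair u v = map just u ++ nothing ∷ map just v

    start-pair : ∀ u v → start-word M (pair u v) ≡ opening M ++ map letter u ++ # ∷ map letter v ++ [ cell ⟧ ]
    start-pair u v = cong (opening M ++_)
      (≡.trans (cong (_++ [ cell ⟧ ]) (≡.trans (map-++ (hat M) (map just u) _)
        (cong₂ (λ u v → u ++ # ∷ v) (≡.sym (map-∘ u)) (≡.sym (map-∘ v)))))
      (++-assoc (map letter u) (# ∷ map letter v) [ cell ⟧ ]))

  guessAndRun-sound : ∀ {u t v} → Star (Rewrite guessAndRun) (initialPhrase u) t → collect copySymbol t ≡ just v →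
                      LBM.Accepts M (map just u ++ nothing ∷ map just v)
  guessAndRun-sound {u} {t} {v} steps copy≡ with copy-completes t copy≡
  ... | α , κ , all† with pulls* steps κ
  ... | α₀ , κ₀ , P-steps = machineRules-sound M
    (subst (λ w → Star (Rewrite P) w α) (≡.trans (completes-initial u κ₀) (≡.sym (start-pair u v))) P-steps) all†

  private
    guesses : List Γ → List Symbol
    guesses v = concatMap (λ y → tp (letter y) ∷ K y ∷ []) v

    guess* : ∀ v t → Star (Rewrite growRules) (G₂ ∷ t) (G₂ ∷ guesses v ++ t)
    guess* []      t = ε
    guess* (y ∷ v) t = guess* v t ◅◅ rule (guesses v ++ t) (guess∈ y)

    eat* : ∀ u t → Star (Rewrite growRules) (map U u ++ G₁ ∷ t) (G₁ ∷ map tp (map letter u) ++ t)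
    eat* []      t = ε
    eat* (x ∷ u) t = under [ U x ] (eat* u t) ◅◅ rule (map tp (map letter u) ++ t) (eat∈ x)

    guessed : List Γ → List Γ → List Symbol
    guessed u v = map tp (opening M) ++ map tp (map letter u) ++ tp # ∷ guesses v ++ [ tp (cell ⟧) ]

    grow* : ∀ u v → Star (Rewrite growRules) (initialPhrase u) (guessed u v)
    grow* u v = under (map U u) (guess* v [ tp (cell ⟧) ] ◅◅ rule _ (here refl)) ◅◅ eat* u _ ◅◅ rule _ (there (here refl))

    commute* : ∀ y z t → Star (Rewrite workRules) (K y ∷ map tp z ++ t) (map tp z ++ K y ∷ t)
    commute* y []      t = ε
    commute* y (x ∷ z) t = rule (map tp z ++ t) (commute∈ y x) ◅◅ under [ tp x ] (commute* y z t)

    sort : ∀ v z → Star (Rewrite workRules) (guesses v ++ map tp z) (map tp (map letter v ++ z) ++ map K v)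
    sort []      z = subst (Star (Rewrite workRules) (map tp z)) (≡.sym (++-identityʳ (map tp z))) ε
    sort (y ∷ v) z = under (tp (letter y) ∷ K y ∷ []) (sort v z) ◅◅ under [ tp (letter y) ] (commute* y (map letter v ++ z) (map K v))

    work* : ∀ {α α′} t → Star (Rewrite P) α α′ → Star (Rewrite workRules) (map tp α ++ t) (map tp α′ ++ t)
    work* t = Star.gmap (λ α → map tp α ++ t) λ { (rewriting {l} {r} u v lr∈) →
      Rewrite-++ʳ t (subst₂ (Rewrite workRules) (map-++₃ u l v) (map-++₃ u r v) (rewriting (map tp u) (map tp v) (work∈ lr∈))) }
      where
      map-++₃ : ∀ u m v → map tp u ++ map tp m ++ map tp v ≡ map tp (u ++ m ++ v)
      map-++₃ u m v = ≡.sym (≡.trans (map-++ tp u (m ++ v)) (cong (map tp u ++_) (map-++ tp m v)))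

    run* : ∀ u v → LBM.Accepts M (pair u v) → Star (Rewrite workRules) (guessed u v) (tp † ∷ map K v)
    run* u v acc =
      subst (Star (Rewrite workRules) (guessed u v)) sorted≡
        (under (map tp (opening M)) (under (map tp (map letter u)) (under [ tp # ] (sort v [ cell ⟧ ]))))
      ◅◅ work* (map K v) (machineRules-complete M acc)
      where
      sorted≡ : map tp (opening M) ++ map tp (map letter u) ++ tp # ∷ map tp (map letter v ++ [ cell ⟧ ]) ++ map K v
                ≡ map tp (start-word M (pair u v)) ++ map K v
      sorted≡ = ≡.sym (≡.trans (cong (λ w → map tp w ++ map K v) (start-pair u v))
        (cong (map tp (opening M) ++_) (≡.trans (cong (_++ map K v) (map-++ tp (map letter u) _))
                                                (++-assoc (map tp (map letter u)) _ (map K v)))))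

    -- The summands are the two letters of `opening`, `#`, the word `u`, the word `v` with its copy,
    -- and the right marker. This is the greatest length in the derivation.
    |guessed| : ∀ u v → length (guessed u v) ≡ 3 + (length u + (length v + length v + 1))
    |guessed| u v = cong (2 +_) (≡.trans (length-++ (map tp (map letter u)))
      (≡.trans (cong₂ _+_ (≡.trans (length-map tp (map letter u)) (length-map letter u))
                          (cong suc (≡.trans (length-++ (guesses v)) (cong (_+ 1) (|guesses| v)))))
               (ℕ.+-suc (length u) _)))
      where
      |guesses| : ∀ v → length (guesses v) ≡ length v + length v
      |guesses| []      = refl
      |guesses| (y ∷ v) = cong suc (≡.trans (cong suc (|guesses| v)) (≡.sym (ℕ.+-suc (length v) (length v))))

  guessAndRun-complete : ∀ {B} u v → 3 + (length u + (length v + length v + 1)) ≤ B →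
    LBM.Accepts M (map just u ++ nothing ∷ map just v) →
    Star (Bounded guessAndRun B) (initialPhrase u) (tp † ∷ map K v)
  guessAndRun-complete {B} u v bound acc =
    Star.map (λ (s , b) → Rewrite-⊆ ∈-++⁺ˡ s , b) (growing-bounded growing |guessed|≤ (grow* u v)) ◅◅
    Star.map (λ (s , b) → Rewrite-⊆ (∈-++⁺ʳ growRules) s , b) (bounded decreasing |guessed|≤ (run* u v acc))
    where
    |guessed|≤ : length (guessed u v) ≤ B
    |guessed|≤ = ℕ.≤-trans (ℕ.≤-reflexive (|guessed| u v)) bound

-- Disjoint unions of rewriting systems

module _ {A : Set} (A-finite : Finite A) {X : A → Set} (S : ∀ a → RewritingSystem (X a)) where

  tag : ∀ a → List (X a) → List (Σ A X)
  tag a w = map (a ,_) w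

  private
    tagRule : ∀ a → List (X a) × List (X a) → List (Σ A X) × List (Σ A X)
    tagRule a (l , r) = tag a l , tag a r

  tagged : RewritingSystem (Σ A X)
  tagged = concat (map (λ a → map (tagRule a) (S a)) (elements A-finite))

  private
    data IsTagged : List (Σ A X) × List (Σ A X) → Set where
      isTagged : ∀ a {l r} → (l , r) ∈ S a → IsTagged (tagRule a (l , r))

    tagged⁻ : ∀ {ρ} → ρ ∈ tagged → IsTagged ρ
    tagged⁻ ρ∈ with ∈-concat⁻′ (map (λ a → map (tagRule a) (S a)) (elements A-finite)) ρ∈
    ... | _ , ρ∈ys , ys∈ with ∈-map⁻ (λ a → map (tagRule a) (S a)) ys∈
    ... | a , _ , refl with ∈-map⁻ (tagRule a) ρ∈ys
    ... | _ , lr∈ , refl = isTagged a lr∈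

    tagged⁺ : ∀ a {l r} → (l , r) ∈ S a → tagRule a (l , r) ∈ tagged
    tagged⁺ a lr∈ = ∈-concat⁺′ (∈-map⁺ (tagRule a) lr∈) (∈-map⁺ (λ a → map (tagRule a) (S a)) (∈-elements A-finite a))

    tag-++₃ : ∀ a u m v → tag a u ++ tag a m ++ tag a v ≡ tag a (u ++ m ++ v)
    tag-++₃ a u m v = ≡.sym (≡.trans (map-++ (a ,_) u (m ++ v)) (cong (tag a u ++_) (map-++ (a ,_) m v)))

  tagged-complete : ∀ {a B w w′} → Star (Bounded (S a) B) w w′ → Star (Bounded tagged B) (tag a w) (tag a w′)
  tagged-complete {a} = Star.gmap (tag a) λ { (rewriting {l} {r} u v lr∈ , |w′|≤) →
    subst₂ (Rewrite tagged) (tag-++₃ a u l v) (tag-++₃ a u r v) (rewriting (tag a u) (tag a v) (tagged⁺ a lr∈)) ,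
    ℕ.≤-trans (ℕ.≤-reflexive (length-map {B = Σ A X} (a ,_) (u ++ r ++ v))) |w′|≤ }

  module _ (lhs : ∀ a {l r} → (l , r) ∈ S a → l ≢ []) where

    private
      -- A nonempty left-hand side shows its tag, so it belongs to the system of the word. An empty
      -- one could insert letters with a foreign tag, which `lhs` forbids.
      sound-step : ∀ {a w t} → Rewrite tagged (tag a w) t → ∃ λ w′ → t ≡ tag a w′ × Rewrite (S a) w w′
      sound-step {a} {w} s = go refl s
        where
        at : ∀ u v {l r} → IsTagged (l , r) → tag a w ≡ u ++ l ++ v → ∃ λ w′ → u ++ r ++ v ≡ tag a w′ × Rewrite (S a) w w′
        at u v (isTagged b {[]} lr∈) eq = ⊥-elim (lhs b lr∈ refl)
        at u v (isTagged b {x ∷ l} {r} lr∈) eq with ∷-split (a ,_) w u eq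
        ... | w₁ , y ∷ w₂ , refl , refl , eq₂ with ∷-injectiveˡ eq₂
        ... | refl with ∷-split (a ,_) w₂ (tag a l) (≡.sym (∷-injectiveʳ eq₂))
        ... | w₃ , w₄ , refl , l≡ , refl with map-injective (λ { refl → refl }) l≡
        ... | refl = w₁ ++ r ++ w₄ , tag-++₃ a w₁ r w₄ , rewriting w₁ w₄ lr∈
        go : ∀ {t′ t} → tag a w ≡ t′ → Rewrite tagged t′ t → ∃ λ w′ → t ≡ tag a w′ × Rewrite (S a) w w′
        go eq (rewriting u v ρ∈) = at u v (tagged⁻ ρ∈) eq

    tagged-sound : ∀ {a w t} → Star (Rewrite tagged) (tag a w) t → ∃ λ w′ → t ≡ tag a w′ × Star (Rewrite (S a)) w w′
    tagged-sound ε = _ , refl , ε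
    tagged-sound (s ◅ ss) with sound-step s
    ... | w₁ , refl , s₁ with tagged-sound ss
    ... | w′ , eq , steps = w′ , eq , s₁ ◅ steps

-- Words as sequences of chunks of length k, of which only the first one may be shorter

module _ {Γ : Set} (k-1 : ℕ) where
  private
    k : ℕ
    k = suc k-1

  Full : List Γ → Set
  Full c = length c ≡ k

  data Canonical : List (List Γ) → Set where
    []  : Canonical []
    _∷_ : ∀ {c cs} → 0 < length c × length c ≤ k → All Full cs → Canonical (c ∷ cs)

  Full⇒Canonical : ∀ {cs} → All Full cs → Canonical cs
  Full⇒Canonical []           = []
  Full⇒Canonical (|c|≡ ∷ all) = (subst (0 <_) (≡.sym |c|≡) (s≤s z≤n) , ℕ.≤-reflexive |c|≡) ∷ all

  private
    push-chunk : Γ → (c : List Γ) → Dec (length c < k) → List (List Γ) → List (List Γ)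
    push-chunk x c (yes _) cs = (x ∷ c) ∷ cs
    push-chunk x c (no _)  cs = [ x ] ∷ c ∷ cs

    push′ : Γ → List (List Γ) → List (List Γ)
    push′ x []       = [ [ x ] ]
    push′ x (c ∷ cs) = push-chunk x c (length c ℕ.<? k) cs

    concat-push : ∀ x cs → concat (push′ x cs) ≡ x ∷ concat cs
    concat-push x []       = refl
    concat-push x (c ∷ cs) with length c ℕ.<? k
    ... | yes _ = refl
    ... | no _  = refl

    canonical-push : ∀ x {cs} → Canonical cs → Canonical (push′ x cs)
    canonical-push x [] = (s≤s z≤n , s≤s z≤n) ∷ []
    canonical-push x (_∷_ {c} (0< , ≤k) full) with length c ℕ.<? k
    ... | yes <k = (s≤s z≤n , <k) ∷ full
    ... | no ≮k  = (s≤s z≤n , s≤s z≤n) ∷ ℕ.≤-antisym ≤k (ℕ.≮⇒≥ ≮k) ∷ full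

  chunks : List Γ → List (List Γ)
  chunks = foldr push′ []

  concat-chunks : ∀ w → concat (chunks w) ≡ w
  concat-chunks []      = refl
  concat-chunks (x ∷ w) = ≡.trans (concat-push x (chunks w)) (cong (x ∷_) (concat-chunks w))

  canonical-chunks : ∀ w → Canonical (chunks w)
  canonical-chunks []      = []
  canonical-chunks (x ∷ w) = canonical-push x (canonical-chunks w)

  -- Counted from the right, the borders are forced, as every chunk but the first is full. Hence a
  -- tape that passes the test for canonicity is the one code of the word it spells.
  chunks-concat : ∀ {cs} → Canonical cs → chunks (concat cs) ≡ cs
  chunks-concat [] = refl
  chunks-concat (_∷_ {c} {cs} bounds full) = go c bounds
    where
    push-full : ∀ x {cs} → All Full cs → push′ x cs ≡ [ x ] ∷ cs
    push-full x [] = refl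
    push-full x (_∷_ {c} |c|≡ _) with length c ℕ.<? k
    ... | yes <k = ⊥-elim (ℕ.<⇒≢ <k |c|≡)
    ... | no _   = refl
    go : ∀ c → 0 < length c × length c ≤ k → chunks (c ++ concat cs) ≡ c ∷ cs
    go (x ∷ [])        _        = ≡.trans (cong (push′ x) (chunks-concat (Full⇒Canonical full))) (push-full x full)
    go (x ∷ c@(y ∷ _)) (_ , <k) rewrite go c (s≤s z≤n , ℕ.<⇒≤ <k) with length c ℕ.<? k
    ... | yes _ = refl
    ... | no ≮k = ⊥-elim (≮k <k)

  private
    length-full : ∀ {cs} → All Full cs → length (concat cs) ≡ k * length cs
    length-full {[]} [] = ≡.sym (ℕ.*-zeroʳ k)
    length-full {c ∷ cs} (|c|≡ ∷ full) =
      ≡.trans (length-++ c) (≡.trans (cong₂ _+_ |c|≡ (length-full full)) (≡.sym (ℕ.*-suc k (length cs))))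

  length≤chunks : ∀ w → length w ≤ k * length (chunks w)
  length≤chunks w = subst (λ w′ → length w′ ≤ k * length (chunks w)) (concat-chunks w) (go (canonical-chunks w))
    where
    go : ∀ {cs} → Canonical cs → length (concat cs) ≤ k * length cs
    go [] = z≤n
    go (_∷_ {c} {cs} (_ , ≤k) full) = ℕ.≤-trans (ℕ.≤-reflexive (length-++ c))
      (ℕ.≤-trans (ℕ.+-mono-≤ ≤k (ℕ.≤-reflexive (length-full full))) (ℕ.≤-reflexive (≡.sym (ℕ.*-suc k (length cs)))))

  -- The first of `n` chunks is nonempty and the others are full, so `k (n - 1)` is less than the
  -- length of `w`, whence `n - 1 < N`. Applied with one chunk more than `u` has, this makes room
  -- for `k` further letters.
  chunks≤length : ∀ w N → length w ≤ k * N → length (chunks w) ≤ N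
  chunks≤length w N |w|≤ = go (canonical-chunks w) (ℕ.≤-trans (ℕ.≤-reflexive (cong length (concat-chunks w))) |w|≤)
    where
    go : ∀ {cs} → Canonical cs → length (concat cs) ≤ k * N → length cs ≤ N
    go [] _ = z≤n
    go (_∷_ {c} {cs} (0< , _) full) ≤kN = ℕ.*-cancelˡ-< k (length cs) N
      (ℕ.≤-trans (ℕ.≤-trans (ℕ.+-mono-≤ 0< (ℕ.≤-reflexive (≡.sym (length-full full)))) (ℕ.≤-reflexive (≡.sym (length-++ c)))) ≤kN)

  -- The second flag tells whether all chunks so far are full; empty chunks
  -- are skipped.
  Extends : Bool → ℕ → Bool → Set
  Extends true  n true  = n ≡ 0 ⊎ n ≡ k
  Extends true  n false = 0 < n
  Extends false n true  = ⊥
  Extends false n false = n ≡ 0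

  extends? : ∀ s n s′ → Dec (Extends s n s′)
  extends? true  n true  = (n ℕ.≟ 0) ⊎-dec (n ℕ.≟ k)
  extends? true  n false = 0 ℕ.<? n
  extends? false n true  = no λ ()
  extends? false n false = n ℕ.≟ 0

  data Extending : List (List Γ) → Bool → Set where
    []  : Extending [] true
    _∷_ : ∀ {c cs s s′} → Extends s (length c) s′ → Extending cs s → Extending (c ∷ cs) s′

  canonical-extending : ∀ {cs} j → Canonical cs → ∃ (Extending (replicate j [] ++ cs))
  canonical-extending j canonical = blanks′ j (go canonical)
    where
    fulls : ∀ {cs} → All Full cs → Extending cs true
    fulls []           = []
    fulls (|c|≡ ∷ all) = inj₂ |c|≡ ∷ fulls all
    go : ∀ {cs} → Canonical cs → ∃ (Extending cs)
    go []                    = true , []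
    go ((0< , _) ∷ full) = false , 0< ∷ fulls full
    blanks′ : ∀ {cs} j → ∃ (Extending cs) → ∃ (Extending (replicate j [] ++ cs))
    blanks′ zero    e = e
    blanks′ (suc j) e with blanks′ j e
    ... | true , e′  = true , inj₁ refl ∷ e′
    ... | false , e′ = false , refl ∷ e′

  nonempty : List (List Γ) → List (List Γ)
  nonempty []             = []
  nonempty ([] ∷ cs)      = nonempty cs
  nonempty ((x ∷ c) ∷ cs) = (x ∷ c) ∷ nonempty cs

  concat-nonempty : ∀ cs → concat (nonempty cs) ≡ concat cs
  concat-nonempty []             = refl
  concat-nonempty ([] ∷ cs)      = concat-nonempty cs
  concat-nonempty ((x ∷ c) ∷ cs) = cong (λ w → x ∷ c ++ w) (concat-nonempty cs)

  nonempty-canonical : ∀ {cs} j → Canonical cs → nonempty (replicate j [] ++ cs) ≡ cs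
  nonempty-canonical (suc j) canonical = nonempty-canonical j canonical
  nonempty-canonical zero    []        = refl
  nonempty-canonical zero    (_∷_ {x ∷ c} _ full) = cong ((x ∷ c) ∷_) (nonempty-canonical zero (Full⇒Canonical full))

  extending-canonical : ∀ {cs s} → All (λ c → length c ≤ k) cs → Extending cs s → Canonical (nonempty cs)
  extending-canonical {cs} {s} small e = toCanonical s (go small e)
    where
    Shape : Bool → List (List Γ) → Set
    Shape true  cs = All Full cs
    Shape false cs = Canonical cs
    toCanonical : ∀ s {cs} → Shape s cs → Canonical cs
    toCanonical true  = Full⇒Canonical
    toCanonical false = id
    go : ∀ {cs s} → All (λ c → length c ≤ k) cs → Extending cs s → Shape s (nonempty cs)
    go [] [] = []
    go {[] ∷ cs} (_ ∷ small) (_∷_ {s = true} {true} _ e)   = go small e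
    go {[] ∷ cs} (_ ∷ small) (_∷_ {s = true} {false} () e)
    go {[] ∷ cs} (_ ∷ small) (_∷_ {s = false} {false} _ e) = go small e
    go {(x ∷ c) ∷ cs} (_ ∷ small) (_∷_ {s = true} {true} (inj₂ |c|≡) e) = |c|≡ ∷ go small e
    go {(x ∷ c) ∷ cs} (≤k ∷ small) (_∷_ {s = true} {false} 0< e) = (0< , ≤k) ∷ go small e
    go {(x ∷ c) ∷ cs} (_ ∷ small) (_∷_ {s = false} {false} () e)

-- From transductions to labeled machines

module _ {X : Set} where

  fill : ∀ n → List X → Vec (Maybe X) n
  fill zero    _       = []
  fill (suc n) []      = nothing ∷ fill n []
  fill (suc n) (x ∷ w) = just x ∷ fill n w

  fill-content : ∀ n w → length w ≤ n → catMaybes (toList (fill n w)) ≡ w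
  fill-content zero    []      _         = refl
  fill-content (suc n) []      _         = fill-content n [] z≤n
  fill-content (suc n) (x ∷ w) (s≤s |w|≤) = cong (x ∷_) (fill-content n w |w|≤)

pair-injective : ∀ {X : Set} (u u′ : List X) {v v′} →
                 map just u ++ nothing ∷ map just v ≡ map just u′ ++ nothing ∷ map just v′ → u ≡ u′ × v ≡ v′
pair-injective []      []       eq = refl , map-injective Maybe.just-injective (∷-injectiveʳ eq)
pair-injective []      (_ ∷ _)  ()
pair-injective (_ ∷ _) []       ()
pair-injective (x ∷ u) (y ∷ u′) eq =
  Product.map (cong₂ _∷_ (Maybe.just-injective (∷-injectiveˡ eq))) id (pair-injective u u′ (∷-injectiveʳ eq))

module _ {A Γ : Set} (A-finite : Finite A) (Γ-finite : Finite Γ) (T : A → Transduction Γ) (k-1 : ℕ)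
         (incremental : ∀ a → IncrementalBy (T a) (suc k-1)) (M : A → LBM (Maybe Γ))
         (accepts : ∀ a w → graphLanguage (T a) w ⇔ LBM.Accepts (M a) w) where
  private
    -- When `v` has been guessed and copied, `4 + |u| + 2 |v|` symbols are present. With `N` cells,
    -- the new one included, `|u|` and `|v|` are at most `k N`; blocks of `4 + 3 k` symbols
    -- therefore suffice.
    k width : ℕ
    k     = suc k-1
    width = 4 + 3 * k

    Sym : Set
    Sym = Σ A (λ a → Symbol Γ-finite (M a))

    Sym-finite : Finite Sym
    Sym-finite = Finite-Σ A-finite (λ a → Symbol-finite Γ-finite (M a))

    system : ∀ a → RewritingSystem (Symbol Γ-finite (M a))
    system a = guessAndRun Γ-finite (M a)

    S : RewritingSystem Sym
    S = tagged A-finite system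

    tags : ∀ a → List (Symbol Γ-finite (M a)) → List Sym
    tags a w = map (a ,_) w

    Chunk Block Δ : Set
    Chunk = BoundedList Γ k
    Block = Vec (Maybe Sym) width
    Δ     = Chunk ⊎ Block

    Chunk-finite : Finite Chunk
    Chunk-finite = Finite-BoundedList Γ-finite k

    Block-finite : Finite Block
    Block-finite = Finite-Vec (Finite-Maybe Sym-finite) width

    Δ-finite : Finite Δ
    Δ-finite = Finite-⊎ Chunk-finite Block-finite

    none : Chunk
    none = truncate k []

    startBlock : A → Block
    startBlock a = fill width (tags a (initialPhrase Γ-finite (M a) []))

    readBlock : A → List Γ → Block
    readBlock a w = fill width (tags a (map U w))

    -- `nothing` expects the blank just inserted at the right end. `just s` reads the chunks of the
    -- old vertex, with `s` the flag of `Extends`; as empty chunks are refused, only codes of words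
    -- get through. The letter stays in the state to tag every block.
    PreState : Set
    PreState = A × Maybe Bool

    preTrans : PreState → Chunk → Block → PreState → Set
    preTrans (a , nothing) x B (a′ , just true)  = a ≡ a′ × x ≡ none × B ≡ startBlock a
    preTrans (a , just s)  x B (a′ , just s′)    =
      a ≡ a′ × Extends {Γ} k-1 s (length (word x)) s′ × 0 < length (word x) × B ≡ readBlock a (word x)
    preTrans (_ , nothing) _ _ (_ , just false)  = ⊥
    preTrans _             _ _ (_ , nothing)     = ⊥

    preTrans? : ∀ d x B d′ → Dec (preTrans d x B d′)
    preTrans? (a , nothing) x B (a′ , just true)  =
      finite-≟ A-finite a a′ ×-dec finite-≟ Chunk-finite x none ×-dec finite-≟ Block-finite B (startBlock a)
    preTrans? (a , just s)  x B (a′ , just s′)    =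
      finite-≟ A-finite a a′ ×-dec extends? {Γ} k-1 s (length (word x)) s′ ×-dec (0 ℕ.<? length (word x))
      ×-dec finite-≟ Block-finite B (readBlock a (word x))
    preTrans? (_ , nothing) _ _ (_ , just false)  = no λ ()
    preTrans? (_ , nothing) _ _ (_ , nothing)     = no λ ()
    preTrans? (_ , just _)  _ _ (_ , nothing)     = no λ ()

    Started : PreState → Set
    Started (_ , s) = s ≢ nothing

    started? : ∀ d → Dec (Started d)
    started? (_ , nothing) = no λ s → s refl
    started? (_ , just _)  = yes λ ()

    pre : Transducer Chunk Block
    pre = record
      { State = PreState ; finite = Finite-× A-finite (Finite-Maybe Finite-Bool)
      ; trans = preTrans ; trans? = preTrans? ; accepting = Started ; accepting? = started? }

    copies : Sym → Maybe (List Γ)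
    copies (a , z) = copySymbol Γ-finite (M a) z

    -- A block is readable only if it contains nothing but copied letters and `†`, so reading the
    -- result also tests acceptance. `Extends` admits only canonical distributions of the copy over
    -- the cells.
    postTrans : Bool → Block → Chunk → Bool → Set
    postTrans s B x s′ = collect copies (catMaybes (toList B)) ≡ just (word x) × Extends {Γ} k-1 s (length (word x)) s′

    postTrans? : ∀ s B x s′ → Dec (postTrans s B x s′)
    postTrans? s B x s′ = Maybe.≡-dec (≡-dec (finite-≟ Γ-finite)) _ _ ×-dec extends? {Γ} k-1 s (length (word x)) s′

    post : Transducer Block Chunk
    post = record
      { State = Bool ; finite = Finite-Bool
      ; trans = postTrans ; trans? = postTrans? ; accepting = λ _ → ⊤ ; accepting? = λ _ → yes tt }

    machine : SweepMachine Δ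
    machine = boundedMachine Sym-finite S pre post true

    entry : A → SweepMachine.D machine
    entry a = inj₁ (a , nothing)

    input : A ↣ Δ
    input = mk↣ {to = λ a → inj₂ (startBlock a)} (λ eq → injective (Sum.inj₂-injective eq))
      where
      injective : ∀ {a b} → startBlock a ≡ startBlock b → a ≡ b
      injective eq = cong proj₁ (Maybe.just-injective (Vec.∷-injectiveˡ eq))

    blank : Δ
    blank = inj₁ none

    open SweepLLBM machine Δ-finite A-finite input blank entry

    Config : Set
    Config = StateWord Control⁺ Δ

    coded : List (List Γ) → List Δ
    coded cs = map inj₁ (map (truncate k) cs)

    vertex : List Γ → Config
    vertex u = idleAt (coded (chunks k-1 u))

    Small : List (List Γ) → Set
    Small cs = All (λ c → length c ≤ k) cs

    canonical-small : ∀ {cs} → Canonical k-1 cs → Small cs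
    canonical-small []              = []
    canonical-small ((_ , ≤k) ∷ full) = ≤k ∷ All.map ℕ.≤-reflexive full

    words : List Chunk → List (List Γ)
    words xs = map word xs

    words-truncate : ∀ {cs} → Small cs → words (map (truncate k) cs) ≡ cs
    words-truncate []               = refl
    words-truncate {c ∷ _} (≤k ∷ small) = cong₂ _∷_ (word-truncate k c ≤k) (words-truncate small)

    truncate-words : ∀ xs → map (truncate k) (words xs) ≡ xs
    truncate-words []       = refl
    truncate-words (x ∷ xs) = cong₂ _∷_ (truncate-word x) (truncate-words xs)

    words-small : ∀ xs → Small (words xs)
    words-small []       = []
    words-small (x ∷ xs) = length-word x ∷ words-small xs

    coded-injective : ∀ {cs cs′} → Small cs → Small cs′ → coded cs ≡ coded cs′ → cs ≡ cs′
    coded-injective small small′ eq =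
      ≡.trans (≡.sym (words-truncate small)) (≡.trans (cong words (map-injective Sum.inj₁-injective eq)) (words-truncate small′))

    vertex-injective : ∀ {u v} → vertex u ≡ vertex v → u ≡ v
    vertex-injective {u} {v} eq = ≡.trans (≡.sym (concat-chunks k-1 u))
      (≡.trans (cong concat (coded-injective (canonical-small (canonical-chunks k-1 u)) (canonical-small (canonical-chunks k-1 v))
                 (idleAt-injective eq)))
               (concat-chunks k-1 v))

    erased-words : ∀ xs → erase (map inj₁ xs) ≡ coded (nonempty k-1 (words xs))
    erased-words []       = refl
    erased-words (x ∷ xs) with word x in word≡
    ... | [] = ≡.trans (cong (λ x → erase (inj₁ x ∷ map inj₁ xs)) x≡none)
                       (≡.trans (erase-blank (map inj₁ xs)) (erased-words xs))
      where
      x≡none : x ≡ none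
      x≡none = word-injective (≡.trans word≡ (≡.sym (word-truncate k [] z≤n)))
    ... | y ∷ c = ≡.trans (erase-keep (map inj₁ xs) x≢blank)
                          (cong₂ _∷_ (cong inj₁ (≡.trans (≡.sym (truncate-word x)) (cong (truncate k) word≡))) (erased-words xs))
      where
      x≢blank : inj₁ x ≢ blank
      x≢blank eq with () ← ≡.trans (≡.sym word≡) (≡.trans (cong word (Sum.inj₁-injective eq)) (word-truncate k [] z≤n))

    phrase : A → List Γ → List Sym
    phrase a u = tags a (initialPhrase Γ-finite (M a) u)

    phrase-++ : ∀ a u v → phrase a (u ++ v) ≡ tags a (map U u) ++ phrase a v
    phrase-++ a u v = ≡.trans (cong (tags a) (≡.trans (cong (_++ _) (map-++ U u v)) (++-assoc (map U u) (map U v) _)))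
                              (map-++ (a ,_) (map U u) _)

    readBlock-content : ∀ a c → length c ≤ k → catMaybes (toList (readBlock a c)) ≡ tags a (map U c)
    readBlock-content a c ≤k = fill-content width _ (ℕ.≤-trans (ℕ.≤-reflexive
      (≡.trans (length-map (a ,_) (map U c)) (length-map U c))) (ℕ.≤-trans ≤k (ℕ.≤-trans (ℕ.m≤m+n k (2 * k)) (ℕ.m≤n+m (3 * k) 4))))

    startBlock-content : ∀ a → catMaybes (toList (startBlock a)) ≡ phrase a []
    startBlock-content a = fill-content width _ (s≤s (s≤s z≤n))

    content-∷ : ∀ (B : Block) W → content (B ∷ W) ≡ catMaybes (toList B) ++ content W
    content-∷ B W = catMaybes-++ (toList B) (flat W)

    blocksOf : A → List (List Γ) → List Block
    blocksOf a []       = [ startBlock a ]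
    blocksOf a (c ∷ cs) = readBlock a c ∷ blocksOf a cs

    blocksOf-content : ∀ a {cs} → Small cs → content (blocksOf a cs) ≡ phrase a (concat cs)
    blocksOf-content a [] = ≡.trans (content-∷ (startBlock a) []) (≡.trans (++-identityʳ _) (startBlock-content a))
    blocksOf-content a {c ∷ cs} (≤k ∷ small) = ≡.trans (content-∷ (readBlock a c) (blocksOf a cs))
      (≡.trans (cong₂ _++_ (readBlock-content a c ≤k) (blocksOf-content a small)) (≡.sym (phrase-++ a c (concat cs))))

    length-blocksOf : ∀ a cs → length (blocksOf a cs) ≡ suc (length cs)
    length-blocksOf a []       = refl
    length-blocksOf a (c ∷ cs) = cong suc (length-blocksOf a cs)

    Nonempty : List (List Γ) → Set
    Nonempty cs = All (λ c → 0 < length c) cs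

    pre-sound : ∀ {a} xs {W d} → Run preTrans (a , nothing) (xs ++ [ none ]) W d → Started d →
                ∃ λ s → d ≡ (a , just s) × Extending k-1 (words xs) s × Nonempty (words xs) × W ≡ blocksOf a (words xs)
    pre-sound [] {d = a′ , just true} (_∷_ {d′ = _} {x = _} (refl , _ , refl) []) _ = true , refl , [] , [] , refl
    pre-sound [] {d = a′ , nothing} (() ∷ []) _
    pre-sound [] {d = a′ , just false} (() ∷ []) _
    pre-sound (x ∷ xs) {d = d} (_∷_ {d′ = a , nothing} t ρ) started = ⊥-elim (stuck xs ρ)
      where
      stuck : ∀ {a b} xs {W} → ¬ Run preTrans (a , nothing) (xs ++ [ none ]) W (b , nothing)
      stuck [] (_∷_ {d′ = _ , nothing} () ρ)
      stuck [] (_∷_ {d′ = _ , just _} () ρ)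
      stuck (x ∷ xs) (_∷_ {d′ = _ , nothing} () ρ)
      stuck (x ∷ xs) (_∷_ {d′ = _ , just _} () ρ)
    pre-sound (x ∷ xs) {d = a″ , nothing} (_∷_ {d′ = a , just s} t ρ) started = ⊥-elim (started refl)
    pre-sound (x ∷ xs) {d = a″ , just s′} (_∷_ {d′ = a , just s} (refl , ext , 0< , refl) ρ) started with pre-sound xs ρ (λ ())
    ... | s₁ , refl , extending , 0<s , refl = s′ , refl , ext ∷ extending , 0< ∷ 0<s , refl

    nonempty-id : ∀ {cs} → Nonempty cs → nonempty k-1 cs ≡ cs
    nonempty-id []                      = refl
    nonempty-id {(x ∷ c) ∷ cs} (_ ∷ ne) = cong ((x ∷ c) ∷_) (nonempty-id ne)

    canonical-nonempty : ∀ {cs} → Canonical k-1 cs → Nonempty cs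
    canonical-nonempty [] = []
    canonical-nonempty ((0< , _) ∷ full) = 0< ∷ All.map (λ eq → subst (0 <_) (≡.sym eq) (s≤s z≤n)) full

    pre-complete : ∀ a {cs s} → Small cs → Nonempty cs → Extending k-1 cs s →
                   Run preTrans (a , nothing) (map (truncate k) cs ++ [ none ]) (blocksOf a cs) (a , just s)
    pre-complete a [] [] [] = (refl , refl , refl) ∷ []
    pre-complete a {c ∷ cs} (≤k ∷ small) (0< ∷ ne) (_∷_ {s = s} {s′} ext e) =
      (refl , subst (λ c → Extends {Γ} k-1 s (length c) s′) (≡.sym word≡) ext ,
       subst (λ c → 0 < length c) (≡.sym word≡) 0< , cong (readBlock a) (≡.sym word≡))
      ∷ pre-complete a small ne e
      where
      word≡ : word (truncate k c) ≡ c
      word≡ = word-truncate k c ≤k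

    post-sound : ∀ {W xs s} → Run postTrans true W xs s →
                 Extending k-1 (words xs) s × collect copies (content W) ≡ just (concat (words xs))
    post-sound [] = [] , refl
    post-sound (_∷_ {x = B} {u = W} (reads , ext) ρ) with post-sound ρ
    ... | extending , read = ext ∷ extending ,
      ≡.trans (cong (collect copies) (content-∷ B W)) (collect-++ copies (catMaybes (toList B)) reads read)

    collect-tags : ∀ a t → collect copies (tags a t) ≡ collect (copySymbol Γ-finite (M a)) t
    collect-tags a []      = refl
    collect-tags a (z ∷ t) = cong (Maybe.zipWith _++_ (copySymbol Γ-finite (M a) z)) (collect-tags a t)

    collect-K : ∀ a c → collect copies (tags a (map K c)) ≡ just c
    collect-K a []      = refl
    collect-K a (y ∷ c) = cong (Maybe.zipWith _++_ (just [ y ])) (collect-K a c)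

    copyBlock : A → List Γ → Block
    copyBlock a c = fill width (tags a (map K c))

    markedBlock : A → List Γ → Block
    markedBlock a c = fill width (tags a (tp † ∷ map K c))

    length-K : ∀ a c → length (tags a (map K c)) ≡ length c
    length-K a c = ≡.trans (length-map (a ,_) (map K c)) (length-map K c)

    small-fits : ∀ (c : List Γ) → length c ≤ k → suc (length c) ≤ width
    small-fits c ≤k = s≤s (ℕ.≤-trans ≤k (ℕ.≤-trans (ℕ.m≤m+n k (2 * k)) (ℕ.m≤n+m (3 * k) 3)))

    copyBlock-content : ∀ a c → length c ≤ k → catMaybes (toList (copyBlock a c)) ≡ tags a (map K c)
    copyBlock-content a c ≤k = fill-content width _ (ℕ.≤-trans (ℕ.≤-reflexive (length-K a c)) (ℕ.<⇒≤ (small-fits c ≤k)))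

    markedBlock-content : ∀ a c → length c ≤ k → catMaybes (toList (markedBlock a c)) ≡ tags a (tp † ∷ map K c)
    markedBlock-content a c ≤k = fill-content width _ (ℕ.≤-trans (ℕ.≤-reflexive (cong suc (length-K a c))) (small-fits c ≤k))

    -- The remaining `†` shares the block of the first chunk instead of taking one for itself. In
    -- the application there is a first chunk, possibly empty, because the tape has at least the
    -- inserted cell.
    final : A → List (List Γ) → List Block
    final a []       = []
    final a (c ∷ cs) = markedBlock a c ∷ map (copyBlock a) cs

    copies-content : ∀ a {cs} → Small cs → content (map (copyBlock a) cs) ≡ tags a (map K (concat cs))
    copies-content a [] = refl
    copies-content a {c ∷ cs} (≤k ∷ small) = ≡.trans (content-∷ (copyBlock a c) (map (copyBlock a) cs))
      (≡.trans (cong₂ _++_ (copyBlock-content a c ≤k) (copies-content a small))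
      (≡.sym (≡.trans (cong (tags a) (map-++ K c (concat cs))) (map-++ (a ,_) (map K c) _))))

    final-content : ∀ a {cs} → 0 < length cs → Small cs → content (final a cs) ≡ tags a (tp † ∷ map K (concat cs))
    final-content a {c ∷ cs} _ (≤k ∷ small) = ≡.trans (content-∷ (markedBlock a c) (map (copyBlock a) cs))
      (≡.trans (cong₂ _++_ (markedBlock-content a c ≤k) (copies-content a small))
      (cong ((a , tp †) ∷_) (≡.sym (≡.trans (cong (tags a) (map-++ K c (concat cs))) (map-++ (a ,_) (map K c) _)))))

    length-final : ∀ a cs → length (final a cs) ≡ length cs
    length-final a []       = refl
    length-final a (c ∷ cs) = cong suc (length-map (copyBlock a) cs)

    reads-as : ∀ {B : Block} {c s s′} → length c ≤ k → collect copies (catMaybes (toList B)) ≡ just c →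
               Extends {Γ} k-1 s (length c) s′ → postTrans s B (truncate k c) s′
    reads-as {c = c} {s} {s′} ≤k eq ext = ≡.trans eq (cong just (≡.sym word≡)) ,
                                  subst (λ c → Extends {Γ} k-1 s (length c) s′) (≡.sym word≡) ext
      where
      word≡ : word (truncate k c) ≡ c
      word≡ = word-truncate k c ≤k

    copies-run : ∀ a {cs s} → Small cs → Extending k-1 cs s →
                 Run postTrans true (map (copyBlock a) cs) (map (truncate k) cs) s
    copies-run a [] [] = []
    copies-run a {c ∷ cs} (≤k ∷ small) (ext ∷ e) =
      reads-as {copyBlock a c} ≤k (≡.trans (cong (collect copies) (copyBlock-content a c ≤k)) (collect-K a c)) ext ∷ copies-run a small e

    final-run : ∀ a {cs s} → Small cs → Extending k-1 cs s →
                Run postTrans true (final a cs) (map (truncate k) cs) s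
    final-run a [] [] = []
    final-run a {c ∷ cs} (≤k ∷ small) (ext ∷ e) =
      reads-as {markedBlock a c} ≤k (≡.trans (cong (collect copies) (markedBlock-content a c ≤k))
        (cong (Maybe.zipWith _++_ (just [])) (collect-K a c))) ext
      ∷ copies-run a small e

    open SweepMachine machine using (Computes)

    room : ∀ (u v : List Γ) → length v ≤ length u + k → 3 + (length u + (length v + length v + 1)) ≤ suc (length (chunks k-1 u)) * width
    room u v |v|≤ = begin
        3 + (n + (m + m + 1))       ≡⟨ cong (3 +_) (≡.trans (≡.sym (ℕ.+-assoc n (m + m) 1)) (ℕ.+-comm (n + (m + m)) 1)) ⟩
        4 + (n + (m + m))           ≤⟨ ℕ.+-monoʳ-≤ 4 (ℕ.+-mono-≤ n≤ (ℕ.+-mono-≤ m≤ m≤)) ⟩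
        4 + (k * N + (k * N + k * N)) ≡⟨ cong (λ z → 4 + (k * N + (k * N + z))) (≡.sym (ℕ.+-identityʳ (k * N))) ⟩
        4 + 3 * (k * N)             ≡⟨ cong (4 +_) (≡.sym (ℕ.*-assoc 3 k N)) ⟩
        4 + 3 * k * N               ≤⟨ ℕ.+-monoˡ-≤ (3 * k * N) (ℕ.m≤m*n 4 N) ⟩
        4 * N + 3 * k * N           ≡⟨ ≡.sym (ℕ.*-distribʳ-+ N 4 (3 * k)) ⟩
        width * N                   ≡⟨ ℕ.*-comm width N ⟩
        N * width                   ∎
      where
      open ℕ.≤-Reasoning
      n m N : ℕ
      n = length u
      m = length v
      N = suc (length (chunks k-1 u))
      n+k≤ : n + k ≤ k * N
      n+k≤ = ℕ.≤-trans (ℕ.+-monoˡ-≤ k (length≤chunks k-1 u))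
             (ℕ.≤-reflexive (≡.trans (ℕ.+-comm _ k) (≡.sym (ℕ.*-suc k (length (chunks k-1 u))))))
      n≤ : n ≤ k * N
      n≤ = ℕ.≤-trans (ℕ.m≤m+n n k) n+k≤
      m≤ : m ≤ k * N
      m≤ = ℕ.≤-trans |v|≤ n+k≤

    module _ {a : A} {u v : List Γ} (Tuv : T a (u , v)) where
      cs ds : List (List Γ)
      cs = chunks k-1 u
      ds = chunks k-1 v

      -- The subtraction is exact: `v` has at most as many chunks as the tape now has cells. The
      -- surplus cells receive empty chunks, which are erased as blanks.
      extra : ℕ
      extra = suc (length cs) ∸ length ds

      padded : List (List Γ)
      padded = replicate extra [] ++ ds

      |v|≤ : length v ≤ k * suc (length cs)
      |v|≤ = ℕ.≤-trans (incremental a Tuv) (ℕ.≤-trans (ℕ.+-monoˡ-≤ k (length≤chunks k-1 u))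
             (ℕ.≤-reflexive (≡.trans (ℕ.+-comm _ k) (≡.sym (ℕ.*-suc k (length cs))))))

      |padded| : length padded ≡ suc (length cs)
      |padded| = ≡.trans (length-++ (replicate extra [])) (≡.trans (cong (_+ length ds) (length-replicate extra))
                 (ℕ.m∸n+n≡m (chunks≤length k-1 v (suc (length cs)) |v|≤)))

      cs-canonical : Canonical k-1 cs
      cs-canonical = canonical-chunks k-1 u

      ds-canonical : Canonical k-1 ds
      ds-canonical = canonical-chunks k-1 v

      cs-small : Small cs
      cs-small = canonical-small cs-canonical

      padded-small : Small padded
      padded-small = All.++⁺ (All.replicate⁺ extra z≤n) (canonical-small ds-canonical)

      concat-padded : concat padded ≡ v
      concat-padded = ≡.trans (skip extra) (concat-chunks k-1 v)
        where
        skip : ∀ j → concat (replicate j [] ++ ds) ≡ concat ds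
        skip zero    = refl
        skip (suc j) = skip j

      steps : Star (Bounded S (length (blocksOf a cs) * width)) (content (blocksOf a cs)) (content (final a padded))
      steps = subst₂ (Star (Bounded S (length (blocksOf a cs) * width)))
        (≡.sym (≡.trans (blocksOf-content a cs-small) (cong (phrase a) (concat-chunks k-1 u))))
        (≡.sym (≡.trans (final-content a (subst (0 <_) (≡.sym |padded|) (s≤s z≤n)) padded-small)
                        (cong (λ v → tags a (tp † ∷ map K v)) concat-padded)))
        (tagged-complete A-finite system (guessAndRun-complete Γ-finite (M a) u v
          (subst (λ N → 3 + (length u + (length v + length v + 1)) ≤ N * width)
                 (≡.sym (length-blocksOf a cs)) (room u v (incremental a Tuv)))
          (Equivalence.to (accepts a _) (u , v , Tuv , refl))))

      computes⁺ : Computes (entry a) (map inj₁ (map (truncate k) cs ++ [ none ])) (map inj₁ (map (truncate k) padded))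
      computes⁺ = boundedMachine-complete Sym-finite S pre post true (blocksOf a cs) (final a padded)
        (_ , pre-complete a cs-small (canonical-nonempty cs-canonical) (proj₂ (canonical-extending k-1 0 cs-canonical)) , λ ())
        (≡.trans (length-blocksOf a cs) (≡.trans (≡.sym |padded|) (≡.sym (length-final a padded))))
        steps
        (_ , final-run a padded-small (proj₂ (canonical-extending k-1 extra ds-canonical)) , tt)

      erased-padded : erase (map inj₁ (map (truncate k) padded)) ≡ coded ds
      erased-padded = ≡.trans (erased-words (map (truncate k) padded))
        (cong coded (≡.trans (cong (nonempty k-1) (words-truncate padded-small)) (nonempty-canonical k-1 extra ds-canonical)))

      vertex-edge : transitionGraph sweepLLBM sweepLLBM-normalized (vertex u , a , vertex v)
      vertex-edge = subst (λ w → transitionGraph sweepLLBM sweepLLBM-normalized (vertex u , a , idleAt w)) erased-padded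
        (sweepLLBM-complete
          (subst (λ w → Computes (entry a) w (map inj₁ (map (truncate k) padded)))
                 (map-++ inj₁ (map (truncate k) cs) [ none ]) computes⁺))

    Edge : Config → A → Config → Set
    Edge s a t = ∃₂ λ u v → s ≡ vertex u × t ≡ vertex v × T a (u , v)

    canonical-words : ∀ xs {s} → Extending k-1 (words xs) s → Canonical k-1 (nonempty k-1 (words xs))
    canonical-words xs e = extending-canonical k-1 (words-small xs) e

    vertex-concat : ∀ {cs} → Canonical k-1 cs → idleAt (coded cs) ≡ vertex (concat cs)
    vertex-concat canonical = cong (λ cs → idleAt (coded cs)) (≡.sym (chunks-concat k-1 canonical))

    -- All symbols keep the tag `a`, so the derivation belongs to the acceptor of `T a`; the single
    -- `#` of the accepted word then identifies `u` and `v`.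
    accepted-pair : ∀ {a u v t} → Star (Rewrite S) (phrase a u) t → collect copies t ≡ just v → T a (u , v)
    accepted-pair {a} {u} {v} steps reads with tagged-sound A-finite system (λ a → guessAndRun-lhs Γ-finite (M a)) steps
    ... | t , refl , steps′ with Equivalence.from (accepts a _)
                                   (guessAndRun-sound Γ-finite (M a) steps′ (≡.trans (≡.sym (collect-tags a t)) reads))
    ... | u′ , v′ , Tuv , eq with pair-injective u u′ eq
    ... | refl , refl = Tuv

    -- The two ends are codes for different reasons: at the source `pre` has checked the chunks and
    -- refused empty ones; at the target `post` has checked them and the erasure removes the empty
    -- ones.
    edge : ∀ {a} xs ys {W W′ : List Block} → Transducer.Transduces pre (a , nothing) (xs ++ [ none ]) W →
           Star (Rewrite S) (content W) (content W′) → Transducer.Transduces post true W′ ys →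
           Edge (idleAt (map inj₁ xs)) a (idleAt (erase (map inj₁ ys)))
    edge {a} xs ys {W} {W′} (d , ρ , started) steps (s , σ , _) =
      go (pre-sound xs ρ started) (post-sound σ)
      where
      go : (∃ λ s → d ≡ (a , just s) × Extending k-1 (words xs) s × Nonempty (words xs) × W ≡ blocksOf a (words xs)) →
           Extending k-1 (words ys) s × collect copies (content W′) ≡ just (concat (words ys)) →
           Edge (idleAt (map inj₁ xs)) a (idleAt (erase (map inj₁ ys)))
      go (_ , _ , extending , ne , refl) (extending′ , reads) =
        concat (words xs) , concat (nonempty k-1 (words ys)) ,
        ≡.trans (cong (λ xs → idleAt (map inj₁ xs)) (≡.sym (truncate-words xs)))
                (vertex-concat (subst (Canonical k-1) (nonempty-id ne) (canonical-words xs extending))) ,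
        ≡.trans (cong idleAt (erased-words ys)) (vertex-concat (canonical-words ys extending′)) ,
        accepted-pair (subst (λ w → Star (Rewrite S) w (content W′)) (blocksOf-content a (words-small xs)) steps)
                      (≡.trans reads (cong just (≡.sym (concat-nonempty k-1 (words ys)))))

    edge-computes : ∀ {a w w′} → Computes (entry a) (w ∷ʳ blank) w′ → Edge (idleAt w) a (idleAt (erase w′))
    edge-computes {a} {w} {w′} r = go (boundedMachine-sound Sym-finite S pre post true r)
      where
      go : (∃₂ λ us ys → ∃₂ λ W W′ → w ∷ʳ blank ≡ map inj₁ us × w′ ≡ map inj₁ ys ×
             Transducer.Transduces pre (a , nothing) us W × Star (Rewrite S) (content W) (content W′) ×
             Transducer.Transduces post true W′ ys) → Edge (idleAt w) a (idleAt (erase w′))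
      go (us , ys , W , W′ , eq , refl , pre-ok , steps , post-ok) with ∷-split inj₁ us w (≡.sym eq)
      ... | xs , none′ ∷ [] , refl , refl , refl = edge xs ys {W} {W′} pre-ok steps post-ok

    edge-sound : ∀ {s a t} → transitionGraph sweepLLBM sweepLLBM-normalized (s , a , t) → Edge s a t
    edge-sound e = go (sweepLLBM-sound e)
      where
      go : ∀ {s a t} → (∃₂ λ w w′ → s ≡ idleAt w × t ≡ idleAt (erase w′) × Computes (entry a) (w ∷ʳ blank) w′) → Edge s a t
      go (w , w′ , refl , refl , r) = edge-computes r

  transductionGraph-isTransitionGraph : IsTransitionGraph (transductionGraph T)
  transductionGraph-isTransitionGraph = sweepLLBM , sweepLLBM-normalized ,
    code⇒≅ vertex (λ _ _ → vertex-injective) (λ t → vertex-edge t) edge-sound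

-- From labeled machines to rewriting systems

module _ {Γ : Set} where

  split-sym : ∀ u A {v} w → u ++ sym A ∷ v ≡ tape {Γ} w → ∃₂ λ w₁ w₂ → u ≡ ⟦ ∷ cells w₁ × v ≡ cells w₂ ++ [ ⟧ ]
  split-sym (X ∷ u) A w eq = go u w (∷-injectiveˡ eq) (∷-injectiveʳ eq)
    where
    inside : ∀ u {v} w → u ++ sym A ∷ v ≡ cells w ++ [ ⟧ ] → ∃₂ λ w₁ w₂ → u ≡ cells w₁ × v ≡ cells w₂ ++ [ ⟧ ]
    inside []          []      ()
    inside (_ ∷ [])    []      ()
    inside (_ ∷ _ ∷ _) []      ()
    inside []          (x ∷ w) refl = [] , w , refl , refl
    inside (X ∷ u)     (x ∷ w) eq with inside u w (∷-injectiveʳ eq)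
    ... | w₁ , w₂ , refl , refl = x ∷ w₁ , w₂ , cong (_∷ cells w₁) (∷-injectiveˡ eq) , refl
    go : ∀ u w {v} → X ≡ ⟦ → u ++ sym A ∷ v ≡ cells w ++ [ ⟧ ] → ∃₂ λ w₁ w₂ → X ∷ u ≡ ⟦ ∷ cells w₁ × v ≡ cells w₂ ++ [ ⟧ ]
    go u w refl eq with inside u w eq
    ... | w₁ , w₂ , refl , refl = w₁ , w₂ , refl , refl

  data Split : List (Cell Γ) → List (Cell Γ) → Set where
    at-left : ∀ w → Split [] (tape w)
    beyond  : ∀ w₁ w₂ → Split (⟦ ∷ cells w₁) (cells w₂ ++ [ ⟧ ])

  split-tape : ∀ u v w → v ≢ [] → u ++ v ≡ tape w → Split u v
  split-tape []      v w _   refl = at-left w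
  split-tape (X ∷ u) v w v≢[] eq with ∷-injectiveˡ eq
  ... | refl = go u w (∷-injectiveʳ eq)
    where
    inside : ∀ u w → u ++ v ≡ cells w ++ [ ⟧ ] → ∃₂ λ w₁ w₂ → u ≡ cells w₁ × v ≡ cells w₂ ++ [ ⟧ ]
    inside []       w       eq = [] , w , refl , eq
    inside (X ∷ []) []      eq = ⊥-elim (v≢[] (∷-injectiveʳ eq))
    inside (X ∷ _ ∷ _) []   ()
    inside (X ∷ u)  (x ∷ w) eq with inside u w (∷-injectiveʳ eq)
    ... | w₁ , w₂ , refl , v≡ = x ∷ w₁ , w₂ , cong (_∷ cells w₁) (∷-injectiveˡ eq) , v≡
    go : ∀ u w → u ++ v ≡ cells w ++ [ ⟧ ] → Split (⟦ ∷ u) v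
    go u w eq with inside u w eq
    ... | w₁ , w₂ , refl , refl = beyond w₁ w₂

  cells-end : ∀ (w : List Γ) → cells w ++ [ ⟧ ] ≢ []
  cells-end []      ()
  cells-end (_ ∷ _) ()

  cells-++ : ∀ (u v : List Γ) → cells (u ++ v) ≡ cells u ++ cells v
  cells-++ = map-++ sym

module _ {A : Set} (M : LLBM A) where
  open LLBM M

  private
    Config : StateWord Q Γ → Set
    Config = IsConfiguration

    tape-join : ∀ w₁ w₂ → (⟦ ∷ cells w₁) ++ cells w₂ ++ [ ⟧ ] ≡ tape {Γ} (w₁ ++ w₂)
    tape-join w₁ w₂ = cong (⟦ ∷_) (≡.trans (≡.sym (++-assoc (cells w₁) (cells w₂) [ ⟧ ])) (cong (_++ [ ⟧ ]) (≡.sym (cells-++ w₁ w₂))))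

    move-configuration : ∀ {r c c′} → MoveStep {Q} {Γ} r c c′ → Config c → Config c′
    move-configuration (forward {s = inner A B .⊕} {u} {v}) (_ , w , eq) with split-sym u A w eq
    ... | w₁ , w₂ , refl , refl = cells-end w₂ , w₁ ++ B ∷ w₂ ,
      ≡.trans (∷ʳ-++ (⟦ ∷ cells w₁) (sym B) _) (tape-join w₁ (B ∷ w₂))
    move-configuration (forward {s = left} {u} {v}) (_ , w , eq) = nonempty-rest v eq , w , ≡.trans (∷ʳ-++ u ⟦ v) eq
      where
      nonempty-rest : ∀ v → u ++ ⟦ ∷ v ≡ tape w → v ≢ []
      nonempty-rest [] eq refl with () ← ∷ʳ-injectiveʳ u (⟦ ∷ cells w) eq
    move-configuration (backward {s = inner A B .⊖} {u} {C} {v}) (_ , w , eq) with split-sym (u ∷ʳ C) A w eq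
    ... | w₁ , w₂ , u∷ʳC≡ , refl = (λ ()) , w₁ ++ B ∷ w₂ ,
      ≡.trans (≡.sym (∷ʳ-++ u C _)) (≡.trans (cong (_++ sym B ∷ cells w₂ ++ [ ⟧ ]) u∷ʳC≡) (tape-join w₁ (B ∷ w₂)))
    move-configuration (backward {s = right} {u} {C} {v}) (_ , w , eq) = (λ ()) , w , ≡.trans (≡.sym (∷ʳ-++ u C _)) eq

  -- The shapes of the rules protect the markers: these are rewritten by themselves with a move
  -- inwards, never deleted, and nothing is inserted before `⟦`. The end of a derivation can thus be
  -- recognised as a configuration.
  step-configuration : ∀ {x c c′} → Step M x c c′ → Config c → Config c′
  step-configuration (moving _ s) config = move-configuration s config
  step-configuration (deleting {B = B} {u = u} _) (_ , w , eq) with split-sym u B w eq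
  ... | w₁ , w₂ , refl , refl = cells-end w₂ , w₁ ++ w₂ , tape-join w₁ w₂
  step-configuration (inserting {B = B} {s = sym A} {u} _) (_ , w , eq) with split-sym u A w eq
  ... | w₁ , w₂ , refl , refl = (λ ()) , w₁ ++ B ∷ A ∷ w₂ , tape-join w₁ (B ∷ A ∷ w₂)
  step-configuration (inserting {B = B} {s = ⟧} {u} _) (_ , w , eq) with ⟧-last u w eq
  ... | refl , refl = (λ ()) , w ++ [ B ] , tape-join w [ B ]

  steps-configuration : ∀ {x c c′} → Star (Step M x) c c′ → Config c → Config c′
  steps-configuration ε        config = config
  steps-configuration (s ◅ ss) config = steps-configuration ss (step-configuration s config)

-- Factors of a word with one marked letter

data Occurrence {X : Set} (p : List X) (x : X) (s u l v : List X) : Set where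
  around : ∀ l₁ l₂ → l ≡ l₁ ++ x ∷ l₂ → p ≡ u ++ l₁ → s ≡ l₂ ++ v → Occurrence p x s u l v
  prior  : ∀ v′ → p ≡ u ++ l ++ v′ → Occurrence p x s u l v
  later  : ∀ u′ → s ≡ u′ ++ l ++ v → Occurrence p x s u l v

locate : ∀ {X : Set} (p : List X) {x s} u l {v} → p ++ x ∷ s ≡ u ++ l ++ v → Occurrence p x s u l v
locate p       []      l       eq with at-start p l eq
  where
  at-start : ∀ {X : Set} (p : List X) {x s} l {v} → p ++ x ∷ s ≡ l ++ v →
             (∃₂ λ l₁ l₂ → l ≡ l₁ ++ x ∷ l₂ × p ≡ l₁ × s ≡ l₂ ++ v) ⊎ (∃ λ v′ → p ≡ l ++ v′)
  at-start p       []      eq = inj₂ (p , refl)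
  at-start []      (y ∷ l) eq = inj₁ ([] , l , cong (_∷ l) (≡.sym (∷-injectiveˡ eq)) , refl , ∷-injectiveʳ eq)
  at-start (z ∷ p) (y ∷ l) eq with ∷-injectiveˡ eq | at-start p l (∷-injectiveʳ eq)
  ... | refl | inj₁ (l₁ , l₂ , refl , refl , s≡) = inj₁ (z ∷ l₁ , l₂ , refl , refl , s≡)
  ... | refl | inj₂ (v′ , refl)                  = inj₂ (v′ , refl)
... | inj₁ (l₁ , l₂ , l≡ , p≡ , s≡) = around l₁ l₂ l≡ p≡ s≡
... | inj₂ (v′ , p≡)                = prior v′ p≡
locate []      (y ∷ u) l       eq = later u (∷-injectiveʳ eq)
locate (z ∷ p) (y ∷ u) l       eq with ∷-injectiveˡ eq | locate p u l (∷-injectiveʳ eq)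
... | refl | around l₁ l₂ l≡ refl s≡ = around l₁ l₂ l≡ refl s≡
... | refl | prior v′ refl           = prior v′ refl
... | refl | later u′ s≡             = later u′ s≡

-- A configuration u q v is written with different letters for the cells on
-- the two sides of the head.  The letter a, appended as new a, first checks
-- the right marker, then travels as up a to the left marker, and as down a
-- to the head, where it is inserted.
module _ {A : Set} (A-finite : Finite A) (M : LLBM A) (N : Normalized M) where
  open LLBM M
  open Normalized N
  private
    data Ω : Set where
      lc rc       : Cell Γ → Ω
      hd          : Q → Ω
      new up down : A → Ω

    Ω-finite : Finite Ω
    Ω-finite = Finite-retract
      (Finite-⊎ (Finite-⊎ (Finite-Cell Γ-finite) (Finite-Cell Γ-finite))
                (Finite-⊎ Q-finite (Finite-⊎ A-finite (Finite-⊎ A-finite A-finite))))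
      (λ { (inj₁ (inj₁ X)) → lc X
         ; (inj₁ (inj₂ X)) → rc X
         ; (inj₂ (inj₁ q)) → hd q
         ; (inj₂ (inj₂ (inj₁ a))) → new a
         ; (inj₂ (inj₂ (inj₂ (inj₁ a)))) → up a
         ; (inj₂ (inj₂ (inj₂ (inj₂ a)))) → down a })
      (λ { (lc X) → inj₁ (inj₁ X) , refl
         ; (rc X) → inj₁ (inj₂ X) , refl
         ; (hd q) → inj₂ (inj₁ q) , refl
         ; (new a) → inj₂ (inj₂ (inj₁ a)) , refl
         ; (up a) → inj₂ (inj₂ (inj₂ (inj₁ a))) , refl
         ; (down a) → inj₂ (inj₂ (inj₂ (inj₂ a))) , refl })

    data Token : Ω → Set where
      new  : ∀ a → Token (new a)
      up   : ∀ a → Token (up a)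
      down : ∀ a → Token (down a)

    -- A local test: `lc ⟦` can only be the first letter, and a cell right of the head is followed
    -- only by such cells, up to `rc ⟧`. The part left of the head is tested by the descending
    -- token, which passes only over `lc` letters of inner symbols.
    fits : Ω → Ω → Bool
    fits x        (lc ⟦)  = false
    fits (rc ⟧)   y       = false
    fits (rc X)   (rc ⟦)  = false
    fits (rc X)   (rc Y)  = true
    fits (rc X)   y       = false
    fits x        y       = true

    data IsRule : List Ω × List Ω → Set where
      fwd  : ∀ {p X q Y s} → ofMove (move p X q Y ⊕ s) ∈ δ → IsRule (hd p ∷ rc X ∷ [] , lc Y ∷ hd q ∷ [])
      bwd  : ∀ {p X q Y s} C → ofMove (move p X q Y ⊖ s) ∈ δ →
             IsRule (lc C ∷ hd p ∷ rc X ∷ [] , hd q ∷ rc C ∷ rc Y ∷ [])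
      del  : ∀ {p B q} → delete p B q ∈ δ → IsRule (hd p ∷ rc (sym B) ∷ [] , hd q ∷ [])
      ins  : ∀ {p X a q B s} → insert p X a q B s ∈ δ →
             IsRule (down a ∷ hd p ∷ rc X ∷ [] , hd q ∷ rc (sym B) ∷ rc X ∷ [])
      enter : ∀ a → IsRule (rc ⟧ ∷ new a ∷ [] , up a ∷ rc ⟧ ∷ [])
      turn  : ∀ a → IsRule (lc ⟦ ∷ up a ∷ [] , lc ⟦ ∷ down a ∷ [])
      rise  : ∀ x a → IsRule (x ∷ up a ∷ [] , up a ∷ x ∷ [])
      fall  : ∀ B a → IsRule (down a ∷ lc (sym B) ∷ [] , lc (sym B) ∷ down a ∷ [])
      -- loops which make words with tokens or ill-formed words reducible
      loop₁ : ∀ {x} → Token x → IsRule ([ x ] , [ x ])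
      loop₂ : ∀ {x y} → fits x y ≡ false → IsRule (x ∷ y ∷ [] , x ∷ y ∷ [])

    ΩΩ-finite : Finite (Ω × Ω)
    ΩΩ-finite = Finite-× Ω-finite Ω-finite

    δRules : Rule Q Γ A → RewritingSystem Ω
    δRules (ofMove (move p X q Y ⊕ s)) = [ hd p ∷ rc X ∷ [] , lc Y ∷ hd q ∷ [] ]
    δRules (ofMove (move p X q Y ⊖ s)) =
      map (λ C → lc C ∷ hd p ∷ rc X ∷ [] , hd q ∷ rc C ∷ rc Y ∷ []) (elements (Finite-Cell Γ-finite))
    δRules (insert p X a q B s)        = [ down a ∷ hd p ∷ rc X ∷ [] , hd q ∷ rc (sym B) ∷ rc X ∷ [] ]
    δRules (delete p B q)              = [ hd p ∷ rc (sym B) ∷ [] , hd q ∷ [] ]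

    letterRules : A → RewritingSystem Ω
    letterRules a =
      (rc ⟧ ∷ new a ∷ [] , up a ∷ rc ⟧ ∷ []) ∷ (lc ⟦ ∷ up a ∷ [] , lc ⟦ ∷ down a ∷ []) ∷
      ([ new a ] , [ new a ]) ∷ ([ up a ] , [ up a ]) ∷ ([ down a ] , [ down a ]) ∷
      map (λ x → x ∷ up a ∷ [] , up a ∷ x ∷ []) (elements Ω-finite) ++
      map (λ B → down a ∷ lc (sym B) ∷ [] , lc (sym B) ∷ down a ∷ []) (elements Γ-finite)

    loopRule : Ω × Ω → List Ω × List Ω
    loopRule (x , y) = x ∷ y ∷ [] , x ∷ y ∷ []

    bad? : ∀ (xy : Ω × Ω) → Dec (fits (proj₁ xy) (proj₂ xy) ≡ false)
    bad? (x , y) = finite-≟ Finite-Bool (fits x y) false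

    R : RewritingSystem Ω
    R = concat (map δRules δ) ++ concat (map letterRules (elements A-finite)) ++ select ΩΩ-finite bad? loopRule

    fromδ : ∀ {ρ r} → ρ ∈ δRules r → r ∈ δ → ρ ∈ R
    fromδ ρ∈ r∈ = ∈-++⁺ˡ (∈-concat⁺′ ρ∈ (∈-map⁺ δRules r∈))

    fromLetter : ∀ {ρ} a → ρ ∈ letterRules a → ρ ∈ R
    fromLetter a ρ∈ = ∈-++⁺ʳ (concat (map δRules δ)) (∈-++⁺ˡ (∈-concat⁺′ ρ∈ (∈-map⁺ letterRules (∈-elements A-finite a))))

    R⁺ : ∀ {ρ} → IsRule ρ → ρ ∈ R
    R⁺ (fwd r∈)   = fromδ (here refl) r∈
    R⁺ (bwd C r∈) = fromδ (∈-map⁺ _ (∈-elements (Finite-Cell Γ-finite) C)) r∈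
    R⁺ (del r∈)   = fromδ (here refl) r∈
    R⁺ (ins r∈)   = fromδ (here refl) r∈
    R⁺ (enter a)  = fromLetter a (here refl)
    R⁺ (turn a)   = fromLetter a (there (here refl))
    R⁺ (rise x a) = fromLetter a (there (there (there (there (there (∈-++⁺ˡ (∈-map⁺ _ (∈-elements Ω-finite x))))))))
    R⁺ (fall B a) = fromLetter a (there (there (there (there (there
      (∈-++⁺ʳ (map (λ x → x ∷ up a ∷ [] , up a ∷ x ∷ []) (elements Ω-finite)) (∈-map⁺ _ (∈-elements Γ-finite B))))))))
    R⁺ (loop₁ (new a))  = fromLetter a (there (there (here refl)))
    R⁺ (loop₁ (up a))   = fromLetter a (there (there (there (here refl))))
    R⁺ (loop₁ (down a)) = fromLetter a (there (there (there (there (here refl)))))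
    R⁺ (loop₂ {x} {y} eq) = ∈-++⁺ʳ (concat (map δRules δ)) (∈-++⁺ʳ (concat (map letterRules (elements A-finite)))
      (select⁺ ΩΩ-finite bad? loopRule {x , y} eq))

    δRules⁻ : ∀ r {ρ} → r ∈ δ → ρ ∈ δRules r → IsRule ρ
    δRules⁻ (ofMove (move p X q Y ⊕ s)) r∈ (here refl) = fwd r∈
    δRules⁻ (ofMove (move p X q Y ⊖ s)) r∈ ρ∈ with ∈-map⁻ _ ρ∈
    ... | C , _ , refl = bwd C r∈
    δRules⁻ (insert p X a q B s)        r∈ (here refl) = ins r∈
    δRules⁻ (delete p B q)              r∈ (here refl) = del r∈

    letterRules⁻ : ∀ a {ρ} → ρ ∈ letterRules a → IsRule ρ
    letterRules⁻ a (here refl)                                 = enter a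
    letterRules⁻ a (there (here refl))                         = turn a
    letterRules⁻ a (there (there (here refl)))                 = loop₁ (new a)
    letterRules⁻ a (there (there (there (here refl))))         = loop₁ (up a)
    letterRules⁻ a (there (there (there (there (here refl))))) = loop₁ (down a)
    letterRules⁻ a (there (there (there (there (there ρ∈)))))
      with ∈-++⁻ (map (λ x → x ∷ up a ∷ [] , up a ∷ x ∷ []) (elements Ω-finite)) ρ∈
    ... | inj₁ ρ∈₁ with ∈-map⁻ _ ρ∈₁
    ... | x , _ , refl = rise x a
    letterRules⁻ a (there (there (there (there (there ρ∈))))) | inj₂ ρ∈₂ with ∈-map⁻ _ ρ∈₂
    ... | B , _ , refl = fall B a

    R⁻ : ∀ {ρ} → ρ ∈ R → IsRule ρ
    R⁻ ρ∈ with ∈-++⁻ (concat (map δRules δ)) ρ∈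
    ... | inj₁ ρ∈₁ with ∈-concat⁻′ (map δRules δ) ρ∈₁
    ... | _ , ρ∈ys , ys∈ with ∈-map⁻ δRules ys∈
    ... | r , r∈ , refl = δRules⁻ r r∈ ρ∈ys
    R⁻ ρ∈ | inj₂ ρ∈₂ with ∈-++⁻ (concat (map letterRules (elements A-finite))) ρ∈₂
    ... | inj₁ ρ∈₃ with ∈-concat⁻′ (map letterRules (elements A-finite)) ρ∈₃
    ... | _ , ρ∈ys , ys∈ with ∈-map⁻ letterRules ys∈
    ... | a , _ , refl = letterRules⁻ a ρ∈ys
    R⁻ ρ∈ | inj₂ ρ∈₂ | inj₂ ρ∈₄ with select⁻ ΩΩ-finite bad? loopRule ρ∈₄
    ... | _ , eq , refl = loop₂ eq

    decreasing : LengthDecreasing R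
    decreasing = All.tabulate (λ ρ∈ → go (R⁻ ρ∈))
      where
      go : ∀ {ρ} → IsRule ρ → length (proj₂ ρ) ≤ length (proj₁ ρ)
      go (fwd _)    = ℕ.≤-refl
      go (bwd _ _)  = ℕ.≤-refl
      go (del _)    = s≤s z≤n
      go (ins _)    = ℕ.≤-refl
      go (enter _)  = ℕ.≤-refl
      go (turn _)   = ℕ.≤-refl
      go (rise _ _) = ℕ.≤-refl
      go (fall _ _) = ℕ.≤-refl
      go (loop₁ _)  = ℕ.≤-refl
      go (loop₂ _)  = ℕ.≤-refl

    enc : StateWord Q Γ → List Ω
    enc (u ⟨ q ⟩ v) = map lc u ++ hd q ∷ map rc v

    unique-hd : ∀ u {q} v s {p t} → map lc u ++ hd q ∷ map rc v ≡ s ++ hd p ∷ t → s ≡ map lc u × q ≡ p × t ≡ map rc v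
    unique-hd []      v []      refl = refl , refl , refl
    unique-hd []      v (_ ∷ s) eq = ⊥-elim (none v s (∷-injectiveʳ eq))
      where
      none : ∀ v s {p t} → map rc v ≢ s ++ hd p ∷ t
      none []      []      ()
      none []      (_ ∷ _) ()
      none (_ ∷ v) []      ()
      none (_ ∷ v) (_ ∷ s) eq = none v s (∷-injectiveʳ eq)
    unique-hd (x ∷ u) v []      ()
    unique-hd (x ∷ u) v (y ∷ s) eq =
      Product.map (cong₂ _∷_ (≡.sym (∷-injectiveˡ eq))) id (unique-hd u v s (∷-injectiveʳ eq))

    enc-injective : ∀ {c c′} → enc c ≡ enc c′ → c ≡ c′
    enc-injective {u ⟨ q ⟩ v} {u′ ⟨ q′ ⟩ v′} eq with unique-hd u v (map lc u′) eq
    ... | u≡ , refl , v≡ = cong₂ (λ u v → u ⟨ q ⟩ v) (map-injective (λ { refl → refl }) (≡.sym u≡))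
                                             (map-injective (λ { refl → refl }) (≡.sym v≡))

    enc-no-token : ∀ c s {x} t → Token x → enc c ≢ s ++ x ∷ t
    enc-no-token ([] ⟨ q ⟩ v)      []      t () refl
    enc-no-token ([] ⟨ q ⟩ v)      (y ∷ s) t tok eq = rc-no-token v s tok (∷-injectiveʳ eq)
      where
      rc-no-token : ∀ v s {x t} → Token x → map rc v ≢ s ++ x ∷ t
      rc-no-token []      []      tok ()
      rc-no-token []      (_ ∷ _) tok ()
      rc-no-token (_ ∷ v) []      () refl
      rc-no-token (_ ∷ v) (_ ∷ s) tok eq = rc-no-token v s tok (∷-injectiveʳ eq)
    enc-no-token ((X ∷ u) ⟨ q ⟩ v) []      t () refl
    enc-no-token ((X ∷ u) ⟨ q ⟩ v) (y ∷ s) t tok eq = enc-no-token (u ⟨ q ⟩ v) s t tok (∷-injectiveʳ eq)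

    enc-∷ʳ : ∀ u C q v → enc ((u ∷ʳ C) ⟨ q ⟩ v) ≡ map lc u ++ lc C ∷ hd q ∷ map rc v
    enc-∷ʳ u C q v = ≡.trans (cong (_++ hd q ∷ map rc v) (map-++ lc u [ C ])) (∷ʳ-++ (map lc u) (lc C) _)

    ε-complete : ∀ {c c′} → Step M nothing c c′ → Rewrite R (enc c) (enc c′)
    ε-complete (moving r∈ (forward {p = p} {X} {q} {Y} {u = u} {v})) =
      subst (Rewrite R (enc (u ⟨ p ⟩ (X ∷ v)))) (≡.sym (enc-∷ʳ u Y q v)) (rewriting (map lc u) (map rc v) (R⁺ (fwd r∈)))
    ε-complete (moving r∈ (backward {p = p} {X} {q} {Y} {u = u} {C} {v})) =
      subst (λ w → Rewrite R w (enc (u ⟨ q ⟩ (C ∷ Y ∷ v)))) (≡.sym (enc-∷ʳ u C p (X ∷ v)))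
            (rewriting (map lc u) (map rc v) (R⁺ (bwd C r∈)))
    ε-complete (deleting {u = u} {v} r∈) = rewriting (map lc u) (map rc v) (R⁺ (del r∈))

    -- An encoding contains no token, so only the rules for moves and deletions and the loops
    -- remain. A loop corresponds to no step of the machine, hence the `Star`.
    ε-sound : ∀ c s t {l r} → IsRule (l , r) → enc c ≡ s ++ l ++ t → ∃ λ c′ → s ++ r ++ t ≡ enc c′ × Star (Step M nothing) c c′
    ε-sound (u ⟨ q ⟩ v) s t (fwd r∈) eq with unique-hd u v s eq
    ε-sound (u ⟨ q ⟩ (X ∷ v)) s t (fwd {q = q′} {Y} r∈) eq | refl , refl , refl =
      (u ∷ʳ Y) ⟨ q′ ⟩ v , ≡.sym (enc-∷ʳ u Y q′ v) , moving r∈ forward ◅ ε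
    ε-sound (u ⟨ q ⟩ v) s t (bwd C r∈) eq with unique-hd u v (s ∷ʳ lc C) (≡.trans eq (≡.sym (∷ʳ-++ s (lc C) _)))
    ... | s≡ , refl , t≡ with ∷-split lc u s (≡.sym s≡)
    ε-sound (u ⟨ q ⟩ (X ∷ v)) s t (bwd C r∈) eq | s≡ , refl , refl | u′ , _ ∷ [] , refl , refl , refl =
      _ , refl , moving r∈ backward ◅ ε
    ε-sound (u ⟨ q ⟩ v) s t (del r∈) eq with unique-hd u v s eq
    ε-sound (u ⟨ q ⟩ (X ∷ v)) s t (del r∈) eq | refl , refl , refl = _ , refl , deleting r∈ ◅ ε
    ε-sound c s t (ins {a = a} r∈) eq = ⊥-elim (enc-no-token c s _ (down a) eq)
    ε-sound c s t (enter a) eq = ⊥-elim (enc-no-token c (s ∷ʳ rc ⟧) _ (new a) (≡.trans eq (≡.sym (∷ʳ-++ s (rc ⟧) _))))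
    ε-sound c s t (turn a) eq = ⊥-elim (enc-no-token c (s ∷ʳ lc ⟦) _ (up a) (≡.trans eq (≡.sym (∷ʳ-++ s (lc ⟦) _))))
    ε-sound c s t (rise x a) eq = ⊥-elim (enc-no-token c (s ∷ʳ x) _ (up a) (≡.trans eq (≡.sym (∷ʳ-++ s x _))))
    ε-sound c s t (fall B a) eq = ⊥-elim (enc-no-token c s _ (down a) eq)
    ε-sound c s t (loop₁ _) eq = c , ≡.sym eq , ε
    ε-sound c s t (loop₂ _) eq = c , ≡.sym eq , ε

    Fitting : List Ω → Set
    Fitting w = ∀ s {x y} t → w ≡ s ++ x ∷ y ∷ t → fits x y ≡ true

    fitting-[x] : ∀ x → Fitting [ x ]
    fitting-[x] x []          t ()
    fitting-[x] x (_ ∷ [])    t ()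
    fitting-[x] x (_ ∷ _ ∷ _) t ()

    fitting-∷ : ∀ {x y w} → fits x y ≡ true → Fitting (y ∷ w) → Fitting (x ∷ y ∷ w)
    fitting-∷ ok fitting []      t refl = ok
    fitting-∷ ok fitting (_ ∷ s) t eq   = fitting s t (∷-injectiveʳ eq)

    fitting-right : ∀ w → Fitting (map rc (cells w ++ [ ⟧ ]))
    fitting-right []          = fitting-[x] (rc ⟧)
    fitting-right (B ∷ [])    = fitting-∷ refl (fitting-[x] (rc ⟧))
    fitting-right (B ∷ C ∷ w) = fitting-∷ refl (fitting-right (C ∷ w))

    fitting-head : ∀ q w → Fitting (hd q ∷ map rc (cells w ++ [ ⟧ ]))
    fitting-head q []      = fitting-∷ refl (fitting-right [])
    fitting-head q (B ∷ w) = fitting-∷ refl (fitting-right (B ∷ w))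

    fitting-left : ∀ X u q w → X ≢ ⟧ → Fitting (lc X ∷ map lc (cells u) ++ hd q ∷ map rc (cells w ++ [ ⟧ ]))
    fitting-left X []      q w X≢ = fitting-∷ refl (fitting-head q w)
    fitting-left X (B ∷ u) q w X≢ = fitting-∷ refl (fitting-left (sym B) u q w (λ ()))

    enc-fitting : ∀ {c} → IsConfiguration c → Fitting (enc c)
    enc-fitting {u ⟨ q ⟩ v} (v≢[] , w , eq) with split-tape u v w v≢[] eq
    ... | beyond w₁ w₂     = fitting-left ⟦ w₁ q w₂ (λ ())
    ... | at-left []       = fitting-∷ refl (fitting-∷ refl (fitting-right []))
    ... | at-left (B ∷ w′) = fitting-∷ refl (fitting-∷ refl (fitting-right (B ∷ w′)))

    external≢internal : ∀ {q} → kind q ≡ external → kind q ≢ internal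
    external≢internal ext int with () ← ≡.trans (≡.sym ext) int

    -- At an external state the machine has only letter rules, whose translation has a token on the
    -- left-hand side; and no loop applies, for a configuration is well-formed and free of tokens.
    enc-NF : ∀ {c} → IsExternalConfiguration M N c → NF R (enc c)
    enc-NF {c@(u ⟨ q ⟩ v)} (config , ext) s t ρ∈ eq = go (R⁻ ρ∈) eq
      where
      go : ∀ {l r} → IsRule (l , r) → enc c ≢ s ++ l ++ t
      go (fwd r∈) eq with unique-hd u v s eq
      ... | _ , refl , _ = external≢internal ext (ε-rules r∈ refl)
      go (bwd C r∈) eq with unique-hd u v (s ∷ʳ lc C) (≡.trans eq (≡.sym (∷ʳ-++ s (lc C) _)))
      ... | _ , refl , _ = external≢internal ext (ε-rules r∈ refl)
      go (del r∈) eq with unique-hd u v s eq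
      ... | _ , refl , _ = external≢internal ext (ε-rules r∈ refl)
      go (ins {a = a} r∈) eq = enc-no-token c s _ (down a) eq
      go (enter a) eq = enc-no-token c (s ∷ʳ rc ⟧) _ (new a) (≡.trans eq (≡.sym (∷ʳ-++ s (rc ⟧) _)))
      go (turn a) eq = enc-no-token c (s ∷ʳ lc ⟦) _ (up a) (≡.trans eq (≡.sym (∷ʳ-++ s (lc ⟦) _)))
      go (rise x a) eq = enc-no-token c (s ∷ʳ x) _ (up a) (≡.trans eq (≡.sym (∷ʳ-++ s x _)))
      go (fall B a) eq = enc-no-token c s _ (down a) eq
      go (loop₁ tok) eq = enc-no-token c s _ tok eq
      go (loop₂ bad) eq with () ← ≡.trans (≡.sym bad) (enc-fitting config s t eq)

    -- Totality enters here: an internal state has a move for every cell it may read. A left move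
    -- can be carried out, since at the left end the cell is `⟦`, whose moves go right.
    NF-external : ∀ {c} → IsConfiguration c → NF R (enc c) → kind (state c) ≡ external
    NF-external {u ⟨ q ⟩ []} (v≢[] , _) nf = ⊥-elim (v≢[] refl)
    NF-external {u ⟨ q ⟩ (X ∷ v)} (_ , w , eq) nf with kind q in kind≡
    ... | external = refl
    ... | internal with total q X kind≡
    ... | q′ , Y , ⊕ , s , r∈ = ⊥-elim (nf (map lc u) (map rc v) (R⁺ (fwd r∈)) refl)
    ... | q′ , Y , ⊖ , s , r∈ with initLast u
    ... | u′ ∷ʳ′ C = ⊥-elim (nf (map lc u′) (map rc v) (R⁺ (bwd C r∈)) (enc-∷ʳ u′ C q (X ∷ v)))
    NF-external {.[] ⟨ q ⟩ (X ∷ v)} (_ , w , eq) nf | internal | q′ , Y , ⊖ , s , r∈ | [] with ∷-injectiveˡ eq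
    NF-external {.[] ⟨ q ⟩ (X ∷ v)} (_ , w , eq) nf | internal | q′ , Y , ⊖ , () , r∈ | [] | refl

    rise* : ∀ a z t → Star (Rewrite R) (z ++ up a ∷ t) (up a ∷ z ++ t)
    rise* a []      t = ε
    rise* a (x ∷ z) t = under [ x ] (rise* a z t) ◅◅ rule (z ++ t) (R⁺ (rise x a))

    fall* : ∀ a w t → Star (Rewrite R) (down a ∷ map lc (cells w) ++ t) (map lc (cells w) ++ down a ∷ t)
    fall* a []      t = ε
    fall* a (B ∷ w) t = rule (map lc (cells w) ++ t) (R⁺ (fall B a)) ◅◅ under [ lc (sym B) ] (fall* a w t)

    arrive : ∀ a w z → Star (Rewrite R) ((lc ⟦ ∷ map lc (cells w) ++ z ++ [ rc ⟧ ]) ++ [ new a ])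
                                       (lc ⟦ ∷ map lc (cells w) ++ down a ∷ z ++ [ rc ⟧ ])
    arrive a w z =
      subst (λ y → Star (Rewrite R) y (lc ⟦ ∷ map lc (cells w) ++ down a ∷ z ++ [ rc ⟧ ])) reassociate
        (under (lc ⟦ ∷ map lc (cells w)) (under z (rule [] (R⁺ (enter a))))
        ◅◅ under [ lc ⟦ ] (subst₂ (Star (Rewrite R)) (++-assoc (map lc (cells w)) z _) (cong (up a ∷_) (++-assoc (map lc (cells w)) z _))
                                  (rise* a (map lc (cells w) ++ z) [ rc ⟧ ]))
        ◅◅ rule _ (R⁺ (turn a)) ◅◅ under [ lc ⟦ ] (fall* a w (z ++ [ rc ⟧ ])))
      where
      reassociate : lc ⟦ ∷ map lc (cells w) ++ z ++ rc ⟧ ∷ [ new a ] ≡ (lc ⟦ ∷ map lc (cells w) ++ z ++ [ rc ⟧ ]) ++ [ new a ]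
      reassociate = cong (lc ⟦ ∷_) (≡.sym (≡.trans (++-assoc (map lc (cells w)) _ [ new a ])
                                                  (cong (map lc (cells w) ++_) (++-assoc z [ rc ⟧ ] [ new a ]))))

    insert-complete : ∀ {a c d} → IsConfiguration c → Step M (just a) c d → Star (Rewrite R) (enc c ++ [ new a ]) (enc d)
    insert-complete {a} (_ , w , eq) (inserting {p} {X} {.a} {q} {B} {s} {u} {v} r∈) = go (split-tape u (X ∷ v) w (λ ()) eq) s refl r∈
      where
      go : ∀ {u V X v} → Split u V → (s : NotLeftMarker X) → V ≡ X ∷ v → insert p X a q B s ∈ δ →
           Star (Rewrite R) (enc (u ⟨ p ⟩ V) ++ [ new a ]) (enc (u ⟨ q ⟩ (sym B ∷ V)))
      go (at-left w) () refl _
      go {X = X} {v} (beyond w₁ w₂) s V≡ r∈ =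
        subst₂ (λ x y → Star (Rewrite R) (x ++ [ new a ]) y) (enc-split p (cells w₂)) (enc-split q (sym B ∷ cells w₂))
          (arrive a w₁ (hd p ∷ map rc (cells w₂)) ◅◅
           under (lc ⟦ ∷ map lc (cells w₁))
             (subst₂ (λ x y → Star (Rewrite R) (down a ∷ hd p ∷ x) (hd q ∷ rc (sym B) ∷ y)) right≡ right≡
                     (rule (map rc v) (R⁺ (ins r∈)))))
        where
        enc-split : ∀ q z → lc ⟦ ∷ map lc (cells w₁) ++ hd q ∷ map rc z ++ [ rc ⟧ ] ≡ enc ((⟦ ∷ cells w₁) ⟨ q ⟩ (z ++ [ ⟧ ]))
        enc-split q z = cong (λ x → lc ⟦ ∷ map lc (cells w₁) ++ hd q ∷ x) (≡.sym (map-++ rc z [ ⟧ ]))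
        right≡ : map rc (X ∷ v) ≡ map rc (cells w₂) ++ [ rc ⟧ ]
        right≡ = ≡.trans (cong (map rc) (≡.sym V≡)) (map-++ rc (cells w₂) [ ⟧ ])

    Ends : List Ω → Set
    Ends w = ∃ λ z → w ≡ z ∷ʳ rc ⟧

    ends-suffix : ∀ z {x y} → Ends (z ++ x ∷ y) → Ends (x ∷ y)
    ends-suffix []      ends = ends
    ends-suffix (_ ∷ z) {x} {y} ([] , eq) with z | ∷-injectiveʳ eq
    ... | []    | ()
    ... | _ ∷ _ | ()
    ends-suffix (_ ∷ z) (_ ∷ y , eq) = ends-suffix z (y , ∷-injectiveʳ eq)

    module _ (W : List Ω) (W-nf : NF R W) (a : A) where

      -- the words reachable from W followed by new a
      data Stage : List Ω → Set where
        waiting : Stage (W ++ [ new a ])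
        rising  : ∀ p s → p ++ s ≡ W → Ends W → Stage (p ++ up a ∷ s)
        falling : ∀ w s → lc ⟦ ∷ map lc (cells w) ++ s ≡ W → Ends W → Stage ((lc ⟦ ∷ map lc (cells w)) ++ down a ∷ s)
        running : ∀ {c d c′} → W ≡ enc c → IsConfiguration c → Step M (just a) c d → Star (Step M nothing) d c′ → Stage (enc c′)

      no-token : ∀ s {x} t → Token x → W ≢ s ++ x ∷ t
      no-token s t tok = W-nf s t (R⁺ (loop₁ tok))

      fitting : Fitting W
      fitting s {x} {y} t eq with fits x y in fits≡
      ... | true  = refl
      ... | false = ⊥-elim (W-nf s t (R⁺ (loop₂ fits≡)) eq)

      -- The test `fits` propagates from `rc X` to the right through the irreducible word `W`; that
      -- `W` ends with `rc ⟧`, as checked by the rule `enter`, stops it there.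
      right-cells : ∀ s X y → X ≢ ⟦ → W ≡ s ++ rc X ∷ y → Ends (rc X ∷ y) → ∃ λ w → rc X ∷ y ≡ map rc (cells w ++ [ ⟧ ])
      right-cells s X []      X≢⟦ eq ([] , refl) = [] , refl
      right-cells s X []      X≢⟦ eq (_ ∷ [] , ())
      right-cells s X []      X≢⟦ eq (_ ∷ _ ∷ _ , ())
      right-cells s X (z ∷ y) X≢⟦ eq ends with fitting s y eq
      right-cells s ⟦ (z ∷ y) X≢⟦ eq ends | _ = ⊥-elim (X≢⟦ refl)
      right-cells s ⟧ (lc ⟦ ∷ y)       X≢⟦ eq ends | ()
      right-cells s ⟧ (lc ⟧ ∷ y)       X≢⟦ eq ends | ()
      right-cells s ⟧ (lc (sym _) ∷ y) X≢⟦ eq ends | ()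
      right-cells s ⟧ (rc _ ∷ y)       X≢⟦ eq ends | ()
      right-cells s ⟧ (hd _ ∷ y)       X≢⟦ eq ends | ()
      right-cells s ⟧ (new _ ∷ y)      X≢⟦ eq ends | ()
      right-cells s ⟧ (up _ ∷ y)       X≢⟦ eq ends | ()
      right-cells s ⟧ (down _ ∷ y)     X≢⟦ eq ends | ()
      right-cells s (sym B) (lc ⟦ ∷ y)       X≢⟦ eq ends | ()
      right-cells s (sym B) (lc ⟧ ∷ y)       X≢⟦ eq ends | ()
      right-cells s (sym B) (lc (sym _) ∷ y) X≢⟦ eq ends | ()
      right-cells s (sym B) (hd _ ∷ y)       X≢⟦ eq ends | ()
      right-cells s (sym B) (new _ ∷ y)      X≢⟦ eq ends | ()
      right-cells s (sym B) (up _ ∷ y)       X≢⟦ eq ends | ()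
      right-cells s (sym B) (down _ ∷ y)     X≢⟦ eq ends | ()
      right-cells s (sym B) (rc ⟦ ∷ y)       X≢⟦ eq ends | ()
      right-cells s (sym B) (rc ⟧ ∷ y) X≢⟦ eq ends | _
        with right-cells (s ∷ʳ rc (sym B)) ⟧ y (λ ()) (≡.trans eq (≡.sym (∷ʳ-++ s _ _))) (ends-suffix [ rc (sym B) ] ends)
      ... | w , y≡ = B ∷ w , cong (rc (sym B) ∷_) y≡
      right-cells s (sym B) (rc (sym C) ∷ y) X≢⟦ eq ends | _
        with right-cells (s ∷ʳ rc (sym B)) (sym C) y (λ ()) (≡.trans eq (≡.sym (∷ʳ-++ s _ _))) (ends-suffix [ rc (sym B) ] ends)
      ... | w , y≡ = B ∷ w , cong (rc (sym B) ∷_) y≡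

      nothing-before-⟦ : ∀ x {s} → W ≡ x ++ lc ⟦ ∷ s → x ≡ []
      nothing-before-⟦ x eq with initLast x
      ... | []     = refl
      ... | z ∷ʳ′ y with () ← fitting z _ (≡.trans eq (∷ʳ-++ z y _))

      -- Only now is `W` known to encode a configuration: the falling token has verified the left
      -- part, the rule itself exhibits `hd p` and `rc X`, and `right-cells` gives the rest.
      insert-sound : ∀ w {p X q B s y} → insert p X a q B s ∈ δ → lc ⟦ ∷ map lc (cells w) ++ hd p ∷ rc X ∷ y ≡ W → Ends W →
                     Stage ((lc ⟦ ∷ map lc (cells w)) ++ hd q ∷ rc (sym B) ∷ rc X ∷ y)
      insert-sound w {p} {X} {q} {B} {s} {y} r∈ refl ends =
        go (right-cells ((lc ⟦ ∷ map lc (cells w)) ∷ʳ hd p) X y (nonleft s) (≡.sym (∷ʳ-++ (lc ⟦ ∷ map lc (cells w)) (hd p) _))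
             (ends-suffix ((lc ⟦ ∷ map lc (cells w)) ∷ʳ hd p) (subst Ends (≡.sym (∷ʳ-++ (lc ⟦ ∷ map lc (cells w)) (hd p) _)) ends)))
        where
        nonleft : ∀ {X} → NotLeftMarker {Γ} X → X ≢ ⟦
        nonleft (sym B) ()
        nonleft ⟧ ()
        go : (∃ λ w → rc X ∷ y ≡ map rc (cells w ++ [ ⟧ ])) → Stage ((lc ⟦ ∷ map lc (cells w)) ++ hd q ∷ rc (sym B) ∷ rc X ∷ y)
        go (w′ , eq) with ∷-split rc (cells w′ ++ [ ⟧ ]) [ rc X ] (≡.sym eq)
        ... | _ ∷ [] , v , v≡ , refl , refl =
          running {c = (⟦ ∷ cells w) ⟨ p ⟩ (X ∷ v)} refl
                  ((λ ()) , w ++ w′ , ≡.trans (cong (λ v → (⟦ ∷ cells w) ++ v) (≡.sym v≡))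
                    (cong (⟦ ∷_) (≡.trans (≡.sym (++-assoc (cells w) (cells w′) [ ⟧ ])) (cong (_++ [ ⟧ ]) (≡.sym (cells-++ w w′))))))
                  (inserting r∈) ε

      -- Where the token `x` can stand within a left-hand side. `two` is a `rise` of some `up b`
      -- past `x`; it would need a second token, which the irreducible `W` does not have.
      data TokenView : Ω → List Ω → List Ω → List Ω → Set where
        enter    : ∀ b → TokenView (new b) [ rc ⟧ ] [] (up b ∷ rc ⟧ ∷ [])
        turn     : ∀ b → TokenView (up b) [ lc ⟦ ] [] (lc ⟦ ∷ down b ∷ [])
        rise     : ∀ z b → TokenView (up b) [ z ] [] (up b ∷ z ∷ [])
        two      : ∀ {x r} b → TokenView x [] [ up b ] r
        fall     : ∀ B b → TokenView (down b) [] [ lc (sym B) ] (lc (sym B) ∷ down b ∷ [])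
        ins      : ∀ {p X b q B s} → insert p X b q B s ∈ δ →
                   TokenView (down b) [] (hd p ∷ rc X ∷ []) (hd q ∷ rc (sym B) ∷ rc X ∷ [])
        loop     : ∀ {x l₁ l₂ r} → r ≡ l₁ ++ x ∷ l₂ → TokenView x l₁ l₂ r

      view : ∀ {l r x} → IsRule (l , r) → Token x → ∀ l₁ l₂ → l ≡ l₁ ++ x ∷ l₂ → TokenView x l₁ l₂ r
      view (fwd _) () [] _ refl
      view (fwd _) () (_ ∷ []) _ refl
      view (fwd _) _ (_ ∷ _ ∷ []) _ ()
      view (fwd _) _ (_ ∷ _ ∷ _ ∷ _) _ ()
      view (bwd _ _) () [] _ refl
      view (bwd _ _) () (_ ∷ []) _ refl
      view (bwd _ _) () (_ ∷ _ ∷ []) _ refl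
      view (bwd _ _) _ (_ ∷ _ ∷ _ ∷ []) _ ()
      view (bwd _ _) _ (_ ∷ _ ∷ _ ∷ _ ∷ _) _ ()
      view (del _) () [] _ refl
      view (del _) () (_ ∷ []) _ refl
      view (del _) _ (_ ∷ _ ∷ []) _ ()
      view (del _) _ (_ ∷ _ ∷ _ ∷ _) _ ()
      view (ins r∈) _ [] _ refl = ins r∈
      view (ins _) () (_ ∷ []) _ refl
      view (ins _) () (_ ∷ _ ∷ []) _ refl
      view (ins _) _ (_ ∷ _ ∷ _ ∷ []) _ ()
      view (ins _) _ (_ ∷ _ ∷ _ ∷ _ ∷ _) _ ()
      view (enter _) () [] _ refl
      view (enter b) _ (_ ∷ []) _ refl = enter b
      view (enter _) _ (_ ∷ _ ∷ []) _ ()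
      view (enter _) _ (_ ∷ _ ∷ _ ∷ _) _ ()
      view (turn _) () [] _ refl
      view (turn b) _ (_ ∷ []) _ refl = turn b
      view (turn _) _ (_ ∷ _ ∷ []) _ ()
      view (turn _) _ (_ ∷ _ ∷ _ ∷ _) _ ()
      view (rise _ b) _ [] _ refl = two b
      view (rise z b) _ (_ ∷ []) _ refl = rise z b
      view (rise _ _) _ (_ ∷ _ ∷ []) _ ()
      view (rise _ _) _ (_ ∷ _ ∷ _ ∷ _) _ ()
      view (fall B b) _ [] _ refl = fall B b
      view (fall _ _) () (_ ∷ []) _ refl
      view (fall _ _) _ (_ ∷ _ ∷ []) _ ()
      view (fall _ _) _ (_ ∷ _ ∷ _ ∷ _) _ ()
      view (loop₁ _) _ l₁ l₂ eq = loop eq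
      view (loop₂ _) _ l₁ l₂ eq = loop eq

      reassociate : ∀ (s l₁ : List Ω) {x l₂ t} → s ++ (l₁ ++ x ∷ l₂) ++ t ≡ (s ++ l₁) ++ x ∷ l₂ ++ t
      reassociate s l₁ = ≡.trans (cong (s ++_) (++-assoc l₁ _ _)) (≡.sym (++-assoc s l₁ _))

      waiting-step : ∀ s t {l₁ l₂ r} → TokenView (new a) l₁ l₂ r → W ≡ s ++ l₁ → [] ≡ l₂ ++ t → Stage (s ++ r ++ t)
      waiting-step s .[] (enter .a) W≡ refl = rising s [ rc ⟧ ] (≡.sym W≡) (s , W≡)
      waiting-step s t (two b) W≡ ()
      waiting-step s t {l₁} {l₂} (loop refl) W≡ eq =
        subst Stage (≡.sym (≡.trans (reassociate s l₁) (cong₂ (λ p z → p ++ new a ∷ z) (≡.sym W≡) (≡.sym eq)))) waiting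

      rising-step : ∀ s t {l₁ l₂ r} → TokenView (up a) l₁ l₂ r → (s ++ l₁) ++ l₂ ++ t ≡ W → Ends W → Stage (s ++ r ++ t)
      rising-step s t (turn .a) W≡ ends
        with refl ← nothing-before-⟦ s (≡.trans (≡.sym W≡) (∷ʳ-++ s (lc ⟦) t)) = falling [] t W≡ ends
      rising-step s t (rise z .a) W≡ ends = rising s (z ∷ t) (≡.trans (≡.sym (∷ʳ-++ s z t)) W≡) ends
      rising-step s t (two b) W≡ ends = ⊥-elim (no-token (s ++ []) t (up b) (≡.sym W≡))
      rising-step s t {l₁} {l₂} (loop refl) W≡ ends = subst Stage (≡.sym (reassociate s l₁)) (rising (s ++ l₁) (l₂ ++ t) W≡ ends)

      falling-step : ∀ w s t {l₁ l₂ r} → TokenView (down a) l₁ l₂ r → lc ⟦ ∷ map lc (cells w) ≡ s ++ l₁ →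
                     (lc ⟦ ∷ map lc (cells w)) ++ l₂ ++ t ≡ W → Ends W → Stage (s ++ r ++ t)
      falling-step w s t (two b) p≡ W≡ ends = ⊥-elim (no-token (lc ⟦ ∷ map lc (cells w)) t (up b) (≡.sym W≡))
      falling-step w s t (fall B .a) p≡ W≡ ends =
        subst Stage (≡.trans (cong (_++ down a ∷ t) snoc≡) (≡.trans (∷ʳ-++ (lc ⟦ ∷ map lc (cells w)) (lc (sym B)) _)
                       (cong (_++ lc (sym B) ∷ down a ∷ t) s≡)))
              (falling (w ∷ʳ B) t (≡.trans (cong (_++ t) snoc≡) (≡.trans (∷ʳ-++ (lc ⟦ ∷ map lc (cells w)) (lc (sym B)) t) W≡)) ends)
        where
        s≡ : lc ⟦ ∷ map lc (cells w) ≡ s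
        s≡ = ≡.trans p≡ (++-identityʳ s)
        snoc≡ : lc ⟦ ∷ map lc (cells (w ∷ʳ B)) ≡ (lc ⟦ ∷ map lc (cells w)) ∷ʳ lc (sym B)
        snoc≡ = cong (lc ⟦ ∷_) (≡.trans (cong (map lc) (cells-∷ʳ w B)) (map-++ lc (cells w) [ sym B ]))
      falling-step w s t (ins {p} {X} {_} {q} {B} r∈) p≡ W≡ ends =
        subst (λ s → Stage (s ++ hd q ∷ rc (sym B) ∷ rc X ∷ t)) (≡.trans p≡ (++-identityʳ s)) (insert-sound w r∈ W≡ ends)
      falling-step w s t {l₁} {l₂} (loop refl) p≡ W≡ ends =
        subst Stage (≡.sym (≡.trans (reassociate s l₁) (cong (_++ down a ∷ l₂ ++ t) (≡.sym p≡)))) (falling w (l₂ ++ t) W≡ ends)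

      -- A rule applying beside the token would also apply to `W`, which is irreducible. So every
      -- step up to the insertion involves the token.
      apart : ∀ p {x z s l r t} {B : Set} → IsRule (l , r) → p ++ z ≡ W → Occurrence p x z s l t →
              (∀ l₁ l₂ → l ≡ l₁ ++ x ∷ l₂ → p ≡ s ++ l₁ → z ≡ l₂ ++ t → B) → B
      apart p ρ W≡ (around l₁ l₂ l≡ p≡ z≡) k = k l₁ l₂ l≡ p≡ z≡
      apart p {s = s} {l} ρ W≡ (prior v′ refl) k =
        ⊥-elim (W-nf s _ (R⁺ ρ) (≡.trans (≡.sym W≡) (≡.trans (++-assoc s (l ++ v′) _) (cong (s ++_) (++-assoc l v′ _)))))
      apart p ρ W≡ (later u′ refl) k = ⊥-elim (W-nf (p ++ u′) _ (R⁺ ρ) (≡.trans (≡.sym W≡) (≡.sym (++-assoc p u′ _))))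

      stage-step : ∀ {w} s t {l r} → IsRule (l , r) → Stage w → w ≡ s ++ l ++ t → Stage (s ++ r ++ t)
      stage-step s t {l} ρ waiting eq = apart W ρ (++-identityʳ W) (locate W s l eq)
        λ l₁ l₂ l≡ W≡ z≡ → waiting-step s t (view ρ (new a) l₁ l₂ l≡) W≡ z≡
      stage-step s t {l} ρ (rising p z W≡ ends) eq = apart p ρ W≡ (locate p s l eq)
        λ { l₁ l₂ l≡ refl refl → rising-step s t (view ρ (up a) l₁ l₂ l≡) W≡ ends }
      stage-step s t {l} ρ (falling w z W≡ ends) eq = apart (lc ⟦ ∷ map lc (cells w)) ρ W≡ (locate (lc ⟦ ∷ map lc (cells w)) s l eq)
        λ { l₁ l₂ l≡ p≡ refl → falling-step w s t (view ρ (down a) l₁ l₂ l≡) p≡ W≡ ends }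
      stage-step s t ρ (running {c} {d} {c′} W≡ config first rest) eq with ε-sound c′ s t ρ eq
      ... | c″ , eq′ , more = subst Stage (≡.sym eq′) (running W≡ config first (rest ◅◅ more))

      stages : ∀ {w w′} → Star (Rewrite R) w w′ → Stage w → Stage w′
      stages ε stage = stage
      stages (rewriting s t ρ∈ ◅ ss) stage = stages ss (stage-step s t (R⁻ ρ∈) stage refl)

    input′ : A ↣ Ω
    input′ = mk↣ {to = new} (λ { refl → refl })

    G⁺ : ∀ {c a c′} → transitionGraph M N (c , a , c′) → cayleyGraph R input′ (enc c , a , enc c′)
    G⁺ (ext@(config , _) , ext′ , d , first , rest) =
      enc-NF ext , enc-NF ext′ , (insert-complete config first ◅◅ Star.gmap enc ε-complete rest)

    Edge : List Ω → A → List Ω → Set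
    Edge s a t = ∃₂ λ c c′ → s ≡ enc c × t ≡ enc c′ × transitionGraph M N (c , a , c′)

    -- While a token is present a loop applies, so a normal form is reached only after the
    -- insertion, when the word encodes a configuration.
    G⁻ : ∀ {s a t} → cayleyGraph R input′ (s , a , t) → Edge s a t
    G⁻ {s} {a} {t} (s-nf , t-nf , steps) = go (stages s s-nf a steps waiting) s-nf t-nf
      where
      go : ∀ {t} → Stage s s-nf a t → NF R s → NF R t → Edge s a t
      go waiting           _ t-nf = ⊥-elim (t-nf s [] (R⁺ (loop₁ (new a))) refl)
      go (rising p z _ _)  _ t-nf = ⊥-elim (t-nf p z (R⁺ (loop₁ (up a))) refl)
      go (falling w z _ _) _ t-nf = ⊥-elim (t-nf (lc ⟦ ∷ map lc (cells w)) z (R⁺ (loop₁ (down a))) refl)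
      go (running {c} {d} {c′} refl config first rest) s-nf t-nf =
        c , c′ , refl , refl , (config , NF-external config s-nf) , (config′ , NF-external config′ t-nf) , d , first , rest
        where
        config′ : IsConfiguration c′
        config′ = steps-configuration M rest (step-configuration M first config)

  transitionGraph-isCayleyTypeGraph : IsCayleyTypeGraph (transitionGraph M N)
  transitionGraph-isCayleyTypeGraph =
    Ω , Ω-finite , input′ , R , decreasing , code⇒≅ enc (λ _ _ → enc-injective) G⁺ G⁻

-- Closing the cycle

module _ {V W A : Set} {G : Graph V A} {H : Graph W A} where

  ≅-isCayleyTypeGraph : G ≅ H → IsCayleyTypeGraph H → IsCayleyTypeGraph G
  ≅-isCayleyTypeGraph iso (Γ , Γ-finite , ι , R , decreasing , iso′) = Γ , Γ-finite , ι , R , decreasing , ≅-trans iso iso′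

  ≅-isTransitionGraph : G ≅ H → IsTransitionGraph H → IsTransitionGraph G
  ≅-isTransitionGraph iso (M , N , iso′) = M , N , ≅-trans iso iso′

Transition⇒Cayley : ∀ {A V : Set} {G : Graph V A} → Finite A → IsTransitionGraph G → IsCayleyTypeGraph G
Transition⇒Cayley A-finite (M , N , iso) = ≅-isCayleyTypeGraph iso (transitionGraph-isCayleyTypeGraph A-finite M N)

Transduction⇒Transition : ∀ {A V : Set} {G : Graph V A} → Finite A → IsTransductionGraph G → IsTransitionGraph G
Transduction⇒Transition {A} A-finite (Γ , Γ-finite , T , transductions , iso) =
  ≅-isTransitionGraph iso (transductionGraph-isTransitionGraph A-finite Γ-finite T k-1 incremental
    (λ a → proj₁ (proj₂ (proj₂ (transductions a)))) (λ a → proj₂ (proj₂ (proj₂ (transductions a)))))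
  where
  increments : List ℕ
  increments = map (λ a → proj₁ (transductions a)) (elements A-finite)
  -- One increment must serve all letters, since they share one tape alphabet. Chunks have length
  -- `suc k-1`, which is positive even if no transduction grows.
  k-1 : ℕ
  k-1 = max 0 increments
  incremental : ∀ a → IncrementalBy (T a) (suc k-1)
  incremental a {u} Tuv = ℕ.≤-trans (proj₁ (proj₂ (transductions a)) Tuv) (ℕ.+-monoʳ-≤ (length u)
    (ℕ.m≤n⇒m≤1+n (All.lookup (xs≤max 0 increments) (∈-map⁺ (λ a → proj₁ (transductions a)) (∈-elements A-finite a)))))

theorem4 : (A : Set) → Finite A → (V : Set) → Countable V → (G : Graph V A) →
    (IsTransitionGraph G ⇔ IsCayleyTypeGraph G) ×
    (IsCayleyTypeGraph G ⇔ IsTransductionGraph G)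
theorem4 A A-finite V _ G =
  mk⇔ (Transition⇒Cayley A-finite) (Transduction⇒Transition A-finite ∘ Cayley⇒Transduction) ,
  mk⇔ Cayley⇒Transduction (Transition⇒Cayley A-finite ∘ Transduction⇒Transition A-finite)
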